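{- For all integers $\ell\geq 4$, $t\geq 3$, $q_2\geq 1$ and every real $\varepsilon>0$, there exists $q_0$ such that for all $q_1\geq q_0$, \[ s_{q_1+q_2}(\mathcal{T}(q_1,q_2,\ell,t))\leq (1+\varepsilon)q_1. \]
   Context: All graphs are finite and simple. For graphs $H_1,\dots,H_q$, a graph $G$ is $q$-Ramsey for $(H_1,\dots,H_q)$ if every coloring of the edges of $G$ with colors $1,\dots,q$ contains, for some $i\in[q]$, a copy of $H_i$ all of whose edges have color $i$. $G$ is $q$-Ramsey-minimal for the tuple if it is $q$-Ramsey for it but no proper subgraph of $G$ is. $s_q(H_1,\dots,H_q)$ is the minimum of the minimum degree $\delta(G)$ over all $q$-Ramsey-minimal graphs $G$ for $(H_1,\dots,H_q)$. $\mathcal{T}(q_1,q_2,\ell,t)$ denotes the $(q_1+q_2)$-tuple consisting of $q_1$ copies of the cycle $C_\ell$ on $\ell$ vertices followed by $q_2$ copies of the complete graph $K_t$. -}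

module Defs where

open import Data.Nat using (ℕ; zero; suc; _+_; _*_; _∸_; _≤_; _<_)
open import Data.Bool using (Bool; true; false; _∧_; _∨_; not; if_then_else_)
open import Data.Bool.Properties using (∨-comm)
open import Data.Fin using (Fin; toℕ; splitAt; _≟_)
open import Data.Fin.Properties using ()
open import Data.List using (List; map; allFin)
open import Data.Nat.ListAction using (sum)
open import Data.Product using (Σ; ∃; ∃-syntax; _×_; _,_)
open import Data.Sum using (_⊎_; inj₁; inj₂; [_,_]′)
open import Data.Empty using (⊥; ⊥-elim)
open import Relation.Nullary using (¬_; yes; no)
open import Relation.Nullary.Decidable using (⌊_⌋)
open import Relation.Binary.PropositionalEquality using (_≡_; refl; cong; cong₂; trans) renaming (sym to ≡-sym)
open import Function using (const)
open import Function.Definitions using (Injective)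

record Graph : Set where
  field
    size   : ℕ
    adj    : Fin size → Fin size → Bool
    adj-sym    : ∀ u v → adj u v ≡ adj v u
    adj-irrefl : ∀ u → adj u u ≡ false
open Graph public

private
  eqᵇ : ∀ {n} → Fin n → Fin n → Bool
  eqᵇ u v = ⌊ u ≟ v ⌋

  eqᵇ-sym : ∀ {n} (u v : Fin n) → eqᵇ u v ≡ eqᵇ v u
  eqᵇ-sym u v with u ≟ v | v ≟ u
  ... | yes _ | yes _ = refl
  ... | no _  | no _  = refl
  ... | yes p | no q  = ⊥-elim (q (≡-sym p))
  ... | no q  | yes p = ⊥-elim (q (≡-sym p))

  eqᵇ-refl : ∀ {n} (u : Fin n) → eqᵇ u u ≡ true
  eqᵇ-refl u with u ≟ u
  ... | yes _ = refl
  ... | no q  = ⊥-elim (q refl)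

  ∧-false : ∀ b → b ∧ false ≡ false
  ∧-false true = refl
  ∧-false false = refl

simpleGraph : (n : ℕ) → (Fin n → Fin n → Bool) → Graph
simpleGraph n r = record
  { size   = n
  ; adj    = λ u v → (r u v ∨ r v u) ∧ not (eqᵇ u v)
  ; adj-sym    = λ u v → cong₂ _∧_ (∨-comm (r u v) (r v u)) (cong not (eqᵇ-sym u v))
  ; adj-irrefl = λ u → trans
                     (cong (λ b → (r u u ∨ r u u) ∧ not b) (eqᵇ-refl u))
                     (∧-false (r u u ∨ r u u))
  }

-- The cycle C_ℓ on vertices 0,…,ℓ-1 with edges {i,i+1} and {ℓ-1,0}
-- (a genuine cycle for ℓ ≥ 3).
cycle : ℕ → Graph
cycle ℓ = simpleGraph ℓ (λ i j → (toℕ j Data.Nat.≡ᵇ suc (toℕ i))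
                                  ∨ ((toℕ i Data.Nat.≡ᵇ (ℓ ∸ 1)) ∧ (toℕ j Data.Nat.≡ᵇ 0)))
  where import Data.Nat

complete : ℕ → Graph
complete t = simpleGraph t (λ _ _ → true)

𝒯 : (q₁ q₂ ℓ t : ℕ) → Fin (q₁ + q₂) → Graph
𝒯 q₁ q₂ ℓ t i = [ const (cycle ℓ) , const (complete t) ]′ (splitAt q₁ i)

-- A q-colouring of the edges of G (a symmetric colour assignment to
-- ordered pairs; values on non-edges are irrelevant).
Colouring : ℕ → Graph → Set
Colouring q G = Σ (Fin (size G) → Fin (size G) → Fin q) λ c → ∀ u v → c u v ≡ c v u

MonoCopy : ∀ {q} (G : Graph) → Colouring q G → Fin q → Graph → Set
MonoCopy G (c , _) i H =
  Σ (Fin (size H) → Fin (size G)) λ f →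
    Injective _≡_ _≡_ f ×
    (∀ u v → adj H u v ≡ true → (adj G (f u) (f v) ≡ true) × (c (f u) (f v) ≡ i))

IsRamsey : (q : ℕ) → (Fin q → Graph) → Graph → Set
IsRamsey q Hs G = (c : Colouring q G) → ∃[ i ] MonoCopy G c i (Hs i)

ProperSubgraph : Graph → Graph → Set
ProperSubgraph H G =
  Σ (Fin (size H) → Fin (size G)) λ f →
    Injective _≡_ _≡_ f ×
    (∀ u v → adj H u v ≡ true → adj G (f u) (f v) ≡ true) ×
    ((size H < size G) ⊎ (∃[ u ] ∃[ v ] (adj G (f u) (f v) ≡ true × adj H u v ≡ false)))

IsRamseyMinimal : (q : ℕ) → (Fin q → Graph) → Graph → Set
IsRamseyMinimal q Hs G = IsRamsey q Hs G × (∀ H → ProperSubgraph H G → ¬ IsRamsey q Hs H)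

degree : (G : Graph) → Fin (size G) → ℕ
degree G v = sum (map (λ u → if adj G v u then 1 else 0) (allFin (size G)))

-- "s_q(Hs) ≤ x" with x = m / d a nonnegative rational (d > 0):
-- some q-Ramsey-minimal graph G has minimum degree δ(G) ≤ m/d,
-- i.e. some vertex v of G with d · deg(v) ≤ m.
sLeFrac : (q : ℕ) → (Fin q → Graph) → (m d : ℕ) → Set
sLeFrac q Hs m d = ∃[ G ] (IsRamseyMinimal q Hs G × ∃[ v ] (d * degree G v ≤ m))

{-# OPTIONS --safe #-}
-- Let ρ be maximal such that the complete graph K_ρ has a q₂-colouring without monochromatic K_t.  If Γ has a good
-- colouring, but becomes Ramsey once a new vertex is attached to every n-tuple of vertices of Γ, then a minimal Ramsey
-- subgraph uses a new vertex, so its minimum degree is at most n; we need such a Γ with b n ≤ (b + a) q₁.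
--
-- The vertices of Γ carry tuples of numbers below some large N, and two of them are adjacent if their tuples realise one
-- of finitely many order patterns, the types.  By Ramsey's theorem one may assume that the colour of an edge depends
-- only on its type, and the colour of an edge at a new vertex only on its position among the n edges there.  For each
-- type the complete family of its edges is rich enough in cycles C_ℓ to exclude the cycle colours, except on q₁ types
-- that must then receive the q₁ cycle colours bijectively, and these exclude two positions of the same cycle colour.
-- (For odd ℓ these types shift a window of numbers; for even ℓ they join a vertex to q₁ neighbours in each of ρ roles,
-- and K_{ρ+1} being Ramsey forces them to be cycle coloured in one role.)  Hence all but q₁ positions are clique
-- coloured.  The positions are joined according to a coloured graph on n vertices without monochromatic K_t in which
-- any n − q₁ vertices contain a K_ρ; with the new vertex this is a clique-coloured K_{ρ+1}, which is Ramsey.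
--
-- That graph is built as in Zykov's construction.  From a structure in which sets without K_{r+1} have density at most
-- μ, an amalgam of copies lowers μ to about μ − μ²/2, because vertices of one copy are joined to copies of K_r in many
-- others; iterating this makes μ arbitrarily small, and then r is increased.
module Submission where

open import Defs
open import Data.Nat using (ℕ; zero; suc; pred; _+_; _*_; _∸_; _^_; _≤_; _<_; z≤n; s≤s; _≤?_; _<?_; _≡ᵇ_; _⊓_; NonZero; >-nonZero)
open import Data.Nat.DivMod using (_/_; _%_; m≡m%n+[m/n]*n; m%n<n; m/n*n≤m; /-monoˡ-≤; [m+kn]%n≡m%n; m<n⇒m%n≡m; m<n⇒m/n≡0; +-distrib-/-∣ʳ; m*n/n≡m)
open import Data.Nat.Divisibility using (divides)
open import Data.Nat.ListAction using (sum)
open import Data.Nat.Solver using (module +-*-Solver)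
open import Data.Bool using (Bool; true; false; _∧_; _∨_; not; if_then_else_)
open import Data.Fin using (Fin; zero; suc; toℕ; fromℕ<; inject≤; splitAt; _↑ˡ_; _↑ʳ_; combine; quotient; remainder; funToFin; finToFun; join; punchIn; punchOut)
open import Data.List using (List; []; _∷_; _++_; map; concatMap; length; allFin; tabulate; lookup)
open import Data.List.Properties using (length-tabulate; tabulate-cong; map-tabulate)
open import Data.List.Relation.Binary.Sublist.Propositional using (_⊆_; []; _∷_; _∷ʳ_; ⊆-refl; ⊆-trans; minimum)
open import Data.List.Relation.Binary.Sublist.Propositional.Properties using (All-resp-⊆)
open import Data.List.Relation.Unary.All using (All; []; _∷_)
open import Data.List.Relation.Unary.AllPairs using (AllPairs; []; _∷_)
open import Data.List.Relation.Unary.Unique.Propositional using (Unique)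
open import Data.List.Relation.Unary.Unique.Propositional.Properties using (allFin⁺)
open import Data.Vec using (Vec; []; _∷_)
open import Data.Maybe using (Maybe; just; nothing)
open import Data.Maybe.Properties using (just-injective)
open import Data.Product using (Σ; ∃; ∃-syntax; _×_; _,_; proj₁; proj₂)
open import Data.Sum using (_⊎_; inj₁; inj₂)
open import Data.Sum.Properties using (inj₁-injective; inj₂-injective)
open import Data.Empty using (⊥; ⊥-elim)
open import Relation.Nullary using (¬_; Dec; yes; no; contradiction)
open import Relation.Nullary.Decidable using (⌊_⌋; _×-dec_; _→-dec_; map′)
open import Relation.Binary.Definitions using (Tri; tri<; tri≈; tri>)
open import Relation.Binary.PropositionalEquality using (_≡_; _≢_; _≗_; refl; sym; trans; cong; cong₂; subst; subst₂)
open import Function using (_∘_; id)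
open import Function.Definitions using (Injective)
open import Function.Bundles using (module Equivalence)
import Data.Nat.Properties as ℕ
import Data.Bool.Properties as 𝔹
import Data.Fin as Fin
import Data.Fin.Properties as F
import Data.List.Relation.Unary.All as All
import Data.List.Relation.Unary.AllPairs.Properties as AllPairs
import Data.Vec as Vec

-- Exhaustive search

-- All forced copies are built in the infinite graph whose numbers range over ℕ, where there is
-- always room. Types and positions admit finitely many colour assignments, so finitely many finite
-- copies suffice, and their size decides how large `N` must be.
--
-- In the intended colouring a cycle colour must avoid `C_ℓ`, although it must produce `C_ℓ` as soon
-- as it serves two purposes. For odd ℓ the shifts of one colour have a height, the place of the
-- window, so their closed walks are even. The other windows jump instead of staying put: staying
-- would make two kinds of shift generate a bipartite grid, whereas jumps of arbitrary length let
-- them close up to an odd cycle. Such a colour class contains even cycles, so for even ℓ it is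
-- replaced by a forest of stars: a vertex of a position sees each cycle colour only once, and hub
-- vertices are the centres.

Searchable : (A : Set) → (A → A → Set) → Set₁
Searchable A _≈_ = ∀ {P Q : A → Set} → (∀ {x y} → x ≈ y → P x → P y) →
                   (∀ x → P x ⊎ Q x) → (∀ x → P x) ⊎ ∃ Q

searchable-Fin : ∀ {n} → Searchable (Fin n) _≡_
searchable-Fin {zero}  resp dec = inj₁ λ ()
searchable-Fin {suc n} {P} {Q} resp dec with dec zero | searchable-Fin {n} {P ∘ suc} {Q ∘ suc} (λ { refl p → p }) (dec ∘ suc)
... | inj₂ q | _              = inj₂ (zero , q)
... | inj₁ _ | inj₂ (x , q)   = inj₂ (suc x , q)
... | inj₁ p | inj₁ ps        = inj₁ λ { zero → p ; (suc x) → ps x }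

module _ {A : Set} {_≈_ : A → A → Set} (≈-refl : ∀ {x} → x ≈ x) where

  private
    cons : ∀ {n} → A → (Fin n → A) → Fin (suc n) → A
    cons x h zero    = x
    cons x h (suc i) = h i

  -- Functions on `Fin n` are enumerated only up to pointwise equality, so `P` has to respect it;
  -- the witness for `Q` comes from the enumeration itself. `P` and `Q` need not be complementary,
  -- so that both outcomes carry positive data, such as a colouring that avoids all copies.
  searchable-→ : Searchable A _≈_ → ∀ {n} → Searchable (Fin n → A) (λ f g → ∀ i → f i ≈ g i)
  searchable-→ s {zero} resp dec with dec (λ ())
  ... | inj₁ p = inj₁ λ f → resp (λ ()) p
  ... | inj₂ q = inj₂ (_ , q)
  searchable-→ s {suc n} {P} {Q} resp dec
    with s {P = λ x → ∀ h → P (cons x h)} {Q = λ x → ∃ λ h → Q (cons x h)}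
           (λ x≈y p h → resp (λ { zero → x≈y ; (suc i) → ≈-refl }) (p h))
           (λ x → searchable-→ s {n} {λ h → P (cons x h)} {λ h → Q (cons x h)}
                    (λ h≈g → resp (λ { zero → ≈-refl ; (suc i) → h≈g i }))
                    (λ h → dec (cons x h)))
  ... | inj₁ p = inj₁ λ f → resp (λ { zero → ≈-refl ; (suc i) → ≈-refl }) (p (f zero) (f ∘ suc))
  ... | inj₂ (x , h , q) = inj₂ (_ , q)

searchable-fun : ∀ {m n} → Searchable (Fin m → Fin n) _≗_
searchable-fun = searchable-→ refl searchable-Fin

searchable-fun² : ∀ {m n k} → Searchable (Fin m → Fin n → Fin k) (λ f g → ∀ i → f i ≗ g i)
searchable-fun² = searchable-→ (λ _ → refl) searchable-fun

any-fun? : ∀ {m n} {P : (Fin m → Fin n) → Set} → (∀ {f g} → f ≗ g → P f → P g) →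
           (∀ f → Dec (P f)) → Dec (∃ P)
any-fun? {P = P} resp P? with searchable-fun {P = λ f → ¬ P f} {Q = P}
    (λ f≗g ¬p p → ¬p (resp (λ x → sym (f≗g x)) p)) (λ f → split (P? f))
  where split : ∀ {A : Set} → Dec A → ¬ A ⊎ A
        split (yes a) = inj₂ a
        split (no ¬a) = inj₁ ¬a
... | inj₁ ¬p = no λ { (f , p) → ¬p f p }
... | inj₂ p  = yes p

any-fun²? : ∀ {m n k} {P : (Fin m → Fin n → Fin k) → Set} → (∀ {f g} → (∀ i → f i ≗ g i) → P f → P g) →
            (∀ f → Dec (P f)) → Dec (∃ P)
any-fun²? {P = P} resp P? with searchable-fun² {P = λ f → ¬ P f} {Q = P}
    (λ f≗g ¬p p → ¬p (resp (λ x y → sym (f≗g x y)) p)) (λ f → split (P? f))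
  where split : ∀ {A : Set} → Dec A → ¬ A ⊎ A
        split (yes a) = inj₂ a
        split (no ¬a) = inj₁ ¬a
... | inj₁ ¬p = no λ { (f , p) → ¬p f p }
... | inj₂ p  = yes p

-- The search for colourings runs over arbitrary functions of two arguments. Reading them only at
-- `u ≤ v` makes them symmetric and leaves symmetric ones unchanged, so no colouring is lost.
symmetrize : ∀ {n} {A : Set} → (Fin n → Fin n → A) → Fin n → Fin n → A
symmetrize c u v with toℕ u ≤? toℕ v
... | yes _ = c u v
... | no  _ = c v u

symmetrize-sym : ∀ {n} {A : Set} (c : Fin n → Fin n → A) u v → symmetrize c u v ≡ symmetrize c v u
symmetrize-sym c u v with toℕ u ≤? toℕ v | toℕ v ≤? toℕ u
... | yes p | yes q with F.toℕ-injective (ℕ.≤-antisym p q)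
...   | refl = refl
symmetrize-sym c u v | yes p | no q = refl
symmetrize-sym c u v | no p | yes q = refl
symmetrize-sym c u v | no p | no q = ⊥-elim (p (ℕ.<⇒≤ (ℕ.≰⇒> q)))

symmetrize-cases : ∀ {n} {A : Set} (c : Fin n → Fin n → A) u v → symmetrize c u v ≡ c u v ⊎ symmetrize c u v ≡ c v u
symmetrize-cases c u v with toℕ u ≤? toℕ v
... | yes _ = inj₁ refl
... | no  _ = inj₂ refl

symmetrize-id : ∀ {n} {A : Set} (c : Fin n → Fin n → A) → (∀ u v → c u v ≡ c v u) → ∀ u v → symmetrize c u v ≡ c u v
symmetrize-id c s u v with symmetrize-cases c u v
... | inj₁ e = e
... | inj₂ e = trans e (s v u)

symmetrize-cong : ∀ {n} {A : Set} {c d : Fin n → Fin n → A} → (∀ u v → c u v ≡ d u v) → ∀ u v → symmetrize c u v ≡ symmetrize d u v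
symmetrize-cong e u v with toℕ u ≤? toℕ v
... | yes _ = e u v
... | no  _ = e v u

-- Finite sums over allFin

-- Written in the form of `degree`, so that degrees are such sums by definition.
Σ[_] : ∀ {n} → (Fin n → ℕ) → ℕ
Σ[_] {n} f = sum (map f (allFin n))

Σ-suc : ∀ {n} (f : Fin (suc n) → ℕ) → Σ[ f ] ≡ f zero + Σ[ f ∘ suc ]
Σ-suc {n} f = cong (λ l → f zero + sum l)
  (trans (map-tabulate suc f) (sym (map-tabulate id (f ∘ suc))))

Σ-mono : ∀ {n} {f g : Fin n → ℕ} → (∀ i → f i ≤ g i) → Σ[ f ] ≤ Σ[ g ]
Σ-mono {zero}  p = z≤n
Σ-mono {suc n} {f} {g} p rewrite Σ-suc f | Σ-suc g = ℕ.+-mono-≤ (p zero) (Σ-mono (p ∘ suc))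

Σ-strict : ∀ {n} {f g : Fin n → ℕ} → (∀ i → f i ≤ g i) → ∀ j → f j < g j → Σ[ f ] < Σ[ g ]
Σ-strict {suc n} {f} {g} p zero q rewrite Σ-suc f | Σ-suc g = ℕ.+-mono-<-≤ q (Σ-mono (p ∘ suc))
Σ-strict {suc n} {f} {g} p (suc j) q rewrite Σ-suc f | Σ-suc g = ℕ.+-mono-≤-< (p zero) (Σ-strict (p ∘ suc) j q)

Σ-zero : ∀ n → Σ[ (λ (_ : Fin n) → 0) ] ≡ 0
Σ-zero zero = refl
Σ-zero (suc n) = trans (Σ-suc {n} (λ _ → 0)) (Σ-zero n)

Σ-one : ∀ n → Σ[ (λ (_ : Fin n) → 1) ] ≡ n
Σ-one zero = refl
Σ-one (suc n) = trans (Σ-suc {n} (λ _ → 1)) (cong suc (Σ-one n))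

Σ-+ : ∀ {n} (f g : Fin n → ℕ) → Σ[ (λ i → f i + g i) ] ≡ Σ[ f ] + Σ[ g ]
Σ-+ {zero} f g = refl
Σ-+ {suc n} f g rewrite Σ-suc (λ i → f i + g i) | Σ-suc f | Σ-suc g | Σ-+ (f ∘ suc) (g ∘ suc) =
  interchange (f zero) (g zero) Σ[ f ∘ suc ] Σ[ g ∘ suc ]
  where open import Algebra.Properties.CommutativeSemigroup ℕ.+-commutativeSemigroup using (interchange)

Σ-swap : ∀ {m n} (f : Fin m → Fin n → ℕ) → Σ[ (λ i → Σ[ f i ]) ] ≡ Σ[ (λ j → Σ[ (λ i → f i j) ]) ]
Σ-swap {zero} {n} f = sym (Σ-zero n)
Σ-swap {suc m} f = trans (Σ-suc (λ i → Σ[ f i ])) (trans (cong (Σ[ f zero ] +_) (Σ-swap (f ∘ suc)))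
  (trans (sym (Σ-+ (f zero) (λ j → Σ[ (λ i → f (suc i) j) ]))) (cong-Σ (λ j → sym (Σ-suc (λ i → f i j))))))
  where
  cong-Σ : ∀ {n} {f g : Fin n → ℕ} → f ≗ g → Σ[ f ] ≡ Σ[ g ]
  cong-Σ {zero} e = refl
  cong-Σ {suc n} {f} {g} e rewrite Σ-suc f | Σ-suc g = cong₂ _+_ (e zero) (cong-Σ (e ∘ suc))

Σ-term : ∀ {n} (f : Fin n → ℕ) i → f i ≤ Σ[ f ]
Σ-term {suc n} f zero    rewrite Σ-suc f = ℕ.m≤m+n _ _
Σ-term {suc n} f (suc i) rewrite Σ-suc f = ℕ.≤-trans (Σ-term (f ∘ suc) i) (ℕ.m≤n+m _ (f zero))

Σ-atMostOne : ∀ {n} (P : Fin n → Bool) → (∀ i j → P i ≡ true → P j ≡ true → i ≡ j) →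
              Σ[ (λ i → if P i then 1 else 0) ] ≤ 1
Σ-atMostOne {zero} P u = z≤n
Σ-atMostOne {suc n} P u rewrite Σ-suc (λ i → if P i then 1 else 0) with P zero in eq
... | false = Σ-atMostOne (P ∘ suc) (λ i j p q → F.suc-injective (u (suc i) (suc j) p q))
... | true  = s≤s (ℕ.≤-trans (Σ-mono (λ i → ℕ.≤-reflexive (off i))) (ℕ.≤-reflexive (Σ-zero n)))
  where
  off : ∀ i → (if P (suc i) then 1 else 0) ≡ 0
  off i with P (suc i) in e
  ... | false = refl
  ... | true with u zero (suc i) eq e
  ...   | ()

-- Minimal Ramsey subgraphs

Embedding : Graph → Graph → Set
Embedding H G = Σ (Fin (size H) → Fin (size G)) λ f → Injective _≡_ _≡_ f ×
                (∀ u v → adj H u v ≡ true → adj G (f u) (f v) ≡ true)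

Embedding-refl : ∀ G → Embedding G G
Embedding-refl G = id , id , λ _ _ e → e

Embedding-trans : ∀ {G H K} → Embedding G H → Embedding H K → Embedding G K
Embedding-trans (f , fi , fa) (g , gi , ga) = g ∘ f , (λ e → fi (gi e)) , λ u v e → ga _ _ (fa u v e)

private
  sameᵇ : ∀ {n} → Fin n → Fin n → Bool
  sameᵇ u v = ⌊ u F.≟ v ⌋

  sameᵇ-sound : ∀ {n} {u v : Fin n} → sameᵇ u v ≡ true → u ≡ v
  sameᵇ-sound {u = u} {v} e with u F.≟ v
  ... | yes p = p
  ... | no _  = contradiction e λ ()

  same-refl : ∀ {n} (u : Fin n) → sameᵇ u u ≡ true
  same-refl u with u F.≟ u
  ... | yes _ = refl
  ... | no ¬p = ⊥-elim (¬p refl)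

  ∧-true : ∀ {a b} → a ∧ b ≡ true → a ≡ true × b ≡ true
  ∧-true {true} {true} _ = refl , refl

  ∨-true : ∀ {a b} → a ∨ b ≡ true → a ≡ true ⊎ b ≡ true
  ∨-true {true} _ = inj₁ refl
  ∨-true {false} e = inj₂ e

  isEdge : ∀ {n} → Fin n → Fin n → Fin n → Fin n → Bool
  isEdge u v x y = (sameᵇ x u ∧ sameᵇ y v) ∨ (sameᵇ x v ∧ sameᵇ y u)

deleteEdge : (G : Graph) → Fin (size G) → Fin (size G) → Graph
deleteEdge G u v = record
  { size = size G
  ; adj = λ x y → adj G x y ∧ not (isEdge u v x y)
  ; adj-sym = λ x y → cong₂ (λ a b → a ∧ not b) (adj-sym G x y)
      (trans (𝔹.∨-comm (sameᵇ x u ∧ sameᵇ y v) _) (cong₂ _∨_ (𝔹.∧-comm (sameᵇ x v) _) (𝔹.∧-comm (sameᵇ x u) _)))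
  ; adj-irrefl = λ x → cong (_∧ not (isEdge u v x x)) (adj-irrefl G x)
  }

deleteEdge-embeds : ∀ G u v → Embedding (deleteEdge G u v) G
deleteEdge-embeds G u v = id , id , λ x y e → proj₁ (∧-true e)

deleteVertex : ∀ {n} (a : Fin (suc n) → Fin (suc n) → Bool) → (∀ u v → a u v ≡ a v u) → (∀ u → a u u ≡ false) →
               Fin (suc n) → Graph
deleteVertex {n} a s i v = record
  { size = n
  ; adj = λ x y → a (punchIn v x) (punchIn v y)
  ; adj-sym = λ x y → s _ _
  ; adj-irrefl = λ x → i _ }

edgeCount : Graph → ℕ
edgeCount G = Σ[ (λ u → Σ[ (λ v → if adj G u v then 1 else 0) ]) ]

edgeCount-deleteEdge : ∀ G u v → adj G u v ≡ true → edgeCount (deleteEdge G u v) < edgeCount G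
edgeCount-deleteEdge G u v e = Σ-strict (λ x → Σ-mono (le x)) u (Σ-strict (le u) v lt)
  where
  le : ∀ x y → (if adj G x y ∧ not (isEdge u v x y) then 1 else 0) ≤ (if adj G x y then 1 else 0)
  le x y with adj G x y | isEdge u v x y
  ... | false | _ = z≤n
  ... | true | false = ℕ.≤-refl
  ... | true | true = z≤n
  lt : (if adj G u v ∧ not (isEdge u v u v) then 1 else 0) < (if adj G u v then 1 else 0)
  lt rewrite e | same-refl u | same-refl v = s≤s z≤n

module _ (q : ℕ) (Hs : Fin q → Graph) where

  monoCopy? : ∀ G (c : Colouring q G) i H → Dec (MonoCopy G c i H)
  monoCopy? G (c , s) i H = any-fun? resp good?
    where
    Good : (Fin (size H) → Fin (size G)) → Set
    Good f = Injective _≡_ _≡_ f ×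
             (∀ u v → adj H u v ≡ true → (adj G (f u) (f v) ≡ true) × (c (f u) (f v) ≡ i))
    resp : ∀ {f g} → f ≗ g → Good f → Good g
    resp e (inj , a) = (λ {x} {y} p → inj (trans (e x) (trans p (sym (e y)))))
                     , λ u v p → subst₂ (λ x y → adj G x y ≡ true × c x y ≡ i) (e u) (e v) (a u v p)
    good? : ∀ f → Dec (Good f)
    good? f = map′ (λ h {x} {y} → h x y) (λ h x y → h {x} {y})
                (F.all? λ x → F.all? λ y → (f x F.≟ f y) →-dec (x F.≟ y))
              ×-dec (F.all? λ u → F.all? λ v → (adj H u v 𝔹.≟ true) →-dec
                       ((adj G (f u) (f v) 𝔹.≟ true) ×-dec (c (f u) (f v) F.≟ i)))

  monoCopy-cong : ∀ G (c d : Colouring q G) → (∀ u v → proj₁ c u v ≡ proj₁ d u v) → ∀ {i H} →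
                  MonoCopy G c i H → MonoCopy G d i H
  monoCopy-cong G c d e (f , inj , a) = f , inj , λ u v p → proj₁ (a u v p) , trans (sym (e _ _)) (proj₂ (a u v p))

  Avoiding : Graph → Set
  Avoiding G = Σ (Colouring q G) λ c → ∀ i → ¬ MonoCopy G c i (Hs i)

  private
    col : ∀ {G} → (Fin (size G) → Fin (size G) → Fin q) → Colouring q G
    col c = symmetrize c , symmetrize-sym c

  ramsey? : ∀ G → IsRamsey q Hs G ⊎ Avoiding G
  ramsey? G with searchable-fun² {P = λ c → ∃ λ i → MonoCopy G (col {G} c) i (Hs i)}
                                 {Q = λ c → ∀ i → ¬ MonoCopy G (col {G} c) i (Hs i)}
                   (λ {c} {d} e (i , m) → i , monoCopy-cong G (col {G} c) (col {G} d) (symmetrize-cong e) {i} {Hs i} m) dec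
    where
    dec : ∀ c → (∃ λ i → MonoCopy G (col {G} c) i (Hs i)) ⊎ (∀ i → ¬ MonoCopy G (col {G} c) i (Hs i))
    dec c with F.any? (λ i → monoCopy? G (col {G} c) i (Hs i))
    ... | yes p = inj₁ p
    ... | no ¬p = inj₂ λ i m → ¬p (i , m)
  ... | inj₁ p = inj₁ λ { (c , s) → let (i , m) = p c in
                          i , monoCopy-cong G (col {G} c) (c , s) (symmetrize-id c s) {i} {Hs i} m }
  ... | inj₂ (c , h) = inj₂ (col {G} c , h)

  embedding-ramsey : ∀ {H G} → Embedding H G → IsRamsey q Hs H → IsRamsey q Hs G
  embedding-ramsey (f , inj , a) R (c , s) with R ((λ u v → c (f u) (f v)) , λ u v → s _ _)
  ... | i , g , ginj , ga = i , f ∘ g , (λ e → ginj (inj e)) , λ u v e → a _ _ (proj₁ (ga u v e)) , proj₂ (ga u v e)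

  avoiding-embedding : ∀ {H G} → Embedding H G → Avoiding G → ¬ IsRamsey q Hs H
  avoiding-embedding {H} {G} emb (c , h) R = let (i , m) = embedding-ramsey {H} {G} emb R c in h i m

  private
    missed : ∀ {m n} (f : Fin m → Fin n) → m < n → ∃ λ v → ∀ u → f u ≢ v
    missed {m} {n} f m<n with F.any? (λ v → F.all? (λ u → nd (f u F.≟ v)))
      where nd : ∀ {A : Set} → Dec A → Dec (¬ A)
            nd (yes a) = no λ k → k a
            nd (no k) = yes k
    ... | yes p = p
    ... | no ¬p = ⊥-elim (ℕ.<⇒≱ m<n (F.injective⇒≤ {f = λ v → proj₁ (pre v)} pre-inj))
      where
      pre : ∀ v → ∃ λ u → f u ≡ v
      pre v with F.any? (λ u → f u F.≟ v)
      ... | yes p = p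
      ... | no ¬q = ⊥-elim (¬p (v , λ u e → ¬q (u , e)))
      pre-inj : ∀ {v w} → proj₁ (pre v) ≡ proj₁ (pre w) → v ≡ w
      pre-inj {v} {w} e = trans (sym (proj₂ (pre v))) (trans (cong f e) (proj₂ (pre w)))

    Deletable : Graph → Set
    Deletable G = ∃ λ u → ∃ λ v → adj G u v ≡ true × IsRamsey q Hs (deleteEdge G u v)

    edge-critical? : ∀ G → Deletable G ⊎ (∀ u v → adj G u v ≡ true → ¬ IsRamsey q Hs (deleteEdge G u v))
    edge-critical? G with searchable-Fin
        {P = λ u → ∀ v → adj G u v ≡ true → ¬ IsRamsey q Hs (deleteEdge G u v)}
        {Q = λ u → ∃ λ v → adj G u v ≡ true × IsRamsey q Hs (deleteEdge G u v)}
        (λ { refl p → p })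
        (λ u → searchable-Fin (λ { refl p → p }) (λ v → one u v))
      where
      one : ∀ u v → (adj G u v ≡ true → ¬ IsRamsey q Hs (deleteEdge G u v)) ⊎
                    (adj G u v ≡ true × IsRamsey q Hs (deleteEdge G u v))
      one u v with adj G u v | ramsey? (deleteEdge G u v)
      ... | false | _ = inj₁ λ ()
      ... | true | inj₁ R = inj₂ (refl , R)
      ... | true | inj₂ (c , h) = inj₁ λ _ R → let (i , m) = R c in h i m
    ... | inj₁ p = inj₂ p
    ... | inj₂ p = inj₁ p

    Minimal-below : Graph → Set
    Minimal-below G = ∃ λ G′ → IsRamseyMinimal q Hs G′ × Embedding G′ G

    embeds-deleteEdge : ∀ H G (S : Embedding H G) u v → adj H u v ≡ false →
                        Embedding H (deleteEdge G (proj₁ S u) (proj₁ S v))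
    embeds-deleteEdge H G (f , inj , a) u v e = f , inj , λ x y p → helper x y p
      where
      helper : ∀ x y → adj H x y ≡ true → adj G (f x) (f y) ∧ not (isEdge (f u) (f v) (f x) (f y)) ≡ true
      helper x y p rewrite a x y p with isEdge (f u) (f v) (f x) (f y) in eq
      ... | false = refl
      ... | true with ∨-true {sameᵇ (f x) (f u) ∧ sameᵇ (f y) (f v)} eq
      ...   | inj₁ r with inj (sameᵇ-sound (proj₁ (∧-true r))) | inj (sameᵇ-sound (proj₂ (∧-true {sameᵇ (f x) (f u)} r)))
      ...     | refl | refl = contradiction (trans (sym p) e) λ ()
      helper x y p | true | inj₂ r with inj (sameᵇ-sound (proj₁ (∧-true r))) | inj (sameᵇ-sound (proj₂ (∧-true {sameᵇ (f x) (f v)} r)))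
      ...     | refl | refl = contradiction (trans (sym p) (trans (adj-sym H x y) e)) λ ()

    -- The hypothesis on smaller graphs survives the deletion of an edge, because what embeds in the
    -- remaining graph embeds in `G`. For this reason vertices are removed before edges.
    minimal-edges : ∀ k G → edgeCount G ≤ k → IsRamsey q Hs G →
                    (∀ {H} → Embedding H G → size H < size G → ¬ IsRamsey q Hs H) → Minimal-below G
    minimal-edges k G ek R crit with edge-critical? G
    ... | inj₂ ec = G , (R , min) , Embedding-refl G
      where
      min : ∀ H → ProperSubgraph H G → ¬ IsRamsey q Hs H
      min H (f , inj , a , inj₁ lt) RH = crit {H} (f , (λ {x} {y} → inj {x} {y}) , a) lt RH
      min H (f , inj , a , inj₂ (u , v , e , ne)) RH =
        ec (f u) (f v) e (embedding-ramsey {H} {deleteEdge G (f u) (f v)} (embeds-deleteEdge H G (f , inj , a) u v ne) RH)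
    minimal-edges zero G ek R crit | inj₁ (u , v , e , R′) = ⊥-elim (ℕ.n≮0 (ℕ.<-≤-trans (edgeCount-deleteEdge G u v e) ek))
    minimal-edges (suc k) G ek R crit | inj₁ (u , v , e , R′)
      with minimal-edges k (deleteEdge G u v) (ℕ.≤-pred (ℕ.≤-trans (edgeCount-deleteEdge G u v e) ek)) R′
             (λ {H} S lt → crit {H} (Embedding-trans {H} {deleteEdge G u v} {G} S (deleteEdge-embeds G u v)) lt)
    ... | G′ , m , S = G′ , m , Embedding-trans {G′} {deleteEdge G u v} {G} S (deleteEdge-embeds G u v)

    -- Once no deletion of a single vertex leaves a Ramsey graph, no smaller graph embedded in `G`
    -- is Ramsey: its embedding misses some vertex and factors through the deletion of that vertex.
    minimal-size : ∀ k G → size G ≤ k → IsRamsey q Hs G → Minimal-below G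
    minimal-size zero G@(record { size = zero }) sk R =
      minimal-edges (edgeCount G) G ℕ.≤-refl R (λ {H} S ())
    minimal-size (suc k) G@(record { size = zero }) sk R =
      minimal-edges (edgeCount G) G ℕ.≤-refl R (λ {H} S ())
    minimal-size (suc k) G@(record { size = suc n ; adj = a ; adj-sym = s ; adj-irrefl = ir }) (s≤s sk) R
      with searchable-Fin {P = λ v → Avoiding (deleteVertex a s ir v)} {Q = λ v → IsRamsey q Hs (deleteVertex a s ir v)}
             (λ { refl p → p }) (λ v → ⊎-swap (ramsey? (deleteVertex a s ir v)))
      where
      ⊎-swap : ∀ {A B : Set} → A ⊎ B → B ⊎ A
      ⊎-swap (inj₁ x) = inj₂ x
      ⊎-swap (inj₂ y) = inj₁ y
    ... | inj₂ (v , R′) = let (G′ , m , S) = minimal-size k (deleteVertex a s ir v) sk R′ in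
          G′ , m , Embedding-trans {G′} {deleteVertex a s ir v} {G} S (punchIn v , (λ {x} {y} → F.punchIn-injective v x y) , λ _ _ e → e)
    ... | inj₁ av = minimal-edges (edgeCount G) G ℕ.≤-refl R λ {H} S lt → crit H S lt
      where
      crit : ∀ H → Embedding H G → size H < size G → ¬ IsRamsey q Hs H
      crit H (f , inj , ad) lt = avoiding-embedding {H} {deleteVertex a s ir v} emb (av v)
        where
        v = proj₁ (missed f lt)
        ne : ∀ u → v ≢ f u
        ne u e = proj₂ (missed f lt) u (sym e)
        emb : Embedding H (deleteVertex a s ir v)
        emb = (λ u → punchOut (ne u)) , (λ {x} {y} e → inj (F.punchOut-injective (ne x) (ne y) e))
            , λ x y p → subst₂ (λ w z → a w z ≡ true) (sym (F.punchIn-punchOut (ne x))) (sym (F.punchIn-punchOut (ne y))) (ad x y p)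

  minimal-subgraph : ∀ G → IsRamsey q Hs G → ∃ λ G′ → IsRamseyMinimal q Hs G′ × Embedding G′ G
  minimal-subgraph G = minimal-size (size G) G ℕ.≤-refl

-- Ramsey's theorem

module _ {A : Set} {c : ℕ} where

  Homogeneous : (List A → Fin c) → ℕ → Fin c → List A → Set
  Homogeneous χ K k ys = ∀ {zs} → zs ⊆ ys → length zs ≡ K → χ zs ≡ k

  -- The intermediate stage of the classical proof: the colour of a sublist of length `suc K`
  -- depends only on its first entry. Sorting the entries by this colour then leaves a pigeonhole
  -- argument.
  data EndHomogeneous (χ : List A → Fin c) (K : ℕ) : List A → Set where
    []  : EndHomogeneous χ K []
    _∷_ : ∀ {y ys} → ∃ (λ k → Homogeneous (χ ∘ (y ∷_)) K k ys) → EndHomogeneous χ K ys → EndHomogeneous χ K (y ∷ ys)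

  module _ {χ : List A → Fin c} {K : ℕ} where

    ofColour : ∀ {ys} → EndHomogeneous χ K ys → Fin c → List A
    ofColour [] k = []
    ofColour (_∷_ {y = y} (l , _) h) k with l F.≟ k
    ... | yes _ = y ∷ ofColour h k
    ... | no  _ = ofColour h k

    ofColour-⊆ : ∀ {ys} (h : EndHomogeneous χ K ys) k → ofColour h k ⊆ ys
    ofColour-⊆ [] k = []
    ofColour-⊆ (_∷_ {y = y} (l , _) h) k with l F.≟ k
    ... | yes _ = refl ∷ ofColour-⊆ h k
    ... | no  _ = y ∷ʳ ofColour-⊆ h k

    ofColour-homogeneous : ∀ {ys} (h : EndHomogeneous χ K ys) k → Homogeneous χ (suc K) k (ofColour h k)
    ofColour-homogeneous [] k [] ()
    ofColour-homogeneous (_∷_ {y = y} (l , hom) h) k s e with l F.≟ k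
    ofColour-homogeneous (_∷_ {y = y} (l , hom) h) k (_ ∷ʳ s) e | yes refl = ofColour-homogeneous h k s e
    ofColour-homogeneous (_∷_ {y = y} (l , hom) h) k (refl ∷ s) e | yes refl = hom (⊆-trans s (ofColour-⊆ h k)) (ℕ.suc-injective e)
    ofColour-homogeneous (_∷_ {y = y} (l , hom) h) k s e | no _ = ofColour-homogeneous h k s e

    ofColour-length : ∀ {ys} (h : EndHomogeneous χ K ys) → length ys ≤ Σ[ (λ k → length (ofColour h k)) ]
    ofColour-length [] = z≤n
    ofColour-length (_∷_ {y = y} (l , hom) h) =
      ℕ.≤-trans (s≤s (ofColour-length h))
        (Σ-strict {f = λ k → length (ofColour h k)} {g = λ k → length (ofColour ((l , hom) ∷ h) k)} le l lt)
      where
      le : ∀ k → length (ofColour h k) ≤ length (ofColour (_∷_ {y = y} (l , hom) h) k)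
      le k with l F.≟ k
      ... | yes _ = ℕ.n≤1+n _
      ... | no  _ = ℕ.≤-refl
      lt : length (ofColour h l) < length (ofColour (_∷_ {y = y} (l , hom) h) l)
      lt with l F.≟ l
      ... | yes _ = ℕ.≤-refl
      ... | no ¬p = ⊥-elim (¬p refl)

    ofColour-large : ∀ {ys} (h : EndHomogeneous χ K ys) M → c * M < length ys → ∃ λ k → M ≤ length (ofColour h k)
    ofColour-large {ys} h M lt with F.any? (λ k → M ≤? length (ofColour h k))
    ... | yes p = p
    ... | no ¬p = ⊥-elim (ℕ.<⇒≱ lt (ℕ.≤-trans (ofColour-length h)
                    (ℕ.≤-trans (Σ-mono (λ k → ℕ.<⇒≤ (ℕ.≰⇒> (λ q → ¬p (k , q))))) (ℕ.≤-reflexive (Σ-const c M)))))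
      where
      Σ-const : ∀ n m → Σ[ (λ (_ : Fin n) → m) ] ≡ n * m
      Σ-const zero m = refl
      Σ-const (suc n) m = trans (Σ-suc {n} (λ _ → m)) (cong (m +_) (Σ-const n m))

-- Sublists stand for subsets listed in order, so that the recursion can pass to sublists without
-- any order on `A`.
RamseyNumber : (c K M N : ℕ) → Set₁
RamseyNumber c K M N = ∀ {A : Set} (xs : List A) → N ≤ length xs → (χ : List A → Fin c) →
  ∃ λ ys → ys ⊆ xs × M ≤ length ys × ∃ λ k → Homogeneous χ K k ys

ramsey : ∀ c K M → ∃ (RamseyNumber c K M)

private
  -- Ramsey's theorem for `K`, applied to the colouring `χ ∘ (x ∷_)` of the tail, fixes the colours
  -- that begin with `x`; thinning the tail further does not disturb them.
  endHomogeneous : ∀ c K m → ∃ λ N → ∀ {A : Set} (xs : List A) → N ≤ length xs → (χ : List A → Fin c) →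
    ∃ λ ys → ys ⊆ xs × m ≤ length ys × EndHomogeneous χ K ys
  endHomogeneous c K zero = 0 , λ xs _ χ → [] , minimum xs , z≤n , []
  endHomogeneous c K (suc m) with endHomogeneous c K m
  ... | N , end with ramsey c K N
  ... | N′ , ram = suc N′ , step
    where
    step : ∀ {A : Set} (xs : List A) → suc N′ ≤ length xs → (χ : List A → Fin c) →
           ∃ λ ys → ys ⊆ xs × suc m ≤ length ys × EndHomogeneous χ K ys
    step (x ∷ xs) (s≤s le) χ with ram xs le (χ ∘ (x ∷_))
    ... | ys , ys⊆xs , le′ , k , hom with end ys le′ χ
    ... | zs , zs⊆ys , le″ , h =
      x ∷ zs , refl ∷ ⊆-trans zs⊆ys ys⊆xs , s≤s le″ , (k , λ s → hom (⊆-trans s zs⊆ys)) ∷ h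

ramsey c zero M = M , λ xs le χ → xs , ⊆-refl , le , χ [] , λ { {[]} _ _ → refl ; {_ ∷ _} _ () }
ramsey c (suc K) M with endHomogeneous c K (suc (c * M))
... | N , end = N , λ xs le χ → finish xs le χ
  where
  finish : ∀ {A : Set} (xs : List A) → N ≤ length xs → (χ : List A → Fin c) →
           ∃ λ ys → ys ⊆ xs × M ≤ length ys × ∃ λ k → Homogeneous χ (suc K) k ys
  finish xs le χ with end xs le χ
  ... | ys , ys⊆xs , le′ , h with ofColour-large h M le′
  ... | k , lek = ofColour h k , ⊆-trans (ofColour-⊆ h k) ys⊆xs , lek , k , ofColour-homogeneous h k

-- Systems of order patterns

record Finite (A : Set) : Set where
  field
    card    : ℕ
    index   : A → Fin card
    element : Fin card → A
    element-index : ∀ a → element (index a) ≡ a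
    index-element : ∀ i → index (element i) ≡ i
open Finite public

finite-Fin : ∀ n → Finite (Fin n)
finite-Fin n = record { card = n ; index = id ; element = id ; element-index = λ _ → refl ; index-element = λ _ → refl }

finite-⊎ : ∀ {A B} → Finite A → Finite B → Finite (A ⊎ B)
finite-⊎ {A} {B} FA FB = record
  { card = card FA + card FB ; index = ix ; element = el ∘ splitAt (card FA)
  ; element-index = ei ; index-element = λ i → trans (ie (splitAt (card FA) i)) (F.join-splitAt (card FA) (card FB) i) }
  where
  el : Fin (card FA) ⊎ Fin (card FB) → A ⊎ B
  el (inj₁ i) = inj₁ (element FA i)
  el (inj₂ j) = inj₂ (element FB j)
  ix : A ⊎ B → Fin (card FA + card FB)
  ix (inj₁ a) = index FA a ↑ˡ card FB
  ix (inj₂ b) = card FA ↑ʳ index FB b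
  ei : ∀ x → el (splitAt (card FA) (ix x)) ≡ x
  ei (inj₁ a) = trans (cong el (F.splitAt-↑ˡ (card FA) (index FA a) (card FB))) (cong inj₁ (element-index FA a))
  ei (inj₂ b) = trans (cong el (F.splitAt-↑ʳ (card FA) (card FB) (index FB b))) (cong inj₂ (element-index FB b))
  ie : ∀ s → ix (el s) ≡ join (card FA) (card FB) s
  ie (inj₁ i) = cong (_↑ˡ card FB) (index-element FA i)
  ie (inj₂ j) = cong (card FA ↑ʳ_) (index-element FB j)

finite-× : ∀ {A B} → Finite A → Finite B → Finite (A × B)
finite-× FA FB = record
  { card = card FA * card FB
  ; index = λ (a , b) → combine (index FA a) (index FB b)
  ; element = λ i → element FA (quotient (card FB) i) , element FB (remainder {card FA} (card FB) i)
  ; element-index = λ (a , b) → cong₂ _,_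
      (trans (cong (element FA ∘ proj₁) (F.remQuot-combine (index FA a) (index FB b))) (element-index FA a))
      (trans (cong (element FB ∘ proj₂) (F.remQuot-combine (index FA a) (index FB b))) (element-index FB b))
  ; index-element = λ i → trans (cong₂ combine (index-element FA _) (index-element FB _)) (F.combine-remQuot {card FA} (card FB) i)
  }

funToFin-cong : ∀ {m n} {f g : Fin m → Fin n} → f ≗ g → funToFin f ≡ funToFin g
funToFin-cong {zero}  e = refl
funToFin-cong {suc m} e = cong₂ combine (e zero) (funToFin-cong (e ∘ suc))

funToFin-injective : ∀ {m n} {f g : Fin m → Fin n} → funToFin f ≡ funToFin g → f ≗ g
funToFin-injective {f = f} {g} e i = trans (sym (F.finToFun-funToFin f i)) (trans (cong (λ k → finToFun k i) e) (F.finToFun-funToFin g i))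

module _ {A : Set} (d : A) where

  nth : List A → ℕ → A
  nth []       _       = d
  nth (x ∷ xs) zero    = x
  nth (x ∷ xs) (suc i) = nth xs i

  nth-tabulate : ∀ {n} (f : Fin n → A) i → nth (tabulate f) (toℕ i) ≡ f i
  nth-tabulate f zero    = refl
  nth-tabulate f (suc i) = nth-tabulate (f ∘ suc) i

  tabulate-nth-⊆ : ∀ ys {n} (ix : Fin n → ℕ) → (∀ {i j} → i Fin.< j → ix i < ix j) → (∀ i → ix i < length ys) →
                   tabulate (nth ys ∘ ix) ⊆ ys
  tabulate-nth-⊆ ys {zero} ix mono bd = minimum ys
  tabulate-nth-⊆ [] {suc n} ix mono bd = contradiction (bd zero) λ ()
  tabulate-nth-⊆ (y ∷ ys) {suc n} ix mono bd with ix zero in eq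
  ... | zero = refl ∷ subst (_⊆ ys) (tabulate-cong (λ i → sym (nth-pred (pos i))))
                 (tabulate-nth-⊆ ys (pred ∘ ix ∘ suc)
                    (λ {i} {j} lt → ℕ.pred-mono-< {{>-nonZero (pos i)}} (mono (s≤s lt)))
                    (λ i → below (pos i) (bd (suc i))))
    where
    pos : ∀ i → 0 < ix (suc i)
    pos i = ℕ.≤-<-trans z≤n (mono {zero} {suc i} (s≤s z≤n))
    nth-pred : ∀ {m} → 0 < m → nth (y ∷ ys) m ≡ nth ys (pred m)
    nth-pred (s≤s z≤n) = refl
    below : ∀ {m k} → 0 < m → m < suc k → pred m < k
    below (s≤s z≤n) (s≤s lt) = lt
  ... | suc k = y ∷ʳ subst (_⊆ ys) (cong₂ _∷_ (cong (nth ys ∘ pred) eq) (tabulate-cong (λ i → sym (nth-pred (pos (suc i))))))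
                 (tabulate-nth-⊆ ys (pred ∘ ix)
                    (λ {i} {j} lt → ℕ.pred-mono-< {{>-nonZero (pos i)}} (mono lt))
                    (λ i → below (pos i) (bd i)))
    where
    pos : ∀ i → 0 < ix i
    pos zero = subst (0 <_) (sym eq) (s≤s z≤n)
    pos (suc i) = ℕ.≤-<-trans z≤n (mono {zero} {suc i} (s≤s z≤n))
    nth-pred : ∀ {m} → 0 < m → nth (y ∷ ys) m ≡ nth ys (pred m)
    nth-pred (s≤s z≤n) = refl
    below : ∀ {m k} → 0 < m → m < suc k → pred m < k
    below (s≤s z≤n) (s≤s lt) = lt

  nth-All : ∀ {P : A → Set} {ys} → All P ys → ∀ {i} → i < length ys → P (nth ys i)
  nth-All (p ∷ ps) {zero} lt = p
  nth-All (p ∷ ps) {suc i} (s≤s lt) = nth-All ps lt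

  nth-AllPairs : ∀ {R : A → A → Set} {ys} → AllPairs R ys → ∀ {i j} → i < j → j < length ys → R (nth ys i) (nth ys j)
  nth-AllPairs (r ∷ rs) {zero} {suc j} lt (s≤s bd) = nth-All r bd
  nth-AllPairs (r ∷ rs) {suc i} {suc j} (s≤s lt) (s≤s bd) = nth-AllPairs rs lt bd

AllPairs-⊆ : ∀ {A : Set} {R : A → A → Set} {xs ys} → xs ⊆ ys → AllPairs R ys → AllPairs R xs
AllPairs-⊆ []         []       = []
AllPairs-⊆ (y ∷ʳ s)   (r ∷ rs) = AllPairs-⊆ s rs
AllPairs-⊆ (refl ∷ s) (r ∷ rs) = All-resp-⊆ s r ∷ AllPairs-⊆ s rs

-- Vertices will contain functions, which are compared pointwise; distinctness is therefore demanded
-- with respect to `≈`.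
record Copy {A : Set} (R _≈_ : A → A → Set) (H : Graph) : Set where
  constructor copy
  field
    vertex    : Fin (size H) → A
    injective : ∀ {u v} → vertex u ≈ vertex v → u ≡ v
    preserves : ∀ u v → adj H u v ≡ true → R (vertex u) (vertex v)
open Copy public

Increasing : ℕ → (ℕ → ℕ) → Set
Increasing b e = ∀ {i j} → i < j → j < b → e i < e j

-- A vertex is a sort together with a number in each slot; each slot belongs to a coordinate, and numbers
-- are only ever compared within a coordinate.  A type of edges prescribes the order pattern of the
-- numbers of the two ends; the positions prescribe n vertices that depend on a common configuration.
record System (n : ℕ) : Set₁ where
  field
    Sort Type        : Set
    sorts            : Finite Sort
    types            : Finite Type
    slots coordinates bound : ℕ
    coordinate       : Sort → Fin slots → Fin coordinates
    source target    : Type → Sort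
    sourceIx targetIx : Type → Fin slots → ℕ
    sourceIx< : ∀ τ d → sourceIx τ d < bound
    targetIx< : ∀ τ d → targetIx τ d < bound
    valid            : Type → Bool
    position         : Fin n → Sort
    positionIx       : Fin n → Fin slots → ℕ
    positionIx<      : ∀ s d → positionIx s d < bound

module Configurations {n : ℕ} (𝕊 : System n) where
  open System 𝕊 public

  Vertex : Set
  Vertex = Sort × (Fin slots → ℕ)

  _≈_ : Vertex → Vertex → Set
  (s , u) ≈ (s′ , u′) = s ≡ s′ × u ≗ u′

  record Config : Set where
    constructor config
    field
      values     : Fin coordinates → ℕ → ℕ
      increasing : ∀ p → Increasing bound (values p)
  open Config public

  at : (Fin coordinates → ℕ → ℕ) → Sort → (Fin slots → ℕ) → Vertex
  at e s ix = s , λ d → e (coordinate s d) (ix d)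

  src tgt : Type → Config → Vertex
  src τ e = at (values e) (source τ) (sourceIx τ)
  tgt τ e = at (values e) (target τ) (targetIx τ)

  pos : Fin n → Config → Vertex
  pos s e = at (values e) (position s) (positionIx s)

  -- One pair of vertices may realise several types, so this relation may hold for one pair in
  -- several colours. It is an upper bound for a colour class when copies are to be avoided, and it
  -- yields edges of colour `c` when copies are to be found in a homogeneous set.
  data Edge {q : ℕ} (ψ : Type → Fin q) (c : Fin q) (x y : Vertex) : Set where
    edge : ∀ τ → valid τ ≡ true → ψ τ ≡ c → ∀ e → x ≈ src τ e → y ≈ tgt τ e → Edge ψ c x y

  Edge↔ : {q : ℕ} (ψ : Type → Fin q) (c : Fin q) → Vertex → Vertex → Set
  Edge↔ ψ c x y = Edge ψ c x y ⊎ Edge ψ c y x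

  data Attached {q : ℕ} (φ : Fin n → Fin q) (c : Fin q) (e : Config) (y : Vertex) : Set where
    attached : ∀ s → φ s ≡ c → y ≈ pos s e → Attached φ c e y

  Vertex⁺ : Set
  Vertex⁺ = Vertex ⊎ Config

  Edge⁺ : {q : ℕ} (ψ : Type → Fin q) (φ : Fin n → Fin q) (c : Fin q) → Vertex⁺ → Vertex⁺ → Set
  Edge⁺ ψ φ c (inj₁ x) (inj₁ y) = Edge↔ ψ c x y
  Edge⁺ ψ φ c (inj₁ x) (inj₂ e) = Attached φ c e x
  Edge⁺ ψ φ c (inj₂ e) (inj₁ y) = Attached φ c e y
  Edge⁺ ψ φ c (inj₂ e) (inj₂ f) = ⊥

  -- In the finite graph a new vertex is the tuple of its neighbours, so configurations with the
  -- same positions give the same vertex.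
  _≈⁺_ : Vertex⁺ → Vertex⁺ → Set
  inj₁ x ≈⁺ inj₁ y = x ≈ y
  inj₂ e ≈⁺ inj₂ f = ∀ s → pos s e ≈ pos s f
  _      ≈⁺ _      = ⊥

⌊⌋-sound : ∀ {A : Set} (d : Dec A) → ⌊ d ⌋ ≡ true → A
⌊⌋-sound (yes a) _ = a

⌊⌋-complete : ∀ {A : Set} (d : Dec A) → A → ⌊ d ⌋ ≡ true
⌊⌋-complete (yes _) _ = refl
⌊⌋-complete (no ¬a) a = ⊥-elim (¬a a)

adj-simpleGraph : ∀ {n} (r : Fin n → Fin n → Bool) {u v} → u ≢ v → r u v ≡ true → adj (simpleGraph n r) u v ≡ true
adj-simpleGraph r {u} {v} ne e rewrite e with u F.≟ v
... | yes p = ⊥-elim (ne p)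
... | no  _ = refl

simpleGraph-adj : ∀ {n} (r : Fin n → Fin n → Bool) {u v} → adj (simpleGraph n r) u v ≡ true →
                  u ≢ v × (r u v ≡ true ⊎ r v u ≡ true)
simpleGraph-adj r {u} {v} e with r u v | r v u | u F.≟ v
... | true  | _    | no ne = ne , inj₁ refl
... | false | true | no ne = ne , inj₂ refl
... | true  | _     | yes _ = contradiction e λ ()
... | false | true  | yes _ = contradiction e λ ()
... | false | false | yes _ = contradiction e λ ()
... | false | false | no _ = contradiction e λ ()

-- Finite realisation of a system and its extension by new vertices

module Realisation {n : ℕ} (𝕊 : System n) where
  open Configurations 𝕊

  module _ (N : ℕ) where

    order : ℕ
    order = card sorts * N ^ slots

    Values : Set
    Values = Fin coordinates → Fin bound → Fin N

    code : Sort → (Fin slots → Fin N) → Fin order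
    code s u = combine (index sorts s) (funToFin u)

    codeAt : Values → (s : Sort) (ix : Fin slots → ℕ) → (∀ d → ix d < bound) → Fin order
    codeAt e s ix ix< = code s λ d → e (coordinate s d) (fromℕ< (ix< d))

    srcᶠ tgtᶠ : Type → Values → Fin order
    srcᶠ τ e = codeAt e (source τ) (sourceIx τ) (sourceIx< τ)
    tgtᶠ τ e = codeAt e (target τ) (targetIx τ) (targetIx< τ)

    posᶠ : Fin n → Values → Fin order
    posᶠ s e = codeAt e (position s) (positionIx s) (positionIx< s)

    codeAt-cong : ∀ {e f : Values} → (∀ p → e p ≗ f p) → ∀ s ix ix< → codeAt e s ix ix< ≡ codeAt f s ix ix<
    codeAt-cong e≗f s ix ix< = cong (combine (index sorts s)) (funToFin-cong λ d → e≗f (coordinate s d) (fromℕ< (ix< d)))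

    Increasingᶠ : Values → Set
    Increasingᶠ e = ∀ p i j → i Fin.< j → e p i Fin.< e p j

    Adjacent : Fin order → Fin order → Set
    Adjacent x y = ∃ λ k → valid (element types k) ≡ true ×
      ∃ λ e → Increasingᶠ e × x ≡ srcᶠ (element types k) e × y ≡ tgtᶠ (element types k) e

    abstract
      adjacent? : ∀ x y → Dec (Adjacent x y)
      adjacent? x y = F.any? λ k → (valid (element types k) 𝔹.≟ true) ×-dec typed? (element types k)
        where
        typed? : ∀ τ → Dec (∃ λ e → Increasingᶠ e × x ≡ srcᶠ τ e × y ≡ tgtᶠ τ e)
        typed? τ = any-fun²? (λ {e} {f} e≗f (inc , p , q) →
                     (λ c i j lt → subst₂ Fin._<_ (e≗f c i) (e≗f c j) (inc c i j lt))
                   , trans p (codeAt-cong e≗f (source τ) (sourceIx τ) (sourceIx< τ))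
                   , trans q (codeAt-cong e≗f (target τ) (targetIx τ) (targetIx< τ)))
          (λ e → (F.all? λ p → F.all? λ i → F.all? λ j → (i F.<? j) →-dec (e p i F.<? e p j))
                 ×-dec (x F.≟ srcᶠ τ e) ×-dec (y F.≟ tgtᶠ τ e))

    related : Fin order → Fin order → Bool
    related x y = ⌊ adjacent? x y ⌋

    base : Graph
    base = simpleGraph order related

    decode : Fin order → Vertex
    decode x = element sorts (quotient (N ^ slots) x) , λ d → toℕ (finToFun {N} {slots} (remainder {card sorts} (N ^ slots) x) d)

    decode-code : ∀ s u → decode (code s u) ≈ (s , toℕ ∘ u)
    decode-code s u = trans (cong (element sorts ∘ proj₁) (F.remQuot-combine (index sorts s) (funToFin u))) (element-index sorts s)
      , λ d → cong toℕ (trans (cong (λ z → finToFun (proj₂ z) d) (F.remQuot-combine {card sorts} (index sorts s) (funToFin u)))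
                              (F.finToFun-funToFin u d))

    decode-injective : ∀ {x y} → decode x ≈ decode y → x ≡ y
    decode-injective {x} {y} (es , eu) = trans (sym (F.combine-remQuot {card sorts} (N ^ slots) x))
      (trans (cong₂ combine
                (trans (sym (index-element sorts _)) (trans (cong (index sorts) es) (index-element sorts _)))
                (trans (sym (F.funToFin-finToFin {slots} _)) (trans (funToFin-cong (λ d → F.toℕ-injective (eu d))) (F.funToFin-finToFin {slots} _))))
             (F.combine-remQuot {card sorts} (N ^ slots) y))

    extend : Values → Fin coordinates → ℕ → ℕ
    extend e p i with i <? bound
    ... | yes lt = toℕ (e p (fromℕ< lt))
    -- A filler: monotonicity is required only below `bound`, where all slots read.
    ... | no  _  = 0

    extend-in : ∀ e p {i} (lt : i < bound) → extend e p i ≡ toℕ (e p (fromℕ< lt))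
    extend-in e p {i} lt with i <? bound
    ... | yes lt′ = cong (toℕ ∘ e p) (F.fromℕ<-cong i i refl lt′ lt)
    ... | no ¬lt = ⊥-elim (¬lt lt)

    toConfig : (e : Values) → Increasingᶠ e → Config
    toConfig e inc = config (extend e) λ p {i} {j} i<j j<b →
      subst₂ _<_ (sym (extend-in e p (ℕ.<-trans i<j j<b))) (sym (extend-in e p j<b))
        (inc p _ _ (subst₂ _<_ (sym (F.toℕ-fromℕ< (ℕ.<-trans i<j j<b))) (sym (F.toℕ-fromℕ< j<b)) i<j))

    decode-codeAt : ∀ e inc s ix ix< → decode (codeAt e s ix ix<) ≈ at (values (toConfig e inc)) s ix
    decode-codeAt e inc s ix ix< with decode-code s (λ d → e (coordinate s d) (fromℕ< (ix< d)))
    ... | p , q = p , λ d → trans (q d) (sym (extend-in e _ (ix< d)))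

    adjacent-edge : ∀ {q} (ψ : Type → Fin q) {x y} (a : Adjacent x y) → Edge ψ (ψ (element types (proj₁ a))) (decode x) (decode y)
    adjacent-edge ψ (k , ok , e , inc , refl , refl) =
      edge (element types k) ok refl (toConfig e inc) (decode-codeAt e inc (source τ) (sourceIx τ) (sourceIx< τ)) (decode-codeAt e inc (target τ) (targetIx τ) (targetIx< τ))
      where τ = element types k

  module Intended {q : ℕ} (c₀ : Fin q) (Hs : Fin q → Graph) (ψ : Type → Fin q)
                  (avoids : ∀ i → ¬ Copy (Edge↔ ψ i) _≈_ (Hs i)) (N : ℕ) where

    -- An edge that realises several types takes the colour of the one found by the search. Each
    -- colour class thus lies inside the corresponding `Edge↔ ψ`, and already that larger graph
    -- avoids `Hs i`.
    colour : Fin (order N) → Fin (order N) → Fin q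
    colour x y with adjacent? N x y
    ... | yes a = ψ (element types (proj₁ a))
    ... | no  _ with adjacent? N y x
    ...   | yes a = ψ (element types (proj₁ a))
    ...   | no  _ = c₀

    colour-edge : ∀ x y → related N x y ≡ true ⊎ related N y x ≡ true → Edge↔ ψ (colour x y) (decode N x) (decode N y)
    colour-edge x y h with adjacent? N x y
    ... | yes a = inj₁ (adjacent-edge N ψ a)
    ... | no na with adjacent? N y x
    ...   | yes a = inj₂ (adjacent-edge N ψ a)
    colour-edge x y (inj₁ ()) | no na | no nb
    colour-edge x y (inj₂ ()) | no na | no nb

    swap : ∀ {A B : Set} → A ⊎ B → B ⊎ A
    swap (inj₁ a) = inj₂ a
    swap (inj₂ b) = inj₁ b

    base-avoiding : Avoiding q Hs (base N)
    base-avoiding = (symmetrize colour , symmetrize-sym colour) , λ i (f , inj , h) →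
      avoids i (copy (decode N ∘ f) (λ {u} {v} e → inj {u} {v} (decode-injective N {f u} {f v} e)) (λ u v a → edge-of i (f u) (f v) (h u v a)))
      where
      edge-of : ∀ i x y → adj (base N) x y ≡ true × symmetrize colour x y ≡ i → Edge↔ ψ i (decode N x) (decode N y)
      edge-of i x y (a , e) with proj₂ (simpleGraph-adj (related N) {x} {y} a) | symmetrize-cases colour x y
      ... | h | inj₁ e′ = subst (λ c → Edge↔ ψ c (decode N x) (decode N y)) (trans (sym e′) e) (colour-edge x y h)
      ... | h | inj₂ e′ = swap (subst (λ c → Edge↔ ψ c (decode N y) (decode N x)) (trans (sym e′) e) (colour-edge y x (swap h)))

  -- The base together with one vertex for each n-tuple of its vertices, adjacent to the members of the tuple.
  module Extension (N : ℕ) where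

    V : ℕ
    V = order N

    in₁ : Fin V → Fin (V + V ^ n)
    in₁ x = x ↑ˡ (V ^ n)

    in₂ : (Fin n → Fin V) → Fin (V + V ^ n)
    in₂ w = V ↑ʳ funToFin w

    member : Fin (V ^ n) → Fin n → Fin V
    member = finToFun {V} {n}

    member? : ∀ w x → Dec (∃ λ s → member w s ≡ x)
    member? w x = F.any? λ s → member w s F.≟ x

    related′ : Fin V ⊎ Fin (V ^ n) → Fin V ⊎ Fin (V ^ n) → Bool
    related′ (inj₁ x) (inj₁ y) = related N x y
    related′ (inj₂ w) (inj₁ x) = ⌊ member? w x ⌋
    related′ _        _        = false

    related⁺ : Fin (V + V ^ n) → Fin (V + V ^ n) → Bool
    related⁺ a b = related′ (splitAt V a) (splitAt V b)

    extension : Graph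
    extension = simpleGraph (V + V ^ n) related⁺

    neighbour : ∀ {x y w} → x ≡ inj₂ w → related′ x y ≡ true ⊎ related′ y x ≡ true →
                ∃ λ s → y ≡ inj₁ (member w s)
    neighbour {y = inj₁ y} refl (inj₁ r) = let (s , p) = ⌊⌋-sound (member? _ _) r in s , cong inj₁ (sym p)
    neighbour {y = inj₁ y} refl (inj₂ ())
    neighbour {y = inj₂ y} refl (inj₁ ())
    neighbour {y = inj₂ y} refl (inj₂ ())

    related-in₁ : ∀ x y → related⁺ (in₁ x) (in₁ y) ≡ related N x y
    related-in₁ x y rewrite F.splitAt-↑ˡ V x (V ^ n) | F.splitAt-↑ˡ V y (V ^ n) = refl

    related-in₂ : ∀ w s → related⁺ (in₂ w) (in₁ (w s)) ≡ true
    related-in₂ w s rewrite F.splitAt-↑ʳ V (V ^ n) (funToFin w) | F.splitAt-↑ˡ V (w s) (V ^ n) =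
      ⌊⌋-complete (member? (funToFin w) (w s)) (s , F.finToFun-funToFin w s)

    module _ {q : ℕ} {Hs : Fin q → Graph} (avoid : Avoiding q Hs (base N)) where

      old-or-new : ∀ {G′} → IsRamsey q Hs G′ → (E : Embedding G′ extension) →
                   ∃ λ u → ∃ λ w → splitAt V (proj₁ E u) ≡ inj₂ w
      old-or-new {G′} R (g , inj , a) with searchable-Fin {P = λ u → ∃ λ x → splitAt V (g u) ≡ inj₁ x}
             {Q = λ u → ∃ λ w → splitAt V (g u) ≡ inj₂ w} (λ { refl p → p }) split
        where
        split : ∀ u → (∃ λ x → splitAt V (g u) ≡ inj₁ x) ⊎ (∃ λ w → splitAt V (g u) ≡ inj₂ w)
        split u with splitAt V (g u)
        ... | inj₁ x = inj₁ (x , refl)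
        ... | inj₂ w = inj₂ (w , refl)
      ... | inj₂ p = p
      ... | inj₁ old = ⊥-elim (avoiding-embedding q Hs {G′} {base N} emb avoid R)
        where
        h : Fin (size G′) → Fin V
        h u = proj₁ (old u)
        g-h : ∀ u → in₁ (h u) ≡ g u
        g-h u = F.splitAt⁻¹-↑ˡ (proj₂ (old u))
        emb : Embedding G′ (base N)
        emb = h , (λ {x} {y} e → inj (trans (sym (g-h x)) (trans (cong in₁ e) (g-h y)))) , adjacent
          where
          adjacent : ∀ u v → adj G′ u v ≡ true → adj (base N) (h u) (h v) ≡ true
          adjacent u v e with simpleGraph-adj related⁺ {g u} {g v} (a u v e)
          ... | ne , r rewrite sym (g-h u) | sym (g-h v) | related-in₁ (h u) (h v) | related-in₁ (h v) (h u) with r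
          ...   | inj₁ r₁ = adj-simpleGraph (related N) (λ e → ne (cong in₁ e)) r₁
          ...   | inj₂ r₂ = trans (adj-sym (base N) (h u) (h v)) (adj-simpleGraph (related N) (λ e → ne (cong in₁ (sym e))) r₂)

      -- Neighbours of `u` are counted by the positions they occupy in the tuple `w`; the embedding
      -- is injective, so a position accounts for at most one of them.
      degree-new : ∀ {G′} (E : Embedding G′ extension) u {w} → splitAt V (proj₁ E u) ≡ inj₂ w → degree G′ u ≤ n
      degree-new {G′} (g , inj , a) u {w} eq = ℕ.≤-trans (Σ-mono bnd)
          (ℕ.≤-trans (ℕ.≤-reflexive (Σ-swap (λ v s → if hit v s then 1 else 0)))
            (ℕ.≤-trans (Σ-mono (λ s → Σ-atMostOne (λ v → hit v s) (one s))) (ℕ.≤-reflexive (Σ-one n))))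
        where
        hit : Fin (size G′) → Fin n → Bool
        hit v s = ⌊ in₁ (member w s) F.≟ g v ⌋
        one : ∀ s v v′ → hit v s ≡ true → hit v′ s ≡ true → v ≡ v′
        one s v v′ p p′ = inj (trans (sym (⌊⌋-sound (in₁ (member w s) F.≟ g v) p)) (⌊⌋-sound (in₁ (member w s) F.≟ g v′) p′))
        near : ∀ v → adj G′ u v ≡ true → ∃ λ s → in₁ (member w s) ≡ g v
        near v e = let (s , p) = neighbour eq (proj₂ (simpleGraph-adj related⁺ {g u} {g v} (a u v e))) in
                   s , F.splitAt⁻¹-↑ˡ p
        bnd : ∀ v → (if adj G′ u v then 1 else 0) ≤ Σ[ (λ s → if hit v s then 1 else 0) ]
        bnd v with adj G′ u v in e
        ... | false = z≤n
        ... | true with near v e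
        ...   | s , p = ℕ.≤-trans (ℕ.≤-reflexive (sym (cong (λ b → if b then 1 else 0) (⌊⌋-complete (in₁ (member w s) F.≟ g v) p))))
                                   (Σ-term (λ s → if hit v s then 1 else 0) s)

      conclusion : ∀ {m d} → d * n ≤ m → IsRamsey q Hs extension → sLeFrac q Hs m d
      conclusion {m} {d} le R with minimal-subgraph q Hs extension R
      ... | G′ , min , E with old-or-new {G′} (proj₁ min) E
      ... | u , w , eq = G′ , min , u , ℕ.≤-trans (ℕ.*-monoʳ-≤ d (degree-new {G′} E u eq)) le

-- Transport of copies from ℕ into a homogeneous set

module Bounds {n : ℕ} (𝕊 : System n) where
  open Configurations 𝕊

  configBound : Config → ℕ
  configBound e = suc Σ[ (λ p → Σ[ (λ (i : Fin bound) → values e p (toℕ i)) ]) ]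

  configBound-correct : ∀ e p {i} → i < bound → values e p i < configBound e
  configBound-correct e p {i} lt = s≤s (ℕ.≤-trans
    (ℕ.≤-reflexive (cong (values e p) (sym (F.toℕ-fromℕ< lt))))
    (ℕ.≤-trans (Σ-term (λ i → values e p (toℕ i)) (fromℕ< lt)) (Σ-term (λ p → Σ[ (λ (i : Fin bound) → values e p (toℕ i)) ]) p)))

  vertexBound : Vertex⁺ → ℕ
  vertexBound (inj₁ (s , u)) = suc Σ[ u ]
  vertexBound (inj₂ e)       = configBound e

  edgeBound : ∀ {q} {ψ : Type → Fin q} {c x y} → Edge ψ c x y → ℕ
  edgeBound (edge τ _ _ e _ _) = configBound e

  edge⁺Bound : ∀ {q} {ψ : Type → Fin q} {φ c} x y → Edge⁺ ψ φ c x y → ℕ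
  edge⁺Bound (inj₁ x) (inj₁ y) (inj₁ h) = edgeBound h
  edge⁺Bound (inj₁ x) (inj₁ y) (inj₂ h) = edgeBound h
  edge⁺Bound (inj₁ x) (inj₂ e) h = configBound e
  edge⁺Bound (inj₂ e) (inj₁ y) h = configBound e

  module _ {q} {ψ : Type → Fin q} {φ c H} (C : Copy (Edge⁺ ψ φ c) _≈⁺_ H) where

    private
      pick : ∀ (b : Bool) → (b ≡ true → ℕ) → ℕ
      pick true h = h refl
      pick false _ = 0

      pick-≥ : ∀ b (h : b ≡ true → ℕ) e → h e ≤ pick b h
      pick-≥ true h refl = ℕ.≤-refl

      eb : ∀ u v → adj H u v ≡ true → ℕ
      eb u v a = edge⁺Bound (vertex C u) (vertex C v) (preserves C u v a)

      vs es : ℕ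
      vs = Σ[ vertexBound ∘ vertex C ]
      es = Σ[ (λ u → Σ[ (λ v → pick (adj H u v) (eb u v)) ]) ]

    -- The configurations that witness the edges are included, since they have to be transported
    -- along with the vertices.
    copyBound : ℕ
    copyBound = vs + es

    vertexBound-≤ : ∀ u → vertexBound (vertex C u) ≤ copyBound
    vertexBound-≤ u = ℕ.≤-trans (Σ-term (vertexBound ∘ vertex C) u) (ℕ.m≤m+n vs es)

    edgeBound-≤ : ∀ u v a → edge⁺Bound (vertex C u) (vertex C v) (preserves C u v a) ≤ copyBound
    edgeBound-≤ u v a = ℕ.≤-trans (pick-≥ (adj H u v) (eb u v) a)
      (ℕ.≤-trans (Σ-term (λ v → pick (adj H u v) (eb u v)) v)
        (ℕ.≤-trans (Σ-term (λ u → Σ[ (λ v → pick (adj H u v) (eb u v)) ]) u) (ℕ.m≤n+m es vs)))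

module DegreeBound {n : ℕ} (𝕊 : System n) {q : ℕ} (c₀ : Fin q) (Hs : Fin q → Graph) where
  open Configurations 𝕊
  open Realisation 𝕊
  open Bounds 𝕊

  module Transport (N M : ℕ) (C : Colouring q (Extension.extension (suc N)))
                   (ys : List (Fin (suc N))) (ys⊆ : ys ⊆ allFin (suc N)) (len : coordinates * M ≤ length ys) where
    open Extension (suc N)

    colour : Fin (V + V ^ n) → Fin (V + V ^ n) → Fin q
    colour = proj₁ C

    colours : Values (suc N) → Fin (card types) ⊎ Fin n → Fin q
    colours e (inj₁ k) = colour (in₁ (srcᶠ (suc N) (element types k) e)) (in₁ (tgtᶠ (suc N) (element types k) e))
    colours e (inj₂ s) = colour (in₂ (λ s → posᶠ (suc N) s e)) (in₁ (posᶠ (suc N) s e))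

    colours-cong : ∀ {e f} → (∀ p → e p ≗ f p) → colours e ≗ colours f
    colours-cong e≗f (inj₁ k) = cong₂ colour (cong in₁ (codeAt-cong (suc N) e≗f (source τ) (sourceIx τ) (sourceIx< τ)))
                                             (cong in₁ (codeAt-cong (suc N) e≗f (target τ) (targetIx τ) (targetIx< τ)))
      where τ = element types k
    colours-cong e≗f (inj₂ s) = cong₂ colour
      (cong (V ↑ʳ_) (funToFin-cong λ s → codeAt-cong (suc N) e≗f (position s) (positionIx s) (positionIx< s)))
      (cong in₁ (codeAt-cong (suc N) e≗f (position s) (positionIx s) (positionIx< s)))

    -- Consecutive stretches of `bound` entries become the coordinates. The default `zero` of `nth`
    -- is the reason for working with `Fin (suc N)`.
    fromList : List (Fin (suc N)) → Values (suc N)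
    fromList zs p i = nth zero zs (toℕ (combine p i))

    -- A single colour records the colours of all types and of all positions at once, so that one
    -- application of Ramsey's theorem makes all of them constant.
    χ : List (Fin (suc N)) → Fin (q ^ (card types + n))
    χ zs = funToFin (colours (fromList zs) ∘ splitAt (card types))

    H : ℕ → Fin (suc N)
    H = nth zero ys

    H-mono : ∀ {i j} → i < j → j < coordinates * M → H i Fin.< H j
    H-mono lt lt′ = nth-AllPairs zero {R = Fin._<_} (AllPairs-⊆ ys⊆ (AllPairs.tabulate⁺-< {f = id} id)) lt (ℕ.<-≤-trans lt′ len)

    H-injective : ∀ {i j} → i < coordinates * M → j < coordinates * M → H i ≡ H j → i ≡ j
    H-injective {i} {j} li lj e with ℕ.<-cmp i j
    ... | tri< lt _ _ = contradiction (cong toℕ e) (ℕ.<⇒≢ (H-mono lt lj))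
    ... | tri≈ _ eq _ = eq
    ... | tri> _ _ gt = contradiction (cong toℕ (sym e)) (ℕ.<⇒≢ (H-mono gt li))

    -- Coordinate `p` gets the `p`-th stretch of `M` entries of the homogeneous list. Numbers of
    -- different coordinates are never compared, so this loses nothing, and it turns a configuration
    -- into one increasing list of `coordinates * bound` entries, which is what `χ` colours.
    place : Fin coordinates → ℕ → ℕ
    place p x = toℕ p * M + x

    place-< : ∀ p {x} → x < M → place p x < coordinates * M
    place-< p {x} lt = ℕ.≤-trans (ℕ.+-monoʳ-< (toℕ p * M) lt)
      (ℕ.≤-trans (ℕ.≤-reflexive (ℕ.+-comm (toℕ p * M) M)) (ℕ.*-monoˡ-≤ M (F.toℕ<n p)))

    place-lex : ∀ {p p′ x x′} → x < M → toℕ p < toℕ p′ → place p x < place p′ x′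
    place-lex {p} {p′} {x} {x′} lt lt′ = ℕ.<-≤-trans (ℕ.+-monoʳ-< (toℕ p * M) lt)
      (ℕ.≤-trans (ℕ.≤-reflexive (ℕ.+-comm (toℕ p * M) M)) (ℕ.≤-trans (ℕ.*-monoˡ-≤ M lt′) (ℕ.m≤m+n _ x′)))

    realise : Config → Values (suc N)
    realise e p i = H (place p (values e p (toℕ i)))

    module _ (e : Config) (bd : ∀ p {i} → i < bound → values e p i < M) where

      private
        ix : Fin (coordinates * bound) → ℕ
        ix k = place (quotient bound k) (values e (quotient bound k) (toℕ (remainder {coordinates} bound k)))

        ix-< : ∀ k → ix k < coordinates * M
        ix-< k = place-< (quotient bound k) (bd _ (F.toℕ<n _))

        toℕ-split : ∀ (k : Fin (coordinates * bound)) →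
                    toℕ k ≡ bound * toℕ (quotient {coordinates} bound k) + toℕ (remainder {coordinates} bound k)
        toℕ-split k = trans (cong toℕ (sym (F.combine-remQuot {coordinates} bound k)))
                            (F.toℕ-combine (quotient {coordinates} bound k) (remainder {coordinates} bound k))

        lex : ∀ (p p′ : Fin coordinates) (i i′ : Fin bound) → bound * toℕ p + toℕ i < bound * toℕ p′ + toℕ i′ →
              place p (values e p (toℕ i)) < place p′ (values e p′ (toℕ i′))
        lex p p′ i i′ lt with ℕ.<-cmp (toℕ p) (toℕ p′)
        ... | tri< p<p′ _ _ = place-lex {p} {p′} (bd p (F.toℕ<n i)) p<p′
        ... | tri≈ _ p≡p′ _ with F.toℕ-injective {i = p} {p′} p≡p′
        ...   | refl = ℕ.+-monoʳ-< (toℕ p * M) (increasing e p (ℕ.+-cancelˡ-< (bound * toℕ p) _ _ lt) (F.toℕ<n i′))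
        lex p p′ i i′ lt | tri> _ _ p′<p = ⊥-elim (ℕ.<⇒≱ lt (ℕ.≤-trans (ℕ.<⇒≤ (ℕ.+-monoʳ-< (bound * toℕ p′) (F.toℕ<n i′)))
          (ℕ.≤-trans (ℕ.≤-reflexive (trans (ℕ.+-comm (bound * toℕ p′) bound) (sym (ℕ.*-suc bound (toℕ p′)))))
            (ℕ.≤-trans (ℕ.*-monoʳ-≤ bound p′<p) (ℕ.m≤m+n _ (toℕ i))))))

        ix-mono : ∀ {k l} → k Fin.< l → ix k < ix l
        ix-mono {k} {l} lt = lex _ _ _ _ (subst₂ _<_ (toℕ-split k) (toℕ-split l) lt)

        zs : List (Fin (suc N))
        zs = tabulate (H ∘ ix)

        zs⊆ys : zs ⊆ ys
        zs⊆ys = tabulate-nth-⊆ zero ys ix ix-mono (λ k → ℕ.<-≤-trans (ix-< k) len)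

        fromList-zs : ∀ p → fromList zs p ≗ realise e p
        fromList-zs p i = trans (nth-tabulate zero (H ∘ ix) (combine p i))
          (cong (λ (p , i) → H (place p (values e p (toℕ i)))) (F.remQuot-combine p i))

      realise-increasing : Increasingᶠ (suc N) (realise e)
      realise-increasing p i j lt = H-mono (ℕ.+-monoʳ-< (toℕ p * M) (increasing e p lt (F.toℕ<n j))) (place-< p (bd p (F.toℕ<n j)))

      module _ {κ} (hom : Homogeneous χ (coordinates * bound) κ ys) where

        colours-constant : ∀ k → colours (realise e) (splitAt (card types) k) ≡ finToFun κ k
        colours-constant k = trans (sym (colours-cong fromList-zs (splitAt (card types) k)))
          (trans (sym (F.finToFun-funToFin (colours (fromList zs) ∘ splitAt (card types)) k))
                 (cong (λ z → finToFun z k) (hom zs⊆ys (length-tabulate (H ∘ ix)))))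

    vertexCode : Vertex → Fin V
    vertexCode (s , u) = code (suc N) s (λ d → H (place (coordinate s d) (u d)))

    vertexCode-at : ∀ e {x} s ix (ix< : ∀ d → ix d < bound) → x ≈ at (values e) s ix →
                    vertexCode x ≡ codeAt (suc N) (realise e) s ix ix<
    vertexCode-at e s ix ix< (refl , eq) = cong (combine (index sorts s))
      (funToFin-cong λ d → cong (λ z → H (place (coordinate s d) z))
         (trans (eq d) (cong (values e (coordinate s d)) (sym (F.toℕ-fromℕ< (ix< d))))))

    vertexCode-injective : ∀ {x y} → (∀ d → proj₂ x d < M) → (∀ d → proj₂ y d < M) → vertexCode x ≡ vertexCode y → x ≈ y
    vertexCode-injective {s , u} {s′ , u′} bx by e with F.combine-injective (index sorts s) _ (index sorts s′) _ e
    ... | e₁ , e₂ with trans (sym (element-index sorts s)) (trans (cong (element sorts) e₁) (element-index sorts s′))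
    ...   | refl = refl , λ d → ℕ.+-cancelˡ-≡ (toℕ (coordinate s d) * M) _ _
                     (H-injective (place-< (coordinate s d) (bx d)) (place-< (coordinate s d) (by d)) (funToFin-injective e₂ d))

    vertexCode⁺ : Vertex⁺ → Fin (V + V ^ n)
    vertexCode⁺ (inj₁ x) = in₁ (vertexCode x)
    vertexCode⁺ (inj₂ e) = in₂ (λ s → vertexCode (pos s e))

    Bounded : Vertex⁺ → Set
    Bounded x = vertexBound x ≤ M

    config-bounded : ∀ e → configBound e ≤ M → ∀ p {i} → i < bound → values e p i < M
    config-bounded e b p lt = ℕ.<-≤-trans (configBound-correct e p lt) b

    vertexCode⁺-injective : ∀ x y → Bounded x → Bounded y → vertexCode⁺ x ≡ vertexCode⁺ y → x ≈⁺ y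
    vertexCode⁺-injective (inj₁ x) (inj₁ y) bx by e =
      vertexCode-injective (λ d → ℕ.<-≤-trans (s≤s (Σ-term (proj₂ x) d)) bx) (λ d → ℕ.<-≤-trans (s≤s (Σ-term (proj₂ y) d)) by)
        (F.↑ˡ-injective (V ^ n) _ _ e)
    vertexCode⁺-injective (inj₁ x) (inj₂ f) bx by e =
      contradiction (trans (sym (F.splitAt-↑ˡ V _ (V ^ n))) (trans (cong (splitAt V) e) (F.splitAt-↑ʳ V (V ^ n) _))) λ ()
    vertexCode⁺-injective (inj₂ f) (inj₁ x) bx by e =
      contradiction (trans (sym (F.splitAt-↑ʳ V (V ^ n) _)) (trans (cong (splitAt V) e) (F.splitAt-↑ˡ V _ (V ^ n)))) λ ()
    vertexCode⁺-injective (inj₂ f) (inj₂ g) bx by e s =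
      vertexCode-injective (λ d → config-bounded f bx _ (positionIx< s d)) (λ d → config-bounded g by _ (positionIx< s d))
        (funToFin-injective (F.↑ʳ-injective V _ _ e) s)

    module _ {κ} (hom : Homogeneous χ (coordinates * bound) κ ys) where

      ψ : Type → Fin q
      ψ τ = finToFun {q} {card types + n} κ (index types τ ↑ˡ n)

      φ : Fin n → Fin q
      φ s = finToFun {q} {card types + n} κ (card types ↑ʳ s)

      -- Adjacency is promised only for distinct codes, since `simpleGraph` drops loops;
      -- distinctness follows afterwards from the injectivity of the codes.
      Realised : Fin q → Fin (V + V ^ n) → Fin (V + V ^ n) → Set
      Realised c a b = (a ≢ b → adj extension a b ≡ true) × colour a b ≡ c

      Realised-sym : ∀ {c a b} → Realised c a b → Realised c b a
      Realised-sym {a = a} {b} (h , e) = (λ ne → trans (adj-sym extension b a) (h (ne ∘ sym))) , trans (proj₂ C b a) e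

      realised-edge : ∀ {c x y} (h : Edge ψ c x y) → edgeBound h ≤ M → Realised c (in₁ (vertexCode x)) (in₁ (vertexCode y))
      realised-edge {x = x} {y} (edge τ ok refl e ex ey) b = adjacent , coloured
        where
        bd : ∀ p {i} → i < bound → values e p i < M
        bd = config-bounded e b
        cx : vertexCode x ≡ srcᶠ (suc N) τ (realise e)
        cx = vertexCode-at e (source τ) (sourceIx τ) (sourceIx< τ) ex
        cy : vertexCode y ≡ tgtᶠ (suc N) τ (realise e)
        cy = vertexCode-at e (target τ) (targetIx τ) (targetIx< τ) ey
        ty : element types (index types τ) ≡ τ
        ty = element-index types τ
        a : Adjacent (suc N) (vertexCode x) (vertexCode y)
        a = index types τ , trans (cong valid ty) ok , realise e , realise-increasing e bd
          , trans cx (cong (λ τ → srcᶠ (suc N) τ (realise e)) (sym ty)) , trans cy (cong (λ τ → tgtᶠ (suc N) τ (realise e)) (sym ty))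
        adjacent : in₁ (vertexCode x) ≢ in₁ (vertexCode y) → adj extension (in₁ (vertexCode x)) (in₁ (vertexCode y)) ≡ true
        adjacent ne = adj-simpleGraph related⁺ ne
          (trans (related-in₁ (vertexCode x) (vertexCode y)) (⌊⌋-complete (adjacent? (suc N) (vertexCode x) (vertexCode y)) a))
        coloured : colour (in₁ (vertexCode x)) (in₁ (vertexCode y)) ≡ ψ τ
        coloured = trans (cong₂ (λ a b → colour (in₁ a) (in₁ b)) (trans cx (cong (λ τ → srcᶠ (suc N) τ (realise e)) (sym ty)))
                                                                (trans cy (cong (λ τ → tgtᶠ (suc N) τ (realise e)) (sym ty))))
          (trans (cong (colours (realise e)) (sym (F.splitAt-↑ˡ (card types) (index types τ) n)))
                 (colours-constant e bd hom (index types τ ↑ˡ n)))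

      realised-attached : ∀ {c e y} → Attached φ c e y → configBound e ≤ M → Realised c (vertexCode⁺ (inj₂ e)) (in₁ (vertexCode y))
      realised-attached {e = e} {y} (attached s refl ey) b = adjacent , coloured
        where
        bd : ∀ p {i} → i < bound → values e p i < M
        bd = config-bounded e b
        cp : ∀ s → vertexCode (pos s e) ≡ posᶠ (suc N) s (realise e)
        cp s = vertexCode-at e (position s) (positionIx s) (positionIx< s) (refl , λ _ → refl)
        cy : vertexCode y ≡ posᶠ (suc N) s (realise e)
        cy = vertexCode-at e (position s) (positionIx s) (positionIx< s) ey
        adjacent : vertexCode⁺ (inj₂ e) ≢ in₁ (vertexCode y) → adj extension (vertexCode⁺ (inj₂ e)) (in₁ (vertexCode y)) ≡ true
        adjacent ne = adj-simpleGraph related⁺ ne (subst (λ z → related⁺ (vertexCode⁺ (inj₂ e)) (in₁ z) ≡ true)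
          (trans (cp s) (sym cy)) (related-in₂ (λ s → vertexCode (pos s e)) s))
        coloured : colour (vertexCode⁺ (inj₂ e)) (in₁ (vertexCode y)) ≡ φ s
        coloured = trans (cong₂ colour (cong (V ↑ʳ_) (funToFin-cong cp)) (cong in₁ cy))
          (trans (cong (colours (realise e)) (sym (F.splitAt-↑ʳ (card types) n s)))
                 (colours-constant e bd hom (card types ↑ʳ s)))

      realised : ∀ {c} x y (h : Edge⁺ ψ φ c x y) → edge⁺Bound x y h ≤ M → Realised c (vertexCode⁺ x) (vertexCode⁺ y)
      realised (inj₁ x) (inj₁ y) (inj₁ h) b = realised-edge h b
      realised {c} (inj₁ x) (inj₁ y) (inj₂ h) b = Realised-sym {c} (realised-edge h b)
      realised {c} (inj₁ x) (inj₂ e) h b = Realised-sym {c} (realised-attached h b)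
      realised (inj₂ e) (inj₁ y) h b = realised-attached h b

      monoCopy : ∀ {c G} (K : Copy (Edge⁺ ψ φ c) _≈⁺_ G) → copyBound K ≤ M → MonoCopy extension C c G
      monoCopy {c} {G} K b = f , inj , λ u v a → let (h , e) = re u v a in h (ne u v a) , e
        where
        f : Fin (size G) → Fin (V + V ^ n)
        f u = vertexCode⁺ (vertex K u)
        inj : ∀ {u v} → f u ≡ f v → u ≡ v
        inj {u} {v} e = injective K (vertexCode⁺-injective (vertex K u) (vertex K v)
          (ℕ.≤-trans (vertexBound-≤ K u) b) (ℕ.≤-trans (vertexBound-≤ K v) b) e)
        re : ∀ u v → adj G u v ≡ true → Realised c (f u) (f v)
        re u v a = realised (vertex K u) (vertex K v) (preserves K u v a) (ℕ.≤-trans (edgeBound-≤ K u v a) b)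
        ne : ∀ u v → adj G u v ≡ true → f u ≢ f v
        ne u v a e with inj {u} {v} e
        ... | refl = contradiction (trans (sym a) (adj-irrefl G u)) λ ()

  module _ (ψ₀ : Type → Fin q) (avoids : ∀ i → ¬ Copy (Edge↔ ψ₀ i) _≈_ (Hs i))
           (forced : ∀ ψ φ → ∃ λ i → Copy (Edge⁺ ψ φ i) _≈⁺_ (Hs i)) where

    private
      typeColours : Fin (q ^ (card types + n)) → Type → Fin q
      typeColours κ τ = finToFun {q} {card types + n} κ (index types τ ↑ˡ n)

      positionColours : Fin (q ^ (card types + n)) → Fin n → Fin q
      positionColours κ s = finToFun {q} {card types + n} κ (card types ↑ʳ s)

      the : ∀ κ → ∃ λ i → Copy (Edge⁺ (typeColours κ) (positionColours κ) i) _≈⁺_ (Hs i)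
      the κ = forced (typeColours κ) (positionColours κ)

      -- The forced copy is fixed for every possible `κ` before `N` is chosen; the sum of their
      -- bounds is an `M` that serves whichever `κ` occurs.
      M : ℕ
      M = Σ[ (λ κ → copyBound (proj₂ (the κ))) ]

      N : ℕ
      N = proj₁ (ramsey (q ^ (card types + n)) (coordinates * bound) (coordinates * M))

      arrow : RamseyNumber (q ^ (card types + n)) (coordinates * bound) (coordinates * M) N
      arrow = proj₂ (ramsey (q ^ (card types + n)) (coordinates * bound) (coordinates * M))

    system-bound : ∀ {m d} → d * n ≤ m → sLeFrac q Hs m d
    system-bound {m} {d} le = Extension.conclusion (suc N) {q} {Hs}
      (Intended.base-avoiding c₀ Hs ψ₀ avoids (suc N)) {m} {d} le isRamsey
      where
      isRamsey : IsRamsey q Hs (Extension.extension (suc N))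
      -- The homogeneous list is not known when the colouring is handed to Ramsey's theorem; `χ` is
      -- the same for all `M` and `ys`, so it is taken here at `M = 0` and the full list.
      isRamsey C with arrow (allFin (suc N)) (ℕ.≤-trans (ℕ.n≤1+n N) (ℕ.≤-reflexive (sym (length-tabulate id))))
                        (Transport.χ N 0 C (allFin (suc N)) ⊆-refl′ (ℕ.≤-trans (ℕ.≤-reflexive (ℕ.*-zeroʳ coordinates)) z≤n))
        where
        open import Data.List.Relation.Binary.Sublist.Propositional using (⊆-refl)
        ⊆-refl′ : allFin (suc N) ⊆ allFin (suc N)
        ⊆-refl′ = ⊆-refl
      ... | ys , ys⊆ , len , κ , hom =
        proj₁ (the κ) , Transport.monoCopy N M C ys ys⊆ len hom (proj₂ (the κ)) (Σ-term (λ κ → copyBound (proj₂ (the κ))) κ)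

-- Cycles and cliques

≡ᵇ-sound : ∀ {m n} → (m ≡ᵇ n) ≡ true → m ≡ n
≡ᵇ-sound {m} {n} e = ℕ.≡ᵇ⇒≡ m n (Equivalence.from 𝔹.T-≡ e)

≡ᵇ-complete : ∀ {m n} → m ≡ n → (m ≡ᵇ n) ≡ true
≡ᵇ-complete {m} {n} e = Equivalence.to 𝔹.T-≡ (ℕ.≡⇒≡ᵇ m n e)

CycleStep : ℕ → ∀ {ℓ} → Fin ℓ → Fin ℓ → Set
CycleStep L i j = toℕ j ≡ suc (toℕ i) ⊎ (toℕ i ≡ L × toℕ j ≡ 0)

cycleRel : ∀ L → Fin (suc L) → Fin (suc L) → Bool
cycleRel L i j = (toℕ j ≡ᵇ suc (toℕ i)) ∨ ((toℕ i ≡ᵇ L) ∧ (toℕ j ≡ᵇ 0))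

cycle-step : ∀ L (i j : Fin (suc L)) → cycleRel L i j ≡ true → CycleStep L i j
cycle-step L i j e with toℕ j ≡ᵇ suc (toℕ i) in e₁
... | true = inj₁ (≡ᵇ-sound e₁)
... | false with toℕ i ≡ᵇ L in e₂ | toℕ j ≡ᵇ 0 in e₃
...   | true | true = inj₂ (≡ᵇ-sound {toℕ i} e₂ , ≡ᵇ-sound {toℕ j} e₃)
cycle-step L i j () | false | true | false
cycle-step L i j () | false | false | _

cycle-adj : ∀ L (i j : Fin (suc L)) → CycleStep L i j → cycleRel L i j ≡ true
cycle-adj L i j (inj₁ e) rewrite ≡ᵇ-complete {toℕ j} e = refl
cycle-adj L i j (inj₂ (e , e′)) rewrite ≡ᵇ-complete {toℕ i} e | ≡ᵇ-complete {toℕ j} e′ with toℕ j ≡ᵇ suc (toℕ i)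
... | true = refl
... | false = refl

module _ {A : Set} {R _≈_ : A → A → Set} where

  -- The cycle has `suc L` points. Indices in ℕ spare the arithmetic in `Fin`, with every condition
  -- restricted to indices up to `L`.
  record Cycle (L : ℕ) : Set where
    field
      point  : ℕ → A
      step   : ∀ {i} → i < L → R (point i) (point (suc i))
      close  : R (point L) (point 0)
      apart  : ∀ {i j} → i ≤ L → j ≤ L → point i ≈ point j → i ≡ j

  cycle-copy : (∀ {x y} → R x y → R y x) → ∀ {L} → Cycle L → Copy R _≈_ (cycle (suc L))
  cycle-copy R-sym {L} C = copy (point ∘ toℕ) (λ {u} {v} e → F.toℕ-injective (apart (F.toℕ≤pred[n] u) (F.toℕ≤pred[n] v) e)) rel
    where
    open Cycle C
    along : ∀ (u v : Fin (suc L)) → CycleStep L u v → R (point (toℕ u)) (point (toℕ v))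
    along u v (inj₁ e) = subst (λ k → R (point (toℕ u)) (point k)) (sym e)
      (step (ℕ.≤-pred (subst (_≤ suc L) (cong suc e) (F.toℕ<n v))))
    along u v (inj₂ (e , e′)) = subst₂ (λ j k → R (point j) (point k)) (sym e) (sym e′) close
    rel : ∀ u v → adj (cycle (suc L)) u v ≡ true → R (point (toℕ u)) (point (toℕ v))
    rel u v a with simpleGraph-adj (cycleRel L) {u} {v} a
    ... | _ , inj₁ r = along u v (cycle-step L u v r)
    ... | _ , inj₂ r = R-sym (along v u (cycle-step L v u r))

  copy-cycle : ∀ {L} → 1 ≤ L → Copy R _≈_ (cycle (suc L)) → Cycle L
  copy-cycle {L} 1≤L C = record
    { point = vertex C ∘ clamp
    ; step = λ {i} lt → preserves C (clamp i) (clamp (suc i))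
               (adj-simpleGraph (cycleRel L) {clamp i} {clamp (suc i)}
                 (λ e → ℕ.<⇒≢ (ℕ.n<1+n i) (trans (sym (toℕ-clamp (ℕ.<⇒≤ lt))) (trans (cong toℕ e) (toℕ-clamp lt))))
                 (cycle-adj L (clamp i) (clamp (suc i)) (inj₁ (trans (toℕ-clamp lt) (cong suc (sym (toℕ-clamp (ℕ.<⇒≤ lt))))))))
    ; close = preserves C (clamp L) (clamp 0)
                (adj-simpleGraph (cycleRel L) {clamp L} {clamp 0}
                  (λ e → ℕ.>⇒≢ 1≤L (trans (sym (toℕ-clamp ℕ.≤-refl)) (trans (cong toℕ e) (toℕ-clamp z≤n))))
                  (cycle-adj L (clamp L) (clamp 0) (inj₂ (toℕ-clamp ℕ.≤-refl , toℕ-clamp z≤n))))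
    ; apart = λ li lj e → trans (sym (toℕ-clamp li)) (trans (cong toℕ (injective C e)) (toℕ-clamp lj))
    }
    where
    clamp : ℕ → Fin (suc L)
    clamp i = fromℕ< (s≤s (ℕ.m⊓n≤n i L))
    toℕ-clamp : ∀ {i} → i ≤ L → toℕ (clamp i) ≡ i
    toℕ-clamp {i} le = trans (F.toℕ-fromℕ< _) (ℕ.m≤n⇒m⊓n≡m le)

complete-adj : ∀ {t} {u v : Fin t} → u ≢ v → adj (complete t) u v ≡ true
complete-adj {u = u} {v} ne = adj-simpleGraph (λ _ _ → true) {u} {v} ne refl

adj-complete : ∀ {t} {u v : Fin t} → adj (complete t) u v ≡ true → u ≢ v
adj-complete {u = u} {v} a = proj₁ (simpleGraph-adj (λ _ _ → true) {u} {v} a)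

-- The arrow relation between `K_m` and `K_t` for `q` colours.
CliqueRamsey : (q t m : ℕ) → Set
CliqueRamsey q t m = (c : Fin m → Fin m → Fin q) → (∀ u v → c u v ≡ c v u) →
  ∃ λ j → Σ (Fin t → Fin m) λ κ → Injective _≡_ _≡_ κ × (∀ {u v} → u ≢ v → c (κ u) (κ v) ≡ j)

module _ {q t m : ℕ} (K : CliqueRamsey q t m) (j₀ : Fin q) {A : Set} {R : Fin q → A → A → Set} {_≈_ : A → A → Set}
         (R-sym : ∀ {j x y} → R j x y → R j y x) (R-irrefl : ∀ {j x y} → R j x y → ¬ x ≈ y)
         (g : Fin m → A) (h : ∀ {a b} → a ≢ b → ∃ λ j → R j (g a) (g b)) where

  private
    c : Fin m → Fin m → Fin q
    c a b with a F.≟ b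
    ... | yes _ = j₀
    ... | no ne = proj₁ (h ne)

  -- Nothing is assumed about the injectivity of `g`: different places are joined by an edge, and
  -- irreflexivity keeps them apart.
  monochromatic-clique : ∃ λ j → Copy (R j) _≈_ (complete t)
  monochromatic-clique with K (symmetrize c) (symmetrize-sym c)
  ... | j , κ , inj , mono = j , copy (g ∘ κ) apart rel
    where
    edge-c : ∀ {a b} → a ≢ b → R (c a b) (g a) (g b)
    edge-c {a} {b} ne with a F.≟ b
    ... | yes e = ⊥-elim (ne e)
    ... | no ne′ = proj₂ (h ne′)
    rel′ : ∀ {u v} → u ≢ v → R j (g (κ u)) (g (κ v))
    rel′ {u} {v} ne with symmetrize-cases c (κ u) (κ v)
    ... | inj₁ e = subst (λ j → R j (g (κ u)) (g (κ v))) (trans (sym e) (mono ne)) (edge-c (ne ∘ inj))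
    ... | inj₂ e = R-sym (subst (λ j → R j (g (κ v)) (g (κ u))) (trans (sym e) (mono ne)) (edge-c (ne ∘ inj ∘ sym)))
    rel : ∀ u v → adj (complete t) u v ≡ true → R j (g (κ u)) (g (κ v))
    rel u v a = rel′ (adj-complete {u = u} {v} a)
    apart : ∀ {u v} → g (κ u) ≈ g (κ v) → u ≡ v
    apart {u} {v} e with u F.≟ v
    ... | yes p = p
    ... | no ne = ⊥-elim (R-irrefl (rel′ ne) e)

-- The coloured graph on the n positions, i.e. the neighbours of a new vertex.
record Pattern (q₁ q₂ t ρ n : ℕ) : Set₁ where
  field
    Joined    : Fin q₂ → Fin n → Fin n → Set
    joined?   : ∀ s s′ → Dec (∃ λ j → Joined j s s′)
    symmetric : ∀ {j s s′} → Joined j s s′ → Joined j s′ s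
    irreflexive : ∀ {j s} → ¬ Joined j s s
    clique-free : ∀ j (f : Fin t → Fin n) → ¬ (∀ {u v} → u ≢ v → Joined j (f u) (f v))
    hits      : (U : Fin n → Bool) → n ≤ q₁ + Σ[ (λ s → if U s then 1 else 0) ] →
                Σ (Fin ρ → Fin n) λ κ → (∀ a → U (κ a) ≡ true) × (∀ {a b} → a ≢ b → ∃ λ j → Joined j (κ a) (κ b))
open Pattern public

module Finish {n q₁ q₂ L t : ℕ} (𝕊 : System n) (j₀ : Fin q₂) where
  open Configurations 𝕊

  module _ (ψ₀ : Type → Fin (q₁ + q₂))
           (no-cycle  : ∀ c → ¬ Copy (Edge↔ ψ₀ (c ↑ˡ q₂)) _≈_ (cycle (suc L)))
           (no-clique : ∀ j → ¬ Copy (Edge↔ ψ₀ (q₁ ↑ʳ j)) _≈_ (complete t))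
           (forced : ∀ ψ φ → (∃ λ c → Copy (Edge⁺ ψ φ (c ↑ˡ q₂)) _≈⁺_ (cycle (suc L))) ⊎
                             (∃ λ j → Copy (Edge⁺ ψ φ (q₁ ↑ʳ j)) _≈⁺_ (complete t))) where

    private
      Hs : Fin (q₁ + q₂) → Graph
      Hs = 𝒯 q₁ q₂ (suc L) t

      Hs-cycle : ∀ c → Hs (c ↑ˡ q₂) ≡ cycle (suc L)
      Hs-cycle c rewrite F.splitAt-↑ˡ q₁ c q₂ = refl

      Hs-clique : ∀ j → Hs (q₁ ↑ʳ j) ≡ complete t
      Hs-clique j rewrite F.splitAt-↑ʳ q₁ q₂ j = refl

      avoids : ∀ i → ¬ Copy (Edge↔ ψ₀ i) _≈_ (Hs i)
      avoids i with splitAt q₁ i in eq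
      ... | inj₁ c = subst (λ i → ¬ Copy (Edge↔ ψ₀ i) _≈_ (cycle (suc L))) (F.splitAt⁻¹-↑ˡ eq) (no-cycle c)
      ... | inj₂ j = subst (λ i → ¬ Copy (Edge↔ ψ₀ i) _≈_ (complete t)) (F.splitAt⁻¹-↑ʳ eq) (no-clique j)

      forced′ : ∀ ψ φ → ∃ λ i → Copy (Edge⁺ ψ φ i) _≈⁺_ (Hs i)
      forced′ ψ φ with forced ψ φ
      ... | inj₁ (c , K) = c ↑ˡ q₂ , subst (Copy (Edge⁺ ψ φ (c ↑ˡ q₂)) _≈⁺_) (sym (Hs-cycle c)) K
      ... | inj₂ (j , K) = q₁ ↑ʳ j , subst (Copy (Edge⁺ ψ φ (q₁ ↑ʳ j)) _≈⁺_) (sym (Hs-clique j)) K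

    finish : ∀ {m d} → d * n ≤ m → sLeFrac (q₁ + q₂) (𝒯 q₁ q₂ (suc L) t) m d
    finish {m} {d} le = DegreeBound.system-bound 𝕊 (q₁ ↑ʳ j₀) Hs ψ₀ avoids forced′ {m} {d} le

classify : ∀ q₁ {q₂} (i : Fin (q₁ + q₂)) → (∃ λ c → i ≡ c ↑ˡ q₂) ⊎ (∃ λ j → i ≡ q₁ ↑ʳ j)
classify q₁ i with splitAt q₁ i in eq
... | inj₁ c = inj₁ (c , sym (F.splitAt⁻¹-↑ˡ eq))
... | inj₂ j = inj₂ (j , sym (F.splitAt⁻¹-↑ʳ eq))

injective-surjective : ∀ {n} (f : Fin n → Fin n) → (∀ {i j} → f i ≡ f j → i ≡ j) → ∀ y → ∃ λ x → f x ≡ y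
injective-surjective {suc n} f inj y with F.any? (λ x → f x F.≟ y)
... | yes p = p
... | no ¬p = ⊥-elim (ℕ.<⇒≱ (ℕ.n<1+n n) (F.injective⇒≤ {f = λ x → Fin.punchOut (ne x)} (λ {i} {j} e → inj (F.punchOut-injective (ne i) (ne j) e))))
  where
  ne : ∀ x → y ≢ f x
  ne x e = ¬p (x , sym e)

module _ {q₁ q₂ t ρ n : ℕ} (P : Pattern q₁ q₂ t ρ n) (φ : Fin n → Fin (q₁ + q₂)) where

  Repeated : Set
  Repeated = ∃ λ s → ∃ λ s′ → s Fin.< s′ × ∃ λ c → φ s ≡ c ↑ˡ q₂ × φ s′ ≡ c ↑ˡ q₂

  CliquePositions : Set
  CliquePositions = Σ (Fin ρ → Fin n) λ κ → (∀ a → ∃ λ j → φ (κ a) ≡ q₁ ↑ʳ j) ×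
                    (∀ {a b} → a ≢ b → ∃ λ j → Joined P j (κ a) (κ b))

  -- If no cycle colour repeats, each of the `q₁` cycle colours sits at one position at most, so all
  -- but `q₁` positions are clique-coloured and `hits` applies to them.
  repeated-or-clique : Repeated ⊎ CliquePositions
  repeated-or-clique with F.any? (λ s → F.any? λ s′ → (s F.<? s′) ×-dec F.any? λ c → (φ s F.≟ c ↑ˡ q₂) ×-dec (φ s′ F.≟ c ↑ˡ q₂))
  ... | yes r = inj₁ r
  ... | no ¬r = inj₂ (κ , (λ a → isClique (Uκ a)) , joined)
    where
    U : Fin n → Bool
    U s with classify q₁ (φ s)
    ... | inj₁ _ = false
    ... | inj₂ _ = true
    isClique : ∀ {s} → U s ≡ true → ∃ λ j → φ s ≡ q₁ ↑ʳ j
    isClique {s} e with classify q₁ (φ s)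
    ... | inj₂ p = p
    isClique {s} () | inj₁ _
    has : Fin n → Fin q₁ → Bool
    has s c = ⌊ φ s F.≟ c ↑ˡ q₂ ⌋
    [_] : Bool → ℕ
    [ b ] = if b then 1 else 0
    unique : ∀ c s s′ → has s c ≡ true → has s′ c ≡ true → s ≡ s′
    unique c s s′ p p′ with F.<-cmp s s′
    ... | tri< lt _ _ = ⊥-elim (¬r (s , s′ , lt , c , ⌊⌋-sound (_ F.≟ _) p , ⌊⌋-sound (_ F.≟ _) p′))
    ... | tri≈ _ e _ = e
    ... | tri> _ _ gt = ⊥-elim (¬r (s′ , s , gt , c , ⌊⌋-sound (_ F.≟ _) p′ , ⌊⌋-sound (_ F.≟ _) p))
    cover : ∀ s → 1 ≤ Σ[ (λ c → [ has s c ]) ] + [ U s ]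
    cover s with classify q₁ (φ s)
    ... | inj₂ _ = ℕ.m≤n+m 1 _
    ... | inj₁ (c , e) = ℕ.≤-trans (ℕ.≤-trans (ℕ.≤-reflexive (sym (cong [_] (⌊⌋-complete (φ s F.≟ c ↑ˡ q₂) e)))) (Σ-term (λ c → [ has s c ]) c)) (ℕ.m≤m+n _ _)
    large : n ≤ q₁ + Σ[ (λ s → [ U s ]) ]
    large = ℕ.≤-trans (ℕ.≤-reflexive (sym (Σ-one n))) (ℕ.≤-trans (Σ-mono cover)
      (ℕ.≤-trans (ℕ.≤-reflexive (Σ-+ (λ s → Σ[ (λ c → [ has s c ]) ]) (λ s → [ U s ])))
        (ℕ.+-monoˡ-≤ _ (ℕ.≤-trans (ℕ.≤-reflexive (Σ-swap (λ s c → [ has s c ])))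
          (ℕ.≤-trans (Σ-mono (λ c → Σ-atMostOne (λ s → has s c) (unique c))) (ℕ.≤-reflexive (Σ-one q₁)))))))
    κ = proj₁ (hits P U large)
    Uκ = proj₁ (proj₂ (hits P U large))
    joined : ∀ {a b} → a ≢ b → ∃ λ j → Joined P j (κ a) (κ b)
    joined = proj₂ (proj₂ (hits P U large))

module Edges {n : ℕ} (𝕊 : System n) where
  open Configurations 𝕊 public

  ≈-refl : ∀ {x} → x ≈ x
  ≈-refl = refl , λ _ → refl

  ≈-sym : ∀ {x y} → x ≈ y → y ≈ x
  ≈-sym (refl , e) = refl , sym ∘ e

  ≈-trans : ∀ {x y z} → x ≈ y → y ≈ z → x ≈ z
  ≈-trans (refl , e) (refl , f) = refl , λ d → trans (e d) (f d)

  Edge↔-sym : ∀ {q} {ψ : Type → Fin q} {c x y} → Edge↔ ψ c x y → Edge↔ ψ c y x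
  Edge↔-sym (inj₁ h) = inj₂ h
  Edge↔-sym (inj₂ h) = inj₁ h

  Edge⁺-sym : ∀ {q} {ψ : Type → Fin q} {φ c} x y → Edge⁺ ψ φ c x y → Edge⁺ ψ φ c y x
  Edge⁺-sym (inj₁ x) (inj₁ y) h = Edge↔-sym h
  Edge⁺-sym (inj₁ x) (inj₂ e) h = h
  Edge⁺-sym (inj₂ e) (inj₁ y) h = h

  Irreflexive : ∀ {q} → (Type → Fin q) → Set
  Irreflexive ψ = ∀ {c x y} → Edge ψ c x y → ¬ x ≈ y

  Edge⁺-irrefl : ∀ {q} {ψ : Type → Fin q} → Irreflexive ψ → ∀ {φ c} x y → Edge⁺ ψ φ c x y → ¬ x ≈⁺ y
  Edge⁺-irrefl irr (inj₁ x) (inj₁ y) (inj₁ h) e = irr h e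
  Edge⁺-irrefl irr (inj₁ x) (inj₁ y) (inj₂ h) e = irr h (≈-sym e)
  Edge⁺-irrefl irr (inj₁ x) (inj₂ e) h ()
  Edge⁺-irrefl irr (inj₂ e) (inj₁ y) h ()

  cliques : ∀ {q₁ q₂ t m ψ φ} → CliqueRamsey q₂ t m → Fin q₂ → Irreflexive {q₁ + q₂} ψ → (g : Fin m → Vertex⁺) →
            (∀ {a b} → a ≢ b → ∃ λ j → Edge⁺ ψ φ (q₁ ↑ʳ j) (g a) (g b)) →
            ∃ λ j → Copy (Edge⁺ ψ φ (q₁ ↑ʳ j)) _≈⁺_ (complete t)
  cliques {q₁} {q₂} {ψ = ψ} {φ} K j₀ irr g h = monochromatic-clique K j₀
    {R = λ j → Edge⁺ ψ φ (q₁ ↑ʳ j)} (λ {j} {x} {y} → Edge⁺-sym x y) (λ {j} {x} {y} → Edge⁺-irrefl irr {φ} {q₁ ↑ʳ j} x y) g h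

  -- A new vertex whose edges to a clique-coloured K_ρ are clique-coloured completes a K_{ρ+1}.
  clique-at : ∀ {q₁ q₂ t ρ ψ φ} → CliqueRamsey q₂ t (suc ρ) → Fin q₂ → Irreflexive {q₁ + q₂} ψ →
              (P : Pattern q₁ q₂ t ρ n) → CliquePositions P φ → (e : Config) →
              (∀ {j s s′} → Joined P j s s′ → ∃ λ j′ → Edge↔ ψ (q₁ ↑ʳ j′) (pos s e) (pos s′ e)) →
              ∃ λ j → Copy (Edge⁺ ψ φ (q₁ ↑ʳ j)) _≈⁺_ (complete t)
  clique-at {q₁} {q₂} {ρ = ρ} {ψ} {φ} K j₀ irr P (κ , cl , jn) e edges = cliques {q₁} {ψ = ψ} {φ} K j₀ irr g h
    where
    g : Fin (suc ρ) → Vertex⁺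
    g zero    = inj₂ e
    g (suc a) = inj₁ (pos (κ a) e)
    h : ∀ {a b} → a ≢ b → ∃ λ j → Edge⁺ ψ φ (q₁ ↑ʳ j) (g a) (g b)
    h {zero} {zero} ne = ⊥-elim (ne refl)
    h {zero} {suc b} ne = proj₁ (cl b) , attached (κ b) (proj₂ (cl b)) ≈-refl
    h {suc a} {zero} ne = proj₁ (cl a) , attached (κ a) (proj₂ (cl a)) ≈-refl
    h {suc a} {suc b} ne = edges (proj₂ (jn (ne ∘ cong suc)))

-- Odd cycles

bump : ∀ {A : Set} → Dec A → ℕ → ℕ
bump (yes _) x = suc x
bump (no _)  x = x

bump-≤ : ∀ {A : Set} (d : Dec A) x → bump d x ≤ suc x
bump-≤ (yes _) x = ℕ.≤-refl
bump-≤ (no _)  x = ℕ.n≤1+n x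

bump-yes : ∀ {A : Set} (d : Dec A) → A → ∀ x → bump d x ≡ suc x
bump-yes (yes _) a x = refl
bump-yes (no ¬a) a x = ⊥-elim (¬a a)

bump-no : ∀ {A : Set} (d : Dec A) → ¬ A → ∀ x → bump d x ≡ x
bump-no (yes a) ¬a x = ⊥-elim (¬a a)
bump-no (no _) ¬a x = refl

∧-sound : ∀ {a b} → a ∧ b ≡ true → a ≡ true × b ≡ true
∧-sound {true} {true} _ = refl , refl

-- The vertices of the odd construction carry a pair of numbers for each position s < n and a window of
-- r numbers for each cycle colour.  Two vertices are joined in a clique colour if they agree in all pairs except
-- two, one of which is shifted up and the other down; they are joined in the cycle colour i if all pairs agree
-- and the i-th window is shifted by one.  All other windows jump, i.e. become disjoint.
module OddSystem {q₁ q₂ t ρ n : ℕ} (P : Pattern q₁ q₂ t ρ n) (j₀ : Fin q₂) (L : ℕ) where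

  -- After a closed walk of `suc L` shifts, entries with indices up to `suc L` have to be compared;
  -- a window of `L + 2` entries is just long enough.
  r : ℕ
  r = suc (suc L)

  Coord : Set
  Coord = Fin n ⊎ Fin q₁

  EdgeType : Set
  EdgeType = (Fin n × Fin n) ⊎ Fin q₁

  -- All coordinates have `r` slots. A pair needs two, and `x ⊓ 1` repeats its upper number in the
  -- others; `bump` moves a pair from the indices 0, 1 to the indices 1, 2.
  srcIx tgtIx : EdgeType → Coord → ℕ → ℕ
  srcIx (inj₁ (s , s′)) (inj₁ w) x = bump (w F.≟ s) (x ⊓ 1)
  srcIx (inj₁ _)        (inj₂ j) x = x
  srcIx (inj₂ i)        (inj₁ w) x = x ⊓ 1
  srcIx (inj₂ i)        (inj₂ j) x = x
  tgtIx (inj₁ (s , s′)) (inj₁ w) x = bump (w F.≟ s′) (x ⊓ 1)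
  tgtIx (inj₁ _)        (inj₂ j) x = r + x
  tgtIx (inj₂ i)        (inj₁ w) x = x ⊓ 1
  tgtIx (inj₂ i)        (inj₂ j) x with i F.≟ j
  ... | yes _ = suc x
  ... | no _  = r + x

  -- Position `s` is raised in its own pair, and its windows occupy block `s`. For `s < s′` this is
  -- the order pattern of the type `inj₁ (s , s′)`, so joined positions of one new vertex are
  -- adjacent.
  posIx : Fin n → Coord → ℕ → ℕ
  posIx s (inj₁ w) x = bump (w F.≟ s) (x ⊓ 1)
  posIx s (inj₂ j) x = toℕ s * r + x

  B : ℕ
  B = (2 + n) * r

  r≤B : r + r ≤ B
  r≤B = ℕ.+-monoʳ-≤ r (ℕ.m≤m+n r (n * r))

  small : ∀ {x y} → x < r → y ≤ suc x → y < B
  small lt le = ℕ.<-≤-trans (s≤s le) (ℕ.≤-trans (s≤s lt) (ℕ.≤-trans (ℕ.+-monoˡ-≤ r {1} {r} (s≤s z≤n)) r≤B))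

  capped : ∀ {A : Set} (d : Dec A) x → bump d (x ⊓ 1) ≤ suc x
  capped d x = ℕ.≤-trans (bump-≤ d (x ⊓ 1)) (s≤s (ℕ.m⊓n≤m x 1))

  srcIx-< : ∀ τ c {x} → x < r → srcIx τ c x < B
  srcIx-< (inj₁ (s , s′)) (inj₁ w) {x} lt = small lt (capped (w F.≟ s) x)
  srcIx-< (inj₁ _) (inj₂ j) lt = small lt (ℕ.n≤1+n _)
  srcIx-< (inj₂ i) (inj₁ w) {x} lt = small lt (ℕ.≤-trans (ℕ.m⊓n≤m x 1) (ℕ.n≤1+n _))
  srcIx-< (inj₂ i) (inj₂ j) lt = small lt (ℕ.n≤1+n _)

  tgtIx-< : ∀ τ c {x} → x < r → tgtIx τ c x < B
  tgtIx-< (inj₁ (s , s′)) (inj₁ w) {x} lt = small lt (capped (w F.≟ s′) x)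
  tgtIx-< (inj₁ _) (inj₂ j) lt = ℕ.<-≤-trans (ℕ.+-monoʳ-< r lt) r≤B
  tgtIx-< (inj₂ i) (inj₁ w) {x} lt = small lt (ℕ.≤-trans (ℕ.m⊓n≤m x 1) (ℕ.n≤1+n _))
  tgtIx-< (inj₂ i) (inj₂ j) lt with i F.≟ j
  ... | yes _ = small lt ℕ.≤-refl
  ... | no _  = ℕ.<-≤-trans (ℕ.+-monoʳ-< r lt) r≤B

  posIx-< : ∀ s c {x} → x < r → posIx s c x < B
  posIx-< s (inj₁ w) {x} lt = small lt (capped (w F.≟ s) x)
  posIx-< s (inj₂ j) {x} lt = ℕ.<-≤-trans (ℕ.+-monoʳ-< (toℕ s * r) lt)
    (ℕ.≤-trans (ℕ.≤-reflexive (ℕ.+-comm (toℕ s * r) r)) (ℕ.*-monoˡ-≤ r (ℕ.≤-trans (F.toℕ<n s) (ℕ.m≤n+m n 2))))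

  coordOf : Fin ((n + q₁) * r) → Coord
  coordOf d = splitAt n (quotient r d)

  placeOf : Fin ((n + q₁) * r) → Fin r
  placeOf d = remainder {n + q₁} r d

  system : System n
  system = record
    { Sort = Fin 1 ; Type = EdgeType
    ; sorts = finite-Fin 1
    ; types = finite-⊎ (finite-× (finite-Fin n) (finite-Fin n)) (finite-Fin q₁)
    ; slots = (n + q₁) * r ; coordinates = n + q₁ ; bound = B
    ; coordinate = λ _ d → quotient r d
    ; source = λ _ → zero ; target = λ _ → zero
    ; sourceIx = λ τ d → srcIx τ (coordOf d) (toℕ (placeOf d))
    ; targetIx = λ τ d → tgtIx τ (coordOf d) (toℕ (placeOf d))
    ; sourceIx< = λ τ d → srcIx-< τ (coordOf d) (F.toℕ<n (placeOf d))
    ; targetIx< = λ τ d → tgtIx-< τ (coordOf d) (F.toℕ<n (placeOf d))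
    ; valid = λ { (inj₁ (s , s′)) → ⌊ s F.<? s′ ⌋ ∧ ⌊ joined? P s s′ ⌋ ; (inj₂ _) → true }
    ; position = λ _ → zero
    ; positionIx = λ s d → posIx s (coordOf d) (toℕ (placeOf d))
    ; positionIx< = λ s d → posIx-< s (coordOf d) (F.toℕ<n (placeOf d))
    }

  open Edges system public

  coordinateOf : Coord → Fin (n + q₁)
  coordinateOf (inj₁ w) = w ↑ˡ q₁
  coordinateOf (inj₂ i) = n ↑ʳ i

  splitAt-coordinateOf : ∀ c → splitAt n (coordinateOf c) ≡ c
  splitAt-coordinateOf (inj₁ w) = F.splitAt-↑ˡ n w q₁
  splitAt-coordinateOf (inj₂ i) = F.splitAt-↑ʳ n q₁ i

  slot : Coord → Fin r → Fin ((n + q₁) * r)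
  slot c x = combine (coordinateOf c) x

  read : Vertex → Coord → Fin r → ℕ
  read (_ , u) c x = u (slot c x)

  quotient-slot : ∀ c x → quotient r (slot c x) ≡ coordinateOf c
  quotient-slot c x = cong proj₁ (F.remQuot-combine (coordinateOf c) x)

  read-at : ∀ e {u} (ix : Coord → ℕ → ℕ) → u ≈ at e zero (λ d → ix (coordOf d) (toℕ (placeOf d))) →
            ∀ c x → read u c x ≡ e (coordinateOf c) (ix c (toℕ x))
  read-at e ix (_ , eq) c x = trans (eq (slot c x))
    (trans (cong₂ (λ p y → e p (ix (splitAt n p) (toℕ y))) (quotient-slot c x) (cong proj₂ (F.remQuot-combine {n + q₁} (coordinateOf c) x)))
           (cong (λ c′ → e (coordinateOf c) (ix c′ (toℕ x))) (splitAt-coordinateOf c)))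

  ψ₀ : EdgeType → Fin (q₁ + q₂)
  ψ₀ (inj₁ (s , s′)) with joined? P s s′
  ... | yes (j , _) = q₁ ↑ʳ j
  ... | no _        = q₁ ↑ʳ j₀
  ψ₀ (inj₂ i) = i ↑ˡ q₂

  clique≢cycle : ∀ {c : Fin q₁} {j : Fin q₂} → q₁ ↑ʳ j ≢ c ↑ˡ q₂
  clique≢cycle {c} {j} e = contradiction (trans (sym (F.splitAt-↑ʳ q₁ q₂ j)) (trans (cong (splitAt q₁) e) (F.splitAt-↑ˡ q₁ c q₂))) λ ()

  record Shifted (a b : ℕ → ℕ) : Set where
    field
      shift : ∀ {x} → suc x < r → b x ≡ a (suc x)
      injˡ  : ∀ {x y} → x < r → y < r → a x ≡ a y → x ≡ y
      injʳ  : ∀ {x y} → x < r → y < r → b x ≡ b y → x ≡ y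
  open Shifted

  window : Vertex → Fin q₁ → ℕ → ℕ
  window u i x = read u (inj₂ i) (fromℕ< (s≤s (ℕ.m⊓n≤n x (suc L))))

  window-at : ∀ e {u} (ix : Coord → ℕ → ℕ) → u ≈ at e zero (λ d → ix (coordOf d) (toℕ (placeOf d))) →
              ∀ i {x} → x < r → window u i x ≡ e (coordinateOf (inj₂ i)) (ix (inj₂ i) x)
  window-at e ix h i {x} lt = trans (read-at e ix h (inj₂ i) _)
    (cong (e (n ↑ʳ i) ∘ ix (inj₂ i)) (trans (F.toℕ-fromℕ< _) (ℕ.m≤n⇒m⊓n≡m (ℕ.≤-pred lt))))

  increasing-injective : ∀ {b e} → Increasing b e → ∀ {x y} → x < b → y < b → e x ≡ e y → x ≡ y
  increasing-injective inc {x} {y} lx ly e with ℕ.<-cmp x y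
  ... | tri< lt _ _ = ⊥-elim (ℕ.<⇒≢ (inc lt ly) e)
  ... | tri≈ _ eq _ = eq
  ... | tri> _ _ gt = ⊥-elim (ℕ.<⇒≢ (inc gt lx) (sym e))

  cycle-edge : ∀ {c x y} → Edge ψ₀ (c ↑ˡ q₂) x y → Shifted (window x c) (window y c)
  cycle-edge (edge (inj₁ (s , s′)) ok eq e ex ey) with joined? P s s′
  ... | yes (j , _) = ⊥-elim (clique≢cycle eq)
  ... | no _ = ⊥-elim (clique≢cycle eq)
  cycle-edge {c} {x} {y} (edge (inj₂ i) ok eq e ex ey) with F.↑ˡ-injective q₂ i c eq
  ... | refl = record
    { shift = λ lt → trans (yv (ℕ.<-trans (ℕ.n<1+n _) lt)) (sym (xv lt))
    ; injˡ = λ lx ly h → increasing-injective (increasing e (n ↑ʳ c)) (small lx (ℕ.n≤1+n _)) (small ly (ℕ.n≤1+n _)) (trans (sym (xv lx)) (trans h (xv ly)))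
    ; injʳ = λ lx ly h → ℕ.suc-injective (increasing-injective (increasing e (n ↑ʳ c)) (small lx ℕ.≤-refl) (small ly ℕ.≤-refl) (trans (sym (yv lx)) (trans h (yv ly)))) }
    where
    xv : ∀ {k} → k < r → window x c k ≡ values e (n ↑ʳ c) k
    xv = window-at (values e) (srcIx (inj₂ c)) ex c
    same : ∀ k → tgtIx (inj₂ c) (inj₂ c) k ≡ suc k
    same k with c F.≟ c
    ... | yes _ = refl
    ... | no ¬p = ⊥-elim (¬p refl)
    yv : ∀ {k} → k < r → window y c k ≡ values e (n ↑ʳ c) (suc k)
    yv lt = trans (window-at (values e) (tgtIx (inj₂ c)) ey c lt) (cong (values e (n ↑ʳ c)) (same _))

  -- After f forward and b backward steps the window has moved f ∸ b places.
  Moved : (f b : ℕ) → (a z : ℕ → ℕ) → Set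
  Moved f b a z = ∀ {x} → x + (f + b) < r → z (b + x) ≡ a (f + x)

  private
    lemma₁ : ∀ x f b → x + suc (f + b) ≡ suc (x + (f + b))
    lemma₁ x f b = ℕ.+-suc x (f + b)

    b+x<r : ∀ {x f b k} → x + (f + b) < k → b + x < k
    b+x<r {x} {f} {b} lt = ℕ.≤-<-trans (ℕ.≤-trans (ℕ.≤-reflexive (ℕ.+-comm b x)) (ℕ.+-monoʳ-≤ x (ℕ.m≤n+m b f))) lt

  moved-forward : ∀ {f b a z z′} → Moved f b a z → Shifted z z′ → Moved (suc f) b a z′
  moved-forward {f} {b} {a} {z} {z′} mv sh {x} lt =
    trans (shift sh (b+x<r {suc x} {f} {b} lt′ ∘′))
      (trans (cong z (sym (ℕ.+-suc b x))) (trans (mv {suc x} lt′) (cong a (ℕ.+-suc f x))))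
    where
    lt′ : suc x + (f + b) < r
    lt′ = subst (_< r) (lemma₁ x f b) lt
    _∘′ : b + suc x < r → suc (b + x) < r
    _∘′ = subst (_< r) (ℕ.+-suc b x)

  moved-backward : ∀ {f b a z z′} → Moved f b a z → Shifted z′ z → Moved f (suc b) a z′
  moved-backward {f} {b} {a} {z} {z′} mv sh {x} lt =
    trans (sym (shift sh (b+x<r {x} {f} {suc b} lt))) (mv (ℕ.<-trans (ℕ.+-monoʳ-< x (ℕ.+-monoʳ-< f (ℕ.n<1+n b))) lt))

  moved-walk : (p : ℕ → ℕ → ℕ) → ∀ m → (∀ {k} → k < m → Shifted (p k) (p (suc k)) ⊎ Shifted (p (suc k)) (p k)) →
               ∃ λ f → ∃ λ b → f + b ≡ m × Moved f b (p 0) (p m)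
  moved-walk p zero st = 0 , 0 , refl , λ _ → refl
  moved-walk p (suc m) st with moved-walk p m (λ lt → st (ℕ.<-trans lt (ℕ.n<1+n m)))
  ... | f , b , e , mv with st (ℕ.n<1+n m)
  ...   | inj₁ sh = suc f , b , cong suc e , moved-forward {f} {b} {p 0} {p m} {p (suc m)} mv sh
  ...   | inj₂ sh = f , suc b , trans (ℕ.+-suc f b) (cong suc e) , moved-backward {f} {b} {p 0} {p m} {p (suc m)} mv sh

  -- Once around the cycle, `f` forward and `b` backward steps identify the entries `f` and `b` of
  -- one and the same window. Its entries are distinct, hence `f ≡ b`, although `f + b` is odd.
  no-cycle : (∀ f → suc L ≢ f + f) → 1 ≤ L → ∀ c → ¬ Copy (Edge↔ ψ₀ (c ↑ˡ q₂)) _≈_ (cycle (suc L))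
  no-cycle odd 1≤L c K = closed (moved-walk w L (λ lt → edge-step (Cycle.step C lt)))
    where
    C : Cycle {R = Edge↔ ψ₀ (c ↑ˡ q₂)} {_≈_} L
    C = copy-cycle 1≤L K
    w : ℕ → ℕ → ℕ
    w k = window (Cycle.point C k) c
    edge-step : ∀ {x y} → Edge↔ ψ₀ (c ↑ˡ q₂) x y → Shifted (window x c) (window y c) ⊎ Shifted (window y c) (window x c)
    edge-step (inj₁ h) = inj₁ (cycle-edge h)
    edge-step (inj₂ h) = inj₂ (cycle-edge h)
    inj-of : ∀ {a b} → Shifted a b ⊎ Shifted b a → ∀ {x y} → x < r → y < r → a x ≡ a y → x ≡ y
    inj-of (inj₁ sh) = injˡ sh
    inj-of (inj₂ sh) = injʳ sh
    finish : ∀ f b → f + b ≡ suc L → Moved f b (w 0) (w 0) → ⊥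
    finish f b e mv = odd f (trans (sym e) (cong (f +_) (trans (sym (ℕ.+-identityʳ b)) (trans b≡f (ℕ.+-identityʳ f)))))
      where
      bd : ∀ {k} → k ≤ f + b → k + 0 < r
      bd {k} le = s≤s (ℕ.≤-trans (ℕ.≤-reflexive (ℕ.+-identityʳ k)) (ℕ.≤-trans le (ℕ.≤-reflexive e)))
      b≡f : b + 0 ≡ f + 0
      b≡f = inj-of (edge-step (Cycle.step C 1≤L)) (bd (ℕ.m≤n+m b f)) (bd (ℕ.m≤m+n f b)) (mv {0} (s≤s (ℕ.≤-reflexive e)))
    closed : (∃ λ f → ∃ λ b → f + b ≡ L × Moved f b (w 0) (w L)) → ⊥
    closed (f , b , e , mv) with edge-step (Cycle.close C)
    ... | inj₁ sh = finish (suc f) b (cong suc e) (moved-forward {f} {b} {w 0} {w L} {w 0} mv sh)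
    ... | inj₂ sh = finish f (suc b) (trans (ℕ.+-suc f b) (cong suc e)) (moved-backward {f} {b} {w 0} {w L} {w 0} mv sh)

  lower upper : Vertex → Fin n → ℕ
  lower u w = read u (inj₁ w) zero
  upper u w = read u (inj₁ w) (suc zero)

  -- The pairs abut: that of `u` starts where that of `v` ends. This equality, and not only the
  -- order, rules out that one vertex of a triangle lies two raises above another.
  record Raised (u v : Vertex) (w : Fin n) : Set where
    constructor raised
    field
      touch : lower u w ≡ upper v w
      low   : lower v w < lower u w
      up    : upper v w < upper u w
  open Raised

  Agree : Vertex → Vertex → Fin n → Set
  Agree u v w = lower u w ≡ lower v w

  record Exchange (j : Fin q₂) (u v : Vertex) : Set where
    constructor exchange
    field
      α β   : Fin n
      joins : Joined P j α β
      atα   : Raised u v α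
      atβ   : Raised v u β
      off   : ∀ w → w ≢ α → w ≢ β → Agree u v w × upper u w ≡ upper v w
  open Exchange

  exchange-sym : ∀ {j u v} → Exchange j u v → Exchange j v u
  exchange-sym (exchange α β jn a b o) = exchange β α (symmetric P jn) b a λ w w≢β w≢α → let (p , q) = o w w≢α w≢β in sym p , sym q

  clique-edge : ∀ {j x y} → Edge ψ₀ (q₁ ↑ʳ j) x y → Exchange j x y
  clique-edge (edge (inj₂ i) ok eq e ex ey) = ⊥-elim (clique≢cycle (sym eq))
  clique-edge {j} {x} {y} (edge (inj₁ (s , s′)) ok eq e ex ey) with joined? P s s′ | ok
  ... | no _ | ok = contradiction (proj₂ (∧-sound {⌊ s F.<? s′ ⌋} ok)) λ ()
  ... | yes (j′ , jn) | ok with F.↑ʳ-injective q₁ j′ j eq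
  ...   | refl = exchange s s′ jn
          (raised (trans (xs zero) (sym (ys (suc zero)))) (subst₂ _<_ (sym (ys zero)) (sym (xs zero)) (inc s (s≤s z≤n) 1<B))
             (subst₂ _<_ (sym (ys (suc zero))) (sym (xs (suc zero))) (inc s (s≤s (s≤s z≤n)) 2<B)))
          (raised (trans (ys′ zero) (sym (xs′ (suc zero)))) (subst₂ _<_ (sym (xs′ zero)) (sym (ys′ zero)) (inc s′ (s≤s z≤n) 1<B))
             (subst₂ _<_ (sym (xs′ (suc zero))) (sym (ys′ (suc zero))) (inc s′ (s≤s (s≤s z≤n)) 2<B)))
          λ w w≢s w≢s′ → same w w≢s w≢s′ zero , same w w≢s w≢s′ (suc zero)
    where
    s≢s′ : s ≢ s′
    s≢s′ e = ℕ.<⇒≢ (⌊⌋-sound (s F.<? s′) (proj₁ (∧-sound ok))) (cong toℕ e)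
    1<B : 1 < B
    1<B = small (s≤s z≤n) ℕ.≤-refl
    2<B : 2 < B
    2<B = small {1} (s≤s (s≤s z≤n)) ℕ.≤-refl
    inc : ∀ w {a b} → a < b → b < B → values e (w ↑ˡ q₁) a < values e (w ↑ˡ q₁) b
    inc w = increasing e (w ↑ˡ q₁)
    rx : ∀ w x′ → read x (inj₁ w) x′ ≡ values e (w ↑ˡ q₁) (bump (w F.≟ s) (toℕ x′ ⊓ 1))
    rx w = read-at (values e) (srcIx (inj₁ (s , s′))) ex (inj₁ w)
    ry : ∀ w x′ → read y (inj₁ w) x′ ≡ values e (w ↑ˡ q₁) (bump (w F.≟ s′) (toℕ x′ ⊓ 1))
    ry w = read-at (values e) (tgtIx (inj₁ (s , s′))) ey (inj₁ w)
    xs : ∀ k → read x (inj₁ s) k ≡ values e (s ↑ˡ q₁) (suc (toℕ k ⊓ 1))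
    xs k = trans (rx s k) (cong (values e (s ↑ˡ q₁)) (bump-yes (s F.≟ s) refl _))
    ys : ∀ k → read y (inj₁ s) k ≡ values e (s ↑ˡ q₁) (toℕ k ⊓ 1)
    ys k = trans (ry s k) (cong (values e (s ↑ˡ q₁)) (bump-no (s F.≟ s′) s≢s′ _))
    xs′ : ∀ k → read x (inj₁ s′) k ≡ values e (s′ ↑ˡ q₁) (toℕ k ⊓ 1)
    xs′ k = trans (rx s′ k) (cong (values e (s′ ↑ˡ q₁)) (bump-no (s′ F.≟ s) (s≢s′ ∘ sym) _))
    ys′ : ∀ k → read y (inj₁ s′) k ≡ values e (s′ ↑ˡ q₁) (suc (toℕ k ⊓ 1))
    ys′ k = trans (ry s′ k) (cong (values e (s′ ↑ˡ q₁)) (bump-yes (s′ F.≟ s′) refl _))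
    same : ∀ w → w ≢ s → w ≢ s′ → ∀ k → read x (inj₁ w) k ≡ read y (inj₁ w) k
    same w w≢s w≢s′ k = trans (rx w k) (trans (cong (values e (w ↑ˡ q₁)) (trans (bump-no (w F.≟ s) w≢s _) (sym (bump-no (w F.≟ s′) w≢s′ _)))) (sym (ry w k)))

  module _ {j : Fin q₂} where

    -- Relative to a common neighbour u, two adjacent vertices are raised at the same position or lowered at the same position.
    star : ∀ {u x y} (X : Exchange j x u) (Y : Exchange j y u) → Exchange j x y →
           (α X ≡ α Y × Joined P j (β X) (β Y)) ⊎ (β X ≡ β Y × Joined P j (α X) (α Y))
    star {u} {x} {y} X Y Z = result
      where
      open ℕ.≤-Reasoning
      compare : ∀ w → (w ≡ α Z × Raised x y w) ⊎ (w ≡ β Z × Raised y x w) ⊎ (Agree x y w)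
      compare w with w F.≟ α Z | w F.≟ β Z
      ... | yes refl | _ = inj₁ (refl , atα Z)
      ... | no _ | yes refl = inj₂ (inj₁ (refl , atβ Z))
      ... | no a | no b = inj₂ (inj₂ (proj₁ (off Z w a b)))
      above : ∀ w → lower y w < lower x w → w ≡ α Z
      above w lt with compare w
      ... | inj₁ (e , _) = e
      ... | inj₂ (inj₁ (_ , r′)) = ⊥-elim (ℕ.<-asym lt (low r′))
      ... | inj₂ (inj₂ e) = ⊥-elim (ℕ.<⇒≢ lt (sym e))
      below : ∀ w → lower x w < lower y w → w ≡ β Z
      below w lt with compare w
      ... | inj₁ (_ , r′) = ⊥-elim (ℕ.<-asym lt (low r′))
      ... | inj₂ (inj₁ (e , _)) = e
      ... | inj₂ (inj₂ e) = ⊥-elim (ℕ.<⇒≢ lt e)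
      α≢β′ : α X ≢ β Y
      α≢β′ e with compare (α X)
      ... | inj₁ (_ , r′) = ℕ.<⇒≢ (low (atα X)) (trans (subst (λ w → lower u w ≡ upper y w) (sym e) (touch (atβ Y))) (sym (touch r′)))
      ... | inj₂ (inj₁ (_ , r′)) = ℕ.<-asym (low r′) (ℕ.<-trans (subst (λ w → lower y w < lower u w) (sym e) (low (atβ Y))) (low (atα X)))
      ... | inj₂ (inj₂ e′) = ℕ.<⇒≢ (ℕ.<-trans (subst (λ w → lower y w < lower u w) (sym e) (low (atβ Y))) (low (atα X))) (sym e′)
      α′≢β : α Y ≢ β X
      α′≢β e with compare (α Y)
      ... | inj₁ (_ , r′) = ℕ.<-asym (low r′) (ℕ.<-trans (subst (λ w → lower x w < lower u w) (sym e) (low (atβ X))) (low (atα Y)))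
      ... | inj₂ (inj₁ (_ , r′)) = ℕ.<⇒≢ (low (atα Y)) (trans (subst (λ w → lower u w ≡ upper x w) (sym e) (touch (atβ X))) (sym (touch r′)))
      ... | inj₂ (inj₂ e′) = ℕ.<⇒≢ (ℕ.<-trans (subst (λ w → lower x w < lower u w) (sym e) (low (atβ X))) (low (atα Y))) e′
      raised-x : α X ≢ α Y → α X ≡ α Z
      raised-x ne = above (α X) (subst (_< lower x (α X)) (sym (proj₁ (off Y (α X) ne α≢β′))) (low (atα X)))
      raised-y : α X ≢ α Y → α Y ≡ β Z
      raised-y ne = below (α Y) (subst (_< lower y (α Y)) (sym (proj₁ (off X (α Y) (ne ∘ sym) α′≢β))) (low (atα Y)))
      lowered-x : β X ≢ β Y → β X ≡ β Z
      lowered-x ne = below (β X) (subst (lower x (β X) <_) (sym (proj₁ (off Y (β X) (α′≢β ∘ sym) ne))) (low (atβ X)))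
      lowered-y : β X ≢ β Y → β Y ≡ α Z
      lowered-y ne = above (β Y) (subst (lower y (β Y) <_) (sym (proj₁ (off X (β Y) (α≢β′ ∘ sym) (ne ∘ sym)))) (low (atβ Y)))
      equal : α X ≡ α Y → β X ≡ β Y → ⊥
      equal eα eβ with α Z F.≟ α X | α Z F.≟ β X
      ... | yes e | _ = ℕ.<⇒≢ (low (atα Z)) (trans (touch (subst (Raised y u) (trans (sym eα) (sym e)) (atα Y))) (sym (touch (subst (Raised x u) (sym e) (atα X)))))
      ... | no _ | yes e = ℕ.<⇒≢ (up (atα Z)) (trans (sym (touch (subst (Raised u y) (trans (sym eβ) (sym e)) (atβ Y)))) (touch (subst (Raised u x) (sym e) (atβ X))))
      ... | no a | no b = ℕ.<⇒≢ (low (atα Z)) (trans (proj₁ (off Y (α Z) (λ e → a (trans e (sym eα))) (λ e → b (trans e (sym eβ))))) (sym (proj₁ (off X (α Z) a b))))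
      result : (α X ≡ α Y × Joined P j (β X) (β Y)) ⊎ (β X ≡ β Y × Joined P j (α X) (α Y))
      result with α X F.≟ α Y | β X F.≟ β Y
      ... | yes eα | yes eβ = ⊥-elim (equal eα eβ)
      ... | yes eα | no ne = inj₁ (eα , symmetric P (subst₂ (Joined P j) (sym (lowered-y ne)) (sym (lowered-x ne)) (joins Z)))
      ... | no ne | yes eβ = inj₂ (eβ , subst₂ (Joined P j) (sym (raised-x ne)) (sym (raised-y ne)) (joins Z))
      ... | no ne | no ne′ = ⊥-elim (α′≢β (trans (raised-y ne) (sym (lowered-x ne′))))

    apart-joined : ∀ {s s′} → Joined P j s s′ → s ≢ s′
    apart-joined jn refl = irreflexive P jn

    -- The edges at `f zero` all share their raised position or all share their lowered one: an edge
    -- that deviates from the first two would identify two positions that are joined, against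
    -- irreflexivity. The shared position and the other ends of the exchanges form the clique.
    clique-positions : ∀ {m} (f : Fin (3 + m) → Vertex) → (∀ {a b} → a ≢ b → Exchange j (f a) (f b)) →
                       Σ (Fin (3 + m) → Fin n) λ κ → ∀ {a b} → a ≢ b → Joined P j (κ a) (κ b)
    clique-positions {m} f ex = result (T {zero} {suc zero} λ ())
      where
      E : ∀ a → Exchange j (f (suc a)) (f zero)
      E a = ex λ ()
      T : ∀ {a b : Fin (2 + m)} → a ≢ b → (α (E a) ≡ α (E b) × Joined P j (β (E a)) (β (E b))) ⊎
                                         (β (E a) ≡ β (E b) × Joined P j (α (E a)) (α (E b)))
      T ne = star (E _) (E _) (ex (ne ∘ F.suc-injective))
      build : (κ : Fin (2 + m) → Fin n) (k₀ : Fin n) → (∀ a → Joined P j k₀ (κ a)) → (∀ {a b} → a ≢ b → Joined P j (κ a) (κ b)) →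
              Σ (Fin (3 + m) → Fin n) λ κ → ∀ {a b} → a ≢ b → Joined P j (κ a) (κ b)
      build κ k₀ h₀ h = κ′ , λ {a} {b} → h′ {a} {b}
        where
        κ′ : Fin (3 + m) → Fin n
        κ′ zero = k₀
        κ′ (suc a) = κ a
        h′ : ∀ {a b} → a ≢ b → Joined P j (κ′ a) (κ′ b)
        h′ {zero} {zero} ne = ⊥-elim (ne refl)
        h′ {zero} {suc b} ne = h₀ b
        h′ {suc a} {zero} ne = symmetric P (h₀ a)
        h′ {suc a} {suc b} ne = h (ne ∘ cong suc)
      result : (α (E zero) ≡ α (E (suc zero)) × Joined P j (β (E zero)) (β (E (suc zero)))) ⊎
               (β (E zero) ≡ β (E (suc zero)) × Joined P j (α (E zero)) (α (E (suc zero)))) →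
               Σ (Fin (3 + m) → Fin n) λ κ → ∀ {a b} → a ≢ b → Joined P j (κ a) (κ b)
      result (inj₁ (eα , jβ)) = build (β ∘ E) (α (E zero)) (λ a → subst (λ w → Joined P j w (β (E a))) (sym (all a)) (joins (E a))) pair
        where
        all : ∀ a → α (E zero) ≡ α (E a)
        all zero = refl
        all (suc zero) = eα
        all (suc (suc a)) with T {zero} {suc (suc a)} (λ ()) | T {suc zero} {suc (suc a)} (λ ())
        ... | inj₁ (e , _) | _ = e
        ... | inj₂ (_ , _) | inj₁ (e , _) = trans eα e
        ... | inj₂ (e , _) | inj₂ (e′ , _) = ⊥-elim (apart-joined jβ (trans e (sym e′)))
        pair : ∀ {a b} → a ≢ b → Joined P j (β (E a)) (β (E b))
        pair {a} {b} ne with T ne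
        ... | inj₁ (_ , jn) = jn
        ... | inj₂ (_ , jn) = ⊥-elim (apart-joined jn (trans (sym (all a)) (all b)))
      result (inj₂ (eβ , jα)) = build (α ∘ E) (β (E zero)) (λ a → subst (λ w → Joined P j w (α (E a))) (sym (all a)) (symmetric P (joins (E a)))) pair
        where
        all : ∀ a → β (E zero) ≡ β (E a)
        all zero = refl
        all (suc zero) = eβ
        all (suc (suc a)) with T {zero} {suc (suc a)} (λ ()) | T {suc zero} {suc (suc a)} (λ ())
        ... | inj₂ (e , _) | _ = e
        ... | inj₁ (_ , _) | inj₂ (e , _) = trans eβ e
        ... | inj₁ (e , _) | inj₁ (e′ , _) = ⊥-elim (apart-joined jα (trans e (sym e′)))
        pair : ∀ {a b} → a ≢ b → Joined P j (α (E a)) (α (E b))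
        pair {a} {b} ne with T ne
        ... | inj₂ (_ , jn) = jn
        ... | inj₁ (_ , jn) = ⊥-elim (apart-joined jn (trans (sym (all a)) (all b)))

  no-clique : 3 ≤ t → ∀ j → ¬ Copy (Edge↔ ψ₀ (q₁ ↑ʳ j)) _≈_ (complete t)
  no-clique (s≤s (s≤s (s≤s z≤n))) j K =
    let (κ , h) = clique-positions (vertex K) (λ {a} {b} ne → exch (preserves K a b (complete-adj {u = a} {b} ne))) in
    clique-free P j κ h
    where
    exch : ∀ {x y} → Edge↔ ψ₀ (q₁ ↑ʳ j) x y → Exchange j x y
    exch (inj₁ h) = clique-edge h
    exch (inj₂ h) = exchange-sym (clique-edge h)

-- Explicit vertices and configurations of the odd construction

StrictlyIncreasing : (ℕ → ℕ) → Set
StrictlyIncreasing e = ∀ {i j} → i < j → e i < e j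

pick : ℕ × ℕ → ℕ → ℕ
pick (a , b) zero    = a
pick (a , b) (suc _) = b

triple : (a b c : ℕ) → ℕ → ℕ
triple a b c zero          = a
triple a b c (suc zero)    = b
triple a b c (suc (suc k)) = c + k

triple-increasing : ∀ {a b c} → a < b → b < c → StrictlyIncreasing (triple a b c)
triple-increasing a<b b<c {zero} {suc zero} lt = a<b
triple-increasing {c = c} a<b b<c {zero} {suc (suc k)} lt = ℕ.<-≤-trans (ℕ.<-trans a<b b<c) (ℕ.m≤m+n c k)
triple-increasing {c = c} a<b b<c {suc zero} {suc (suc k)} lt = ℕ.<-≤-trans b<c (ℕ.m≤m+n c k)
triple-increasing {c = c} a<b b<c {suc (suc i)} {suc (suc k)} (s≤s (s≤s lt)) = ℕ.+-monoʳ-< c lt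
triple-increasing a<b b<c {suc zero} {suc zero} (s≤s ())

pick-low : ∀ a b c q → pick (a , b) q ≡ triple a b c (q ⊓ 1)
pick-low a b c zero = refl
pick-low a b c (suc zero) = refl
pick-low a b c (suc (suc q)) = refl

pick-high : ∀ a b c q → pick (b , c) q ≡ triple a b c (suc (q ⊓ 1))
pick-high a b c zero = refl
pick-high a b c (suc zero) = sym (ℕ.+-identityʳ c)
pick-high a b c (suc (suc q)) = sym (ℕ.+-identityʳ c)

module Windows (k : ℕ) where

  r : ℕ
  r = suc k

  -- The sequence behind a window coordinate in which source and target are disjoint: the source
  -- window starts at `a`, the target window at `b`.
  jump : (a b : ℕ) → ℕ → ℕ
  jump a b q with q <? r
  ... | yes _ = a + q
  ... | no _  = b + (q ∸ r)

  jump-low : ∀ a b {q} → q < r → a + q ≡ jump a b q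
  jump-low a b {q} lt with q <? r
  ... | yes _ = refl
  ... | no ¬lt = ⊥-elim (¬lt lt)

  jump-high : ∀ a b q → b + q ≡ jump a b (r + q)
  jump-high a b q with (r + q) <? r
  ... | yes lt = ⊥-elim (ℕ.m+n≮m r q lt)
  ... | no _ = cong (b +_) (sym (ℕ.m+n∸m≡n r q))

  jump-increasing : ∀ {a b} → a + r ≤ b → StrictlyIncreasing (jump a b)
  jump-increasing {a} {b} le {i} {j} i<j with i <? r | j <? r
  ... | yes _ | yes _ = ℕ.+-monoʳ-< a i<j
  ... | yes i<r | no _ = ℕ.<-≤-trans (ℕ.+-monoʳ-< a i<r) (ℕ.≤-trans le (ℕ.m≤m+n b _))
  ... | no ¬i | yes j<r = ⊥-elim (¬i (ℕ.<-trans i<j j<r))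
  ... | no ¬i | no _ = ℕ.+-monoʳ-< b (ℕ.∸-monoˡ-< i<j (ℕ.≮⇒≥ ¬i))

  block : (ℕ → ℕ) → ℕ → ℕ
  block f q = f (q / r) + q % r

  Spread : (ℕ → ℕ) → Set
  Spread f = ∀ b → f b + r ≤ f (suc b)

  spread-< : ∀ {f} → Spread f → ∀ {b b′} → b < b′ → f b + r ≤ f b′
  spread-< {f} sp {b} {suc b′} (s≤s le) with ℕ.m≤n⇒m<n∨m≡n le
  ... | inj₁ lt = ℕ.≤-trans (spread-< {f} sp lt) (ℕ.≤-trans (ℕ.m≤m+n (f b′) r) (sp b′))
  ... | inj₂ refl = sp b

  block-increasing : ∀ {f} → Spread f → StrictlyIncreasing (block f)
  block-increasing {f} sp {i} {j} i<j with ℕ.m≤n⇒m<n∨m≡n (/-monoˡ-≤ r (ℕ.<⇒≤ i<j))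
  ... | inj₁ lt = ℕ.<-≤-trans (ℕ.+-monoʳ-< (f (i / r)) (m%n<n i r)) (ℕ.≤-trans (spread-< {f} sp lt) (ℕ.m≤m+n _ _))
  ... | inj₂ e rewrite e = ℕ.+-monoʳ-< (f (j / r)) (ℕ.+-cancelʳ-< (j / r * r) _ _
          (subst₂ _<_ (trans (m≡m%n+[m/n]*n i r) (cong (λ z → i % r + z * r) e)) (m≡m%n+[m/n]*n j r) i<j))

  block-at : ∀ f b {x} → x < r → block f (b * r + x) ≡ f b + x
  block-at f b {x} lt = cong₂ (λ y z → f y + z)
    (trans (cong (_/ r) (ℕ.+-comm (b * r) x)) (trans (+-distrib-/-∣ʳ x (divides b refl)) (cong₂ _+_ (m<n⇒m/n≡0 lt) (m*n/n≡m b r))))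
    (trans (cong (_% r) (ℕ.+-comm (b * r) x)) (trans ([m+kn]%n≡m%n x b r) (m<n⇒m%n≡m lt)))

module OddEdges {q₁ q₂ t ρ n : ℕ} (P : Pattern q₁ q₂ t ρ n) (j₀ : Fin q₂) (L : ℕ) where
  open OddSystem P j₀ L
  open Windows (suc L) hiding (r)

  -- In the forced copies all windows are intervals, so a vertex is given by its pairs and by the
  -- first numbers of its windows.
  record Data : Set where
    constructor _∣_
    field
      pairs : Fin n → ℕ × ℕ
      base  : Fin q₁ → ℕ
  open Data

  val : Data → Coord → ℕ → ℕ
  val D (inj₁ w) x = pick (pairs D w) x
  val D (inj₂ i) x = base D i + x

  vert : Data → Vertex
  vert D = zero , λ d → val D (coordOf d) (toℕ (placeOf d))

  read-vert : ∀ D c x → read (vert D) c x ≡ val D c (toℕ x)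
  read-vert D c x = trans
    (cong₂ (λ p y → val D (splitAt n p) (toℕ y)) (quotient-slot c x) (cong proj₂ (F.remQuot-combine {n + q₁} (coordinateOf c) x)))
    (cong (λ c′ → val D c′ (toℕ x)) (splitAt-coordinateOf c))

  vert-base : ∀ {D D′} → vert D ≈ vert D′ → ∀ i → base D i ≡ base D′ i
  vert-base {D} {D′} (_ , e) i = ℕ.+-cancelʳ-≡ 0 _ _ (trans (sym (read-vert D (inj₂ i) zero)) (trans (e _) (read-vert D′ (inj₂ i) zero)))

  vert-pair : ∀ {D D′} → vert D ≈ vert D′ → ∀ w → proj₁ (pairs D w) ≡ proj₁ (pairs D′ w)
  vert-pair {D} {D′} (_ , e) w = trans (sym (read-vert D (inj₁ w) zero)) (trans (e _) (read-vert D′ (inj₁ w) zero))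

  vert-cong : ∀ {D D′} → (∀ w → pairs D w ≡ pairs D′ w) → (∀ i → base D i ≡ base D′ i) → vert D ≈ vert D′
  vert-cong {D} {D′} ep eb = refl , λ d → h (coordOf d) _
    where
    h : ∀ c x → val D c x ≡ val D′ c x
    h (inj₁ w) x = cong (λ p → pick p x) (ep w)
    h (inj₂ i) x = cong (_+ x) (eb i)

  Related : EdgeType → Coord → (x y : ℕ → ℕ) → Set
  Related τ c x y = Σ (ℕ → ℕ) λ e → StrictlyIncreasing e ×
    (∀ {q} → q < r → x q ≡ e (srcIx τ c q)) × (∀ {q} → q < r → y q ≡ e (tgtIx τ c q))

  -- A configuration chooses its sequences independently in every coordinate, so an edge can be
  -- certified one coordinate at a time.
  make-edge : ∀ {k} {ψ : EdgeType → Fin k} {c} τ → valid τ ≡ true → ψ τ ≡ c → ∀ {D D′} →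
              (∀ c → Related τ c (val D c) (val D′ c)) → Edge ψ c (vert D) (vert D′)
  make-edge τ ok eq rel = edge τ ok eq
    (config (λ p → proj₁ (rel (splitAt n p))) (λ p lt _ → proj₁ (proj₂ (rel (splitAt n p))) lt))
    (refl , λ d → proj₁ (proj₂ (proj₂ (rel (coordOf d)))) (F.toℕ<n (placeOf d)))
    (refl , λ d → proj₂ (proj₂ (proj₂ (rel (coordOf d)))) (F.toℕ<n (placeOf d)))

  Edge-resp : ∀ {k} {ψ : EdgeType → Fin k} {c x x′ y y′} → x ≈ x′ → y ≈ y′ → Edge ψ c x′ y′ → Edge ψ c x y
  Edge-resp ex ey (edge τ ok eq e hx hy) = edge τ ok eq e (≈-trans ex hx) (≈-trans ey hy)

  valid-joined : ∀ {s s′ j} → s Fin.< s′ → Joined P j s s′ → valid (inj₁ (s , s′)) ≡ true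
  valid-joined {s} {s′} {j} lt jn = cong₂ _∧_ (⌊⌋-complete (s F.<? s′) lt) (⌊⌋-complete (joined? P s s′) (j , jn))

  pair-edge : ∀ {k} {ψ : EdgeType → Fin k} {s s′ j} → s Fin.< s′ → Joined P j s s′ → ∀ {D D′} →
    ∀ {a b c} → a < b → b < c → pairs D s ≡ (b , c) → pairs D′ s ≡ (a , b) →
    ∀ {a′ b′ c′} → a′ < b′ → b′ < c′ → pairs D s′ ≡ (a′ , b′) → pairs D′ s′ ≡ (b′ , c′) →
    (∀ w → w ≢ s → w ≢ s′ → pairs D w ≡ (0 , 1) × pairs D′ w ≡ (0 , 1)) →
    (∀ i → base D i + r ≤ base D′ i) → Edge ψ (ψ (inj₁ (s , s′))) (vert D) (vert D′)
  pair-edge {s = s} {s′} s<s′ jn {D} {D′} {a} {b} {c} ab bc e₁ e₂ {a′} {b′} {c′} ab′ bc′ e₁′ e₂′ rest jumps =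
    make-edge (inj₁ (s , s′)) (valid-joined s<s′ jn) refl {D} {D′} rel
    where
    s≢s′ : s ≢ s′
    s≢s′ e = ℕ.<⇒≢ s<s′ (cong toℕ e)
    rel : ∀ c → Related (inj₁ (s , s′)) c (val D c) (val D′ c)
    rel (inj₂ i) = jump (base D i) (base D′ i) , jump-increasing (jumps i)
                 , (λ lt → jump-low (base D i) (base D′ i) lt) , λ {q} _ → jump-high (base D i) (base D′ i) q
    rel (inj₁ w) with w F.≟ s | w F.≟ s′
    ... | yes refl | yes refl = ⊥-elim (s≢s′ refl)
    ... | yes refl | no _ = triple a b c , triple-increasing ab bc
        , (λ {q} _ → trans (cong (λ p → pick p q) e₁) (pick-high a b c q)) , λ {q} _ → trans (cong (λ p → pick p q) e₂) (pick-low a b c q)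
    ... | no _ | yes refl = triple a′ b′ c′ , triple-increasing ab′ bc′
        , (λ {q} _ → trans (cong (λ p → pick p q) e₁′) (pick-low a′ b′ c′ q)) , λ {q} _ → trans (cong (λ p → pick p q) e₂′) (pick-high a′ b′ c′ q)
    ... | no w≢s | no w≢s′ = triple 0 1 2 , triple-increasing (s≤s z≤n) (s≤s (s≤s z≤n))
        , (λ {q} _ → trans (cong (λ p → pick p q) (proj₁ (rest w w≢s w≢s′))) (pick-low 0 1 2 q))
        , λ {q} _ → trans (cong (λ p → pick p q) (proj₂ (rest w w≢s w≢s′))) (pick-low 0 1 2 q)

  shift-edge : ∀ {k} {ψ : EdgeType → Fin k} i {p b b′} → (∀ w → proj₁ (p w) < proj₂ (p w)) →
    b′ i ≡ suc (b i) → (∀ j → j ≢ i → b j + r ≤ b′ j) → Edge ψ (ψ (inj₂ i)) (vert (p ∣ b)) (vert (p ∣ b′))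
  shift-edge i {p} {b} {b′} pairs-< shifts jumps = make-edge (inj₂ i) refl refl {p ∣ b} {p ∣ b′} rel
    where
    rel : ∀ c → Related (inj₂ i) c (val (p ∣ b) c) (val (p ∣ b′) c)
    rel (inj₁ w) = triple (proj₁ (p w)) (proj₂ (p w)) (suc (proj₂ (p w))) , triple-increasing (pairs-< w) ℕ.≤-refl
                 , (λ {q} _ → pick-low (proj₁ (p w)) (proj₂ (p w)) _ q) , λ {q} _ → pick-low (proj₁ (p w)) (proj₂ (p w)) _ q
    rel (inj₂ j) with i F.≟ j
    ... | yes refl = (b i +_) , ℕ.+-monoʳ-< (b i) , (λ _ → refl) , λ {q} _ → trans (cong (_+ q) shifts) (sym (ℕ.+-suc (b i) q))
    ... | no ne = jump (b j) (b′ j) , jump-increasing (jumps j (ne ∘ sym))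
                , (λ lt → jump-low (b j) (b′ j) lt) , λ {q} _ → jump-high (b j) (b′ j) q

  irreflexive-edges : ∀ {k} (ψ : EdgeType → Fin k) → Irreflexive ψ
  irreflexive-edges ψ {x = x} {y} (edge (inj₁ (s , s′)) ok _ e ex ey) (_ , x≈y) =
    ℕ.<⇒≢ (increasing e (s ↑ˡ q₁) (s≤s z≤n) (small (s≤s z≤n) ℕ.≤-refl))
      (trans (sym (trans (read-at (values e) (tgtIx (inj₁ (s , s′))) ey (inj₁ s) zero) (cong (values e (s ↑ˡ q₁)) (bump-no (s F.≟ s′) s≢s′ 0))))
        (trans (sym (x≈y (slot (inj₁ s) zero)))
          (trans (read-at (values e) (srcIx (inj₁ (s , s′))) ex (inj₁ s) zero) (cong (values e (s ↑ˡ q₁)) (bump-yes (s F.≟ s) refl 0)))))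
    where
    s≢s′ : s ≢ s′
    s≢s′ eq = ℕ.<⇒≢ (⌊⌋-sound (s F.<? s′) (proj₁ (∧-sound ok))) (cong toℕ eq)
  irreflexive-edges ψ {x = x} {y} (edge (inj₂ i) ok _ e ex ey) (_ , x≈y) =
    ℕ.<⇒≢ (increasing e (n ↑ʳ i) (s≤s z≤n) (small (s≤s z≤n) ℕ.≤-refl))
      (trans (sym (read-at (values e) (srcIx (inj₂ i)) ex (inj₂ i) zero))
        (trans (x≈y (slot (inj₂ i) zero))
          (trans (read-at (values e) (tgtIx (inj₂ i)) ey (inj₂ i) zero) (cong (values e (n ↑ʳ i)) same))))
    where
    same : tgtIx (inj₂ i) (inj₂ i) 0 ≡ 1
    same with i F.≟ i
    ... | yes _ = refl
    ... | no ¬p = ⊥-elim (¬p refl)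

  blocks : (f : Fin q₁ → ℕ → ℕ) → (∀ i → Spread (f i)) → Config
  blocks f sp = config (λ p → seq (splitAt n p)) (λ p lt _ → seq-inc (splitAt n p) lt)
    where
    seq : Coord → ℕ → ℕ
    seq (inj₁ w) = id
    seq (inj₂ i) = block (f i)
    seq-inc : ∀ c → StrictlyIncreasing (seq c)
    seq-inc (inj₁ w) = id
    seq-inc (inj₂ i) = block-increasing {f i} (sp i)

  role : Fin n → Fin n → ℕ × ℕ
  role s w with w F.≟ s
  ... | yes _ = 1 , 2
  ... | no _  = 0 , 1

  role-yes : ∀ s → role s s ≡ (1 , 2)
  role-yes s with s F.≟ s
  ... | yes _ = refl
  ... | no ¬p = ⊥-elim (¬p refl)

  role-no : ∀ {s w} → w ≢ s → role s w ≡ (0 , 1)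
  role-no {s} {w} ne with w F.≟ s
  ... | yes p = ⊥-elim (ne p)
  ... | no _ = refl

  role-< : ∀ s w → proj₁ (role s w) < proj₂ (role s w)
  role-< s w with w F.≟ s
  ... | yes _ = s≤s (s≤s z≤n)
  ... | no _ = s≤s z≤n

  pos-blocks : ∀ f sp s → pos s (blocks f sp) ≈ vert (role s ∣ λ i → f i (toℕ s))
  pos-blocks f sp s = refl , λ d → h (quotient r d) (placeOf d)
    where
    h : ∀ p (x : Fin r) → values (blocks f sp) p (posIx s (splitAt n p) (toℕ x)) ≡ val (role s ∣ λ i → f i (toℕ s)) (splitAt n p) (toℕ x)
    h p x with splitAt n p
    ... | inj₂ i = block-at (f i) (toℕ s) (F.toℕ<n x)
    ... | inj₁ w with w F.≟ s
    ...   | yes _ = sym (trans (pick-high 0 1 2 (toℕ x)) (triple-id (suc (toℕ x ⊓ 1))))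
      where
      triple-id : ∀ k → triple 0 1 2 k ≡ k
      triple-id zero = refl
      triple-id (suc zero) = refl
      triple-id (suc (suc k)) = refl
    ...   | no _ = sym (trans (pick-low 0 1 2 (toℕ x)) (triple-id (toℕ x ⊓ 1)))
      where
      triple-id : ∀ k → triple 0 1 2 k ≡ k
      triple-id zero = refl
      triple-id (suc zero) = refl
      triple-id (suc (suc k)) = refl

  pos-edge : ∀ {k} {ψ : EdgeType → Fin k} {s s′ j} → s Fin.< s′ → Joined P j s s′ → ∀ f sp →
             Edge ψ (ψ (inj₁ (s , s′))) (pos s (blocks f sp)) (pos s′ (blocks f sp))
  pos-edge {s = s} {s′} lt jn f sp = Edge-resp (pos-blocks f sp s) (pos-blocks f sp s′)
    (pair-edge lt jn {role s ∣ _} {role s′ ∣ _} {0} {1} {2} (s≤s z≤n) (s≤s (s≤s z≤n)) (role-yes s) (role-no s≢s′)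
       {0} {1} {2} (s≤s z≤n) (s≤s (s≤s z≤n)) (role-no (s≢s′ ∘ sym)) (role-yes s′)
       (λ w a b → role-no a , role-no b) (λ i → spread-< {f i} (sp i) lt))
    where
    s≢s′ : s ≢ s′
    s≢s′ e = ℕ.<⇒≢ lt (cong toℕ e)

  -- The block of a position owns `W` numbers, room enough for a window of length `r` displaced by
  -- up to `L` jumps of length `r`.
  W : ℕ
  W = (2 + L) * r

  -- The k-th of L + 1 configurations that differ only in the block s, in which the i-th window moves by k and all others jump.
  offset : Fin n → Fin q₁ → ℕ → Fin q₁ → ℕ → ℕ
  offset s i k j b with b ℕ.≟ toℕ s
  ... | no _ = 0
  ... | yes _ with i F.≟ j
  ...   | yes _ = k
  ...   | no _  = k * r

  offset-≤ : ∀ s i {k} → k ≤ L → ∀ j b → offset s i k j b + r ≤ W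
  offset-≤ s i {k} le j b = ℕ.≤-trans (ℕ.+-monoˡ-≤ r bound′) (ℕ.≤-trans (ℕ.≤-reflexive (ℕ.+-comm (L * r) r)) (ℕ.m≤n+m (r + L * r) r))
    where
    bound′ : offset s i k j b ≤ L * r
    bound′ with b ℕ.≟ toℕ s
    ... | no _ = z≤n
    ... | yes _ with i F.≟ j
    ...   | yes _ = ℕ.≤-trans le (ℕ.m≤m*n L r)
    ...   | no _ = ℕ.*-monoˡ-≤ r le

  height : Fin n → Fin q₁ → ℕ → Fin q₁ → ℕ → ℕ
  height s i k j b = b * W + offset s i k j b

  height-spread : ∀ s i {k} → k ≤ L → ∀ j → Spread (height s i k j)
  height-spread s i {k} le j b = ℕ.≤-trans (ℕ.≤-reflexive (ℕ.+-assoc (b * W) _ r))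
    (ℕ.≤-trans (ℕ.+-monoʳ-≤ (b * W) (offset-≤ s i le j b)) (ℕ.≤-trans (ℕ.≤-reflexive (ℕ.+-comm (b * W) W)) (ℕ.m≤m+n _ _)))

  arrangement : Fin n → Fin q₁ → ∀ {k} → k ≤ L → Config
  arrangement s i {k} le = blocks (height s i k) (height-spread s i le)

  height-off : ∀ {s s′} → s′ ≢ s → ∀ i k j → height s i k j (toℕ s′) ≡ toℕ s′ * W
  height-off {s} {s′} ne i k j with toℕ s′ ℕ.≟ toℕ s
  ... | yes e = ⊥-elim (ne (F.toℕ-injective e))
  ... | no _ = ℕ.+-identityʳ _

  height-shift : ∀ s i k → height s i k i (toℕ s) ≡ toℕ s * W + k
  height-shift s i k with toℕ s ℕ.≟ toℕ s
  ... | no ¬p = ⊥-elim (¬p refl)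
  ... | yes _ with i F.≟ i
  ...   | yes _ = refl
  ...   | no ¬p = ⊥-elim (¬p refl)

  height-jump : ∀ s {i j} → j ≢ i → ∀ k → height s i k j (toℕ s) ≡ toℕ s * W + k * r
  height-jump s {i} {j} ne k with toℕ s ℕ.≟ toℕ s
  ... | no ¬p = ⊥-elim (¬p refl)
  ... | yes _ with i F.≟ j
  ...   | yes p = ⊥-elim (ne (sym p))
  ...   | no _ = refl

  pos-same : ∀ {s s′} → s′ ≢ s → ∀ i {k k′} (le : k ≤ L) (le′ : k′ ≤ L) → pos s′ (arrangement s i le) ≈ pos s′ (arrangement s i le′)
  pos-same {s} {s′} ne i {k} {k′} le le′ = ≈-trans (pos-blocks _ (height-spread s i le) s′)
    (≈-trans (vert-cong {role s′ ∣ _} {role s′ ∣ _} (λ _ → refl) (λ j → trans (height-off ne i k j) (sym (height-off ne i k′ j))))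
             (≈-sym (pos-blocks _ (height-spread s i le′) s′)))

  pos-shift : ∀ {q} {ψ : EdgeType → Fin q} s i {k} (le : k ≤ L) (le′ : suc k ≤ L) →
              Edge ψ (ψ (inj₂ i)) (pos s (arrangement s i le)) (pos s (arrangement s i le′))
  pos-shift s i {k} le le′ = Edge-resp (pos-blocks _ (height-spread s i le) s) (pos-blocks _ (height-spread s i le′) s)
    (shift-edge i (role-< s)
      (trans (height-shift s i (suc k)) (trans (ℕ.+-suc _ k) (cong suc (sym (height-shift s i k)))))
      (λ j ne → ℕ.≤-reflexive (trans (cong (_+ r) (height-jump s ne k)) (trans (ℕ.+-assoc (toℕ s * W) (k * r) r)
        (trans (cong (toℕ s * W +_) (ℕ.+-comm (k * r) r)) (sym (height-jump s ne (suc k))))))))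

  pos-apart : ∀ s i {k k′} (le : k ≤ L) (le′ : k′ ≤ L) → pos s (arrangement s i le) ≈ pos s (arrangement s i le′) → k ≡ k′
  pos-apart s i {k} {k′} le le′ e = ℕ.+-cancelˡ-≡ (toℕ s * W) _ _
    (trans (sym (height-shift s i k)) (trans (vert-base {role s ∣ _} {role s ∣ _}
       (≈-trans (≈-sym (pos-blocks _ (height-spread s i le) s)) (≈-trans e (pos-blocks _ (height-spread s i le′) s))) i)
       (height-shift s i k′)))

  pos-apart′ : ∀ {s s′} → s ≢ s′ → ∀ f sp f′ sp′ → ¬ pos s (blocks f sp) ≈ pos s′ (blocks f′ sp′)
  pos-apart′ {s} {s′} ne f sp f′ sp′ e = contradiction (trans (sym (cong proj₁ (role-yes s))) (trans
    (vert-pair {role s ∣ _} {role s′ ∣ _} (≈-trans (≈-sym (pos-blocks f sp s)) (≈-trans e (pos-blocks f′ sp′ s′))) s)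
    (cong proj₁ (role-no ne)))) λ ()

-- Odd cycles: copies forced in every colouring

even : ℕ → Bool
even zero    = true
even (suc m) = not (even m)

module _ {A : Set} where

  select : ∀ (m : ℕ) → (∀ {k} → k ≤ m → A) → A → A → ℕ → A
  select m x y z k with k ≤? m | k ℕ.≟ suc m
  ... | yes le | _ = x le
  ... | no _ | yes _ = y
  ... | no _ | no _ = z

  select-low : ∀ {m} (x : ∀ {k} → k ≤ m → A) (y z : A) → ∀ {k} (le : k ≤ m) → select m x y z k ≡ x le
  select-low {m} x y z {k} le with k ≤? m | k ℕ.≟ suc m
  ... | yes le′ | _ = cong x (ℕ.≤-irrelevant le′ le)
  ... | no ¬p | _ = ⊥-elim (¬p le)

  select-middle : ∀ {m} (x : ∀ {k} → k ≤ m → A) (y z : A) → select m x y z (suc m) ≡ y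
  select-middle {m} x y z with suc m ≤? m | suc m ℕ.≟ suc m
  ... | yes le | _ = ⊥-elim (ℕ.1+n≰n le)
  ... | no _ | yes _ = refl
  ... | no _ | no ¬p = ⊥-elim (¬p refl)

  select-high : ∀ {m} (x : ∀ {k} → k ≤ m → A) (y z : A) → select m x y z (2 + m) ≡ z
  select-high {m} x y z with 2 + m ≤? m | 2 + m ℕ.≟ suc m
  ... | yes le | _ = ⊥-elim (ℕ.1+n≰n (ℕ.≤-trans (ℕ.n≤1+n _) le))
  ... | no _ | yes e = ⊥-elim (ℕ.1+n≢n e)
  ... | no _ | no _ = refl

odd-positive : ∀ m → even m ≡ false → 1 ≤ m
odd-positive (suc _) _ = s≤s z≤n

module OddColours {q₁ q₂ t ρ n : ℕ} (P : Pattern q₁ q₂ t (suc ρ) n) (j₀ : Fin q₂) (m₀ : ℕ) (m₀-odd : even m₀ ≡ false)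
                  (K : CliqueRamsey q₂ t (suc (suc ρ))) where

  L : ℕ
  L = 3 + m₀

  open OddSystem P j₀ L
  open OddEdges P j₀ L

  module _ {s s′ : Fin n} {j : Fin q₂} (s<s′ : s Fin.< s′) (jn : Joined P j s s′) where

    private
      s≢s′ : s ≢ s′
      s≢s′ e = ℕ.<⇒≢ s<s′ (cong toℕ e)

      -- From (3, 4) down to (0, 1) there are two chains of abutting pairs: three steps through (2,
      -- 3) and (1, 2), or two steps through (1, 3). Together they form a closed walk of odd length
      -- 5, and a zigzag between (0, 1) and (1, 3) extends it to any larger odd length. `Y` runs
      -- through the mirror image, as one position goes up when the other goes down.
      X Y : ℕ → ℕ × ℕ
      X 0 = 3 , 4
      X 1 = 2 , 3
      X 2 = 1 , 2
      X (suc (suc (suc m))) = if even m then (0 , 1) else (1 , 3)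
      Y 0 = 0 , 1
      Y 1 = 1 , 2
      Y 2 = 2 , 3
      Y (suc (suc (suc m))) = if even m then (3 , 4) else (1 , 3)

      -- Every edge of this cycle makes all windows jump upwards, so their starts must increase
      -- along its orientation. `level` increases along all edges except those from 1 to 2 and from
      -- 0 to `L`, where it is constant and the index decides; the residue of `rank` modulo `suc L`
      -- recovers the index.
      level : ℕ → ℕ
      level 0 = 0
      level 1 = 1
      level 2 = 1
      level (suc (suc (suc m))) = if even m then 2 else 0

      rank : ℕ → ℕ
      rank k = k + level k * suc L

      rank-level : ∀ {k k′} → k ≤ L → level k < level k′ → rank k < rank k′
      rank-level {k} {k′} le lt = ℕ.<-≤-trans (ℕ.+-monoˡ-< (level k * suc L) (s≤s le))
        (ℕ.≤-trans (ℕ.*-monoˡ-≤ (suc L) lt) (ℕ.m≤n+m _ k′))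

      rank-injective : ∀ {k k′} → k ≤ L → k′ ≤ L → rank k ≡ rank k′ → k ≡ k′
      rank-injective {k} {k′} le le′ e = trans (sym (m<n⇒m%n≡m (s≤s le))) (trans (sym ([m+kn]%n≡m%n k (level k) (suc L)))
        (trans (cong (_% suc L) e) (trans ([m+kn]%n≡m%n k′ (level k′) (suc L)) (m<n⇒m%n≡m (s≤s le′)))))

      pairing : ℕ → Fin n → ℕ × ℕ
      pairing k w with w F.≟ s | w F.≟ s′
      ... | yes _ | _     = X k
      ... | no _  | yes _ = Y k
      ... | no _  | no _  = 0 , 1

      pairing-s : ∀ k → pairing k s ≡ X k
      pairing-s k with s F.≟ s
      ... | yes _ = refl
      ... | no ¬p = ⊥-elim (¬p refl)

      pairing-s′ : ∀ k → pairing k s′ ≡ Y k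
      pairing-s′ k with s′ F.≟ s | s′ F.≟ s′
      ... | yes e | _ = ⊥-elim (s≢s′ (sym e))
      ... | no _ | yes _ = refl
      ... | no _ | no ¬p = ⊥-elim (¬p refl)

      pairing-off : ∀ k w → w ≢ s → w ≢ s′ → pairing k w ≡ (0 , 1)
      pairing-off k w a b with w F.≟ s | w F.≟ s′
      ... | yes e | _ = ⊥-elim (a e)
      ... | no _ | yes e = ⊥-elim (b e)
      ... | no _ | no _ = refl

      point : ℕ → Data
      point k = pairing k ∣ λ _ → rank k * r

      rise : ∀ {q} {ψ : EdgeType → Fin q} k k′ {a b c a′ b′ c′} → a < b → b < c → X k ≡ (b , c) → X k′ ≡ (a , b) →
             a′ < b′ → b′ < c′ → Y k ≡ (a′ , b′) → Y k′ ≡ (b′ , c′) → rank k < rank k′ →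
             Edge ψ (ψ (inj₁ (s , s′))) (vert (point k)) (vert (point k′))
      rise k k′ ab bc e₁ e₂ ab′ bc′ e₁′ e₂′ lt = pair-edge s<s′ jn {point k} {point k′}
        ab bc (trans (pairing-s k) e₁) (trans (pairing-s k′) e₂) ab′ bc′ (trans (pairing-s′ k) e₁′) (trans (pairing-s′ k′) e₂′)
        (λ w a b → pairing-off k w a b , pairing-off k′ w a b)
        (λ _ → ℕ.≤-trans (ℕ.≤-reflexive (ℕ.+-comm (rank k * r) r)) (ℕ.*-monoˡ-≤ r lt))

      1≤L : 1 ≤ L
      1≤L = s≤s z≤n

      2≤L : 2 ≤ L
      2≤L = s≤s (s≤s z≤n)

      peak : ∀ {q} {ψ : EdgeType → Fin q} k k′ m m′ → k ≡ 3 + m → k′ ≡ 3 + m′ → k ≤ L → even m ≡ false → even m′ ≡ true →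
             Edge ψ (ψ (inj₁ (s , s′))) (vert (point k)) (vert (point k′))
      peak _ _ m m′ refl refl le o e = rise (3 + m) (3 + m′) {0} {1} {3} {1} {3} {4} (s≤s z≤n) (s≤s (s≤s z≤n))
        (cong (if_then (0 , 1) else (1 , 3)) o) (cong (if_then (0 , 1) else (1 , 3)) e)
        (s≤s (s≤s z≤n)) (s≤s (s≤s (s≤s (s≤s z≤n))))
        (cong (if_then (3 , 4) else (1 , 3)) o) (cong (if_then (3 , 4) else (1 , 3)) e)
        (rank-level {3 + m} {3 + m′} le (subst₂ _<_ (sym (cong (if_then 2 else 0) o)) (sym (cong (if_then 2 else 0) e)) (s≤s z≤n)))

      zigzag : ∀ {q} {ψ : EdgeType → Fin q} m → 3 + m < L → ∀ b → even m ≡ b →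
               Edge↔ ψ (ψ (inj₁ (s , s′))) (vert (point (3 + m))) (vert (point (4 + m)))
      zigzag m lt true  eq = inj₂ (peak (4 + m) (3 + m) (suc m) m refl refl lt (cong not eq) eq)
      zigzag m lt false eq = inj₁ (peak (3 + m) (4 + m) m (suc m) refl refl (ℕ.<⇒≤ lt) eq (cong not eq))

      step : ∀ {q} {ψ : EdgeType → Fin q} k → k < L → Edge↔ ψ (ψ (inj₁ (s , s′))) (vert (point k)) (vert (point (suc k)))
      step 0 _ = inj₁ (rise 0 1 (s≤s (s≤s (s≤s z≤n))) (s≤s (s≤s (s≤s (s≤s z≤n)))) refl refl (s≤s z≤n) (s≤s (s≤s z≤n)) refl refl (s≤s z≤n))
      step 1 _ = inj₁ (rise 1 2 (s≤s (s≤s z≤n)) (s≤s (s≤s (s≤s z≤n))) refl refl (s≤s (s≤s z≤n)) (s≤s (s≤s (s≤s z≤n))) refl refl ℕ.≤-refl)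
      step 2 _ = inj₁ (rise 2 3 (s≤s z≤n) (s≤s (s≤s z≤n)) refl refl (s≤s (s≤s (s≤s z≤n))) (s≤s (s≤s (s≤s (s≤s z≤n)))) refl refl
                   (rank-level {2} {3} 2≤L ℕ.≤-refl))
      step (suc (suc (suc m))) lt = zigzag m lt (even m) refl

      close : ∀ {q} {ψ : EdgeType → Fin q} → Edge ψ (ψ (inj₁ (s , s′))) (vert (point 0)) (vert (point L))
      close = rise 0 L {1} {3} {4} {0} {1} {3} (s≤s (s≤s z≤n)) (s≤s (s≤s (s≤s (s≤s z≤n)))) refl (cong (if_then (0 , 1) else (1 , 3)) m₀-odd)
        (s≤s z≤n) (s≤s (s≤s z≤n)) refl (cong (if_then (3 , 4) else (1 , 3)) m₀-odd) (s≤s z≤n)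

    pair-cycle : ∀ {ψ φ} (c : Fin q₁) → ψ (inj₁ (s , s′)) ≡ c ↑ˡ q₂ → Copy (Edge⁺ ψ φ (c ↑ˡ q₂)) _≈⁺_ (cycle (suc L))
    pair-cycle {ψ} {φ} c eq = cycle-copy (λ {x} {y} → Edge⁺-sym x y) C
      where
      C : Cycle {R = Edge⁺ ψ φ (c ↑ˡ q₂)} {_≈⁺_} L
      C = record
        { point = inj₁ ∘ vert ∘ point
        ; step = λ {k} lt → subst (λ i → Edge↔ ψ i (vert (point k)) (vert (point (suc k)))) eq (step k lt)
        ; close = inj₂ (subst (λ i → Edge ψ i (vert (point 0)) (vert (point L))) eq close)
        ; apart = λ {k} {k′} le le′ e → rank-injective le le′ (ℕ.*-cancelʳ-≡ (rank k) (rank k′) r (vert-base {point k} {point k′} e c)) }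

  -- The cycle takes an i-shift from start, then m₀ + 1 j-shifts, one j-shift back to last, and an i-shift back to start.
  shift-cycle : ∀ {ψ φ} {i j : Fin q₁} {c : Fin q₁} → i ≢ j → ψ (inj₂ i) ≡ c ↑ˡ q₂ → ψ (inj₂ j) ≡ c ↑ˡ q₂ →
                Copy (Edge⁺ ψ φ (c ↑ˡ q₂)) _≈⁺_ (cycle (suc L))
  shift-cycle {ψ} {φ} {i} {j} {c} i≢j eᵢ eⱼ = cycle-copy (λ {x} {y} → Edge⁺-sym x y) C
    where
    M : ℕ
    M = suc m₀

    1≤m₀ : 1 ≤ m₀
    1≤m₀ = odd-positive m₀ m₀-odd

    flat : (Fin q₁ → ℕ) → Data
    flat = (λ _ → 0 , 1) ∣_

    onto : (Fin q₁ → ℕ) → ℕ → ℕ → Fin q₁ → ℕ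
    onto rest a b k with k F.≟ i | k F.≟ j
    ... | yes _ | _     = a
    ... | no _  | yes _ = b
    ... | no _  | no _  = rest k

    onto-i : ∀ rest a b → onto rest a b i ≡ a
    onto-i rest a b with i F.≟ i
    ... | yes _ = refl
    ... | no ¬p = ⊥-elim (¬p refl)

    onto-j : ∀ rest a b → onto rest a b j ≡ b
    onto-j rest a b with j F.≟ i | j F.≟ j
    ... | yes e | _ = ⊥-elim (i≢j (sym e))
    ... | no _ | yes _ = refl
    ... | no _ | no ¬p = ⊥-elim (¬p refl)

    -- Both neighbours of `start` arise by an `i`-shift, with jumps of different lengths in the
    -- `j`-window: `r` for `forward 0`, and `m₀ + r` for `last`, which is one `j`-shift short of
    -- `forward M`.
    start last : Fin q₁ → ℕ
    start = onto (λ _ → 0) 0 0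
    last  = onto (λ _ → r) 1 (m₀ + r)

    forward : ℕ → Fin q₁ → ℕ
    forward zero    = onto (λ _ → r) 1 r
    forward (suc k) = onto (λ _ → (2 + k) * r) ((2 + k) * r) (suc k + r)

    path : ℕ → Fin q₁ → ℕ
    path zero = start
    path (suc k) with k ≤? M
    ... | yes _ = forward k
    ... | no _  = last

    r≤ : ∀ k {a} → a ≤ r → a + r ≤ (2 + k) * r
    r≤ k {a} le = ℕ.≤-trans (ℕ.+-monoˡ-≤ r le) (ℕ.+-monoʳ-≤ r (ℕ.m≤m+n r (k * r)))

    edgeᵢ : ∀ {b b′} → b′ i ≡ suc (b i) → (∀ k → k ≢ i → b k + r ≤ b′ k) → Edge ψ (c ↑ˡ q₂) (vert (flat b)) (vert (flat b′))
    edgeᵢ {b} {b′} e h = subst (λ z → Edge ψ z (vert (flat b)) (vert (flat b′))) eᵢ (shift-edge i (λ _ → s≤s z≤n) e h)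

    edgeⱼ : ∀ {b b′} → b′ j ≡ suc (b j) → (∀ k → k ≢ j → b k + r ≤ b′ k) → Edge ψ (c ↑ˡ q₂) (vert (flat b)) (vert (flat b′))
    edgeⱼ {b} {b′} e h = subst (λ z → Edge ψ z (vert (flat b)) (vert (flat b′))) eⱼ (shift-edge j (λ _ → s≤s z≤n) e h)

    first-edge : Edge ψ (c ↑ˡ q₂) (vert (flat start)) (vert (flat (forward 0)))
    first-edge = edgeᵢ (trans (onto-i (λ _ → r) 1 r) (cong suc (sym (onto-i (λ _ → 0) 0 0)))) h
      where
      h : ∀ k → k ≢ i → start k + r ≤ forward 0 k
      h k ne with k F.≟ i | k F.≟ j
      ... | yes e | _ = ⊥-elim (ne e)
      ... | no _ | yes _ = ℕ.≤-refl
      ... | no _ | no _ = ℕ.≤-refl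

    last-edge : Edge ψ (c ↑ˡ q₂) (vert (flat start)) (vert (flat last))
    last-edge = edgeᵢ (trans (onto-i (λ _ → r) 1 (m₀ + r)) (cong suc (sym (onto-i (λ _ → 0) 0 0)))) h
      where
      h : ∀ k → k ≢ i → start k + r ≤ last k
      h k ne with k F.≟ i | k F.≟ j
      ... | yes e | _ = ⊥-elim (ne e)
      ... | no _ | yes _ = ℕ.m≤n+m r m₀
      ... | no _ | no _ = ℕ.≤-refl

    forward-edge : ∀ k → Edge ψ (c ↑ˡ q₂) (vert (flat (forward k))) (vert (flat (forward (suc k))))
    forward-edge k = edgeⱼ (e k) (h k)
      where
      e : ∀ k → forward (suc k) j ≡ suc (forward k j)
      e zero = trans (onto-j (λ _ → 2 * r) (2 * r) (1 + r)) (cong suc (sym (onto-j (λ _ → r) 1 r)))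
      e (suc k) = trans (onto-j (λ _ → (3 + k) * r) ((3 + k) * r) (2 + k + r)) (cong suc (sym (onto-j (λ _ → (2 + k) * r) ((2 + k) * r) (suc k + r))))
      h : ∀ k l → l ≢ j → forward k l + r ≤ forward (suc k) l
      h zero l ne with l F.≟ i | l F.≟ j
      ... | yes _ | _ = r≤ 0 (s≤s z≤n)
      ... | no _ | yes e = ⊥-elim (ne e)
      ... | no _ | no _ = r≤ 0 ℕ.≤-refl
      h (suc k) l ne with l F.≟ i | l F.≟ j
      ... | yes _ | _ = ℕ.≤-reflexive (ℕ.+-comm ((2 + k) * r) r)
      ... | no _ | yes e = ⊥-elim (ne e)
      ... | no _ | no _ = ℕ.≤-reflexive (ℕ.+-comm ((2 + k) * r) r)

    back-edge : Edge ψ (c ↑ˡ q₂) (vert (flat last)) (vert (flat (forward M)))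
    back-edge = edgeⱼ (trans (onto-j (λ _ → (2 + m₀) * r) ((2 + m₀) * r) (suc m₀ + r)) (cong suc (sym (onto-j (λ _ → r) 1 (m₀ + r))))) h
      where
      h : ∀ l → l ≢ j → last l + r ≤ forward M l
      h l ne with l F.≟ i | l F.≟ j
      ... | yes _ | _ = r≤ m₀ (s≤s z≤n)
      ... | no _ | yes e = ⊥-elim (ne e)
      ... | no _ | no _ = r≤ m₀ ℕ.≤-refl

    path-forward : ∀ {k} → k ≤ M → path (suc k) ≡ forward k
    path-forward {k} le with k ≤? M
    ... | yes _ = refl
    ... | no ¬p = ⊥-elim (¬p le)

    path-last : ∀ {k} → M < k → path (suc k) ≡ last
    path-last {k} lt with k ≤? M
    ... | yes p = ⊥-elim (ℕ.<⇒≱ lt p)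
    ... | no _ = refl

    E : (Fin q₁ → ℕ) → (Fin q₁ → ℕ) → Set
    E b b′ = Edge↔ ψ (c ↑ˡ q₂) (vert (flat b)) (vert (flat b′))

    step : ∀ k → k < L → E (path k) (path (suc k))
    step zero lt = inj₁ first-edge
    step (suc k) lt with ℕ.m≤n⇒m<n∨m≡n (ℕ.≤-pred (ℕ.≤-pred lt))
    ... | inj₁ k<M = subst₂ E (sym (path-forward (ℕ.<⇒≤ k<M))) (sym (path-forward k<M)) (inj₁ (forward-edge k))
    ... | inj₂ refl = subst₂ E (sym (path-forward ℕ.≤-refl)) (sym (path-last ℕ.≤-refl)) (inj₂ back-edge)

    forward-j : ∀ k → forward k j ≡ k + r
    forward-j zero = onto-j (λ _ → r) 1 r
    forward-j (suc k) = onto-j (λ _ → (2 + k) * r) ((2 + k) * r) (suc k + r)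

    Same : (Fin q₁ → ℕ) → (Fin q₁ → ℕ) → Set
    Same b b′ = b i ≡ b′ i × b j ≡ b′ j

    start≢forward : ∀ k → ¬ Same start (forward k)
    start≢forward k (_ , e) = ℕ.<⇒≢ (ℕ.≤-trans (s≤s z≤n) (ℕ.m≤n+m r k)) (trans (sym (onto-j (λ _ → 0) 0 0)) (trans e (forward-j k)))

    start≢last : ¬ Same start last
    start≢last (e , _) = contradiction (trans (sym (onto-i (λ _ → 0) 0 0)) (trans e (onto-i (λ _ → r) 1 (m₀ + r)))) λ ()

    forward≢last : ∀ k → ¬ Same (forward k) last
    forward≢last k (e , f) with ℕ.+-cancelʳ-≡ r k m₀ (trans (sym (forward-j k)) (trans f (onto-j (λ _ → r) 1 (m₀ + r))))
    forward≢last zero (e , f) | refl = contradiction 1≤m₀ λ ()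
    forward≢last (suc k) (e , f) | refl = ℕ.<⇒≢ {1} {(2 + k) * r} (ℕ.≤-trans (s≤s (s≤s z≤n)) (ℕ.m≤m+n r (suc k * r)))
      (trans (sym (onto-i (λ _ → r) 1 (m₀ + r))) (trans (sym e) (onto-i (λ _ → (2 + k) * r) ((2 + k) * r) (suc k + r))))

    same-path : ∀ k k′ → k ≤ L → k′ ≤ L → Same (path k) (path k′) → k ≡ k′
    same-path zero zero le le′ e = refl
    same-path zero (suc k) le le′ e with k ≤? M
    ... | yes _ = ⊥-elim (start≢forward k e)
    ... | no _ = ⊥-elim (start≢last e)
    same-path (suc k) zero le le′ (e , f) with k ≤? M
    ... | yes _ = ⊥-elim (start≢forward k (sym e , sym f))
    ... | no _ = ⊥-elim (start≢last (sym e , sym f))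
    same-path (suc k) (suc k′) le le′ (e , f) with k ≤? M | k′ ≤? M
    ... | yes _ | yes _ = cong suc (ℕ.+-cancelʳ-≡ r k k′ (trans (sym (forward-j k)) (trans f (forward-j k′))))
    ... | yes _ | no _ = ⊥-elim (forward≢last k (e , f))
    ... | no _ | yes _ = ⊥-elim (forward≢last k′ (sym e , sym f))
    ... | no p | no p′ = cong suc (trans (ℕ.≤-antisym (ℕ.≤-pred le) (ℕ.≰⇒> p)) (ℕ.≤-antisym (ℕ.≰⇒> p′) (ℕ.≤-pred le′)))

    C : Cycle {R = Edge⁺ ψ φ (c ↑ˡ q₂)} {_≈⁺_} L
    C = record
      { point = inj₁ ∘ vert ∘ flat ∘ path
      ; step = λ {k} → step k
      ; close = inj₂ (subst (λ b → Edge ψ (c ↑ˡ q₂) (vert (flat start)) (vert (flat b))) (sym (path-last ℕ.≤-refl)) last-edge)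
      ; apart = λ {k} {k′} le le′ e → same-path k k′ le le′ (vert-base {flat (path k)} {flat (path k′)} e i , vert-base {flat (path k)} {flat (path k′)} e j) }

  -- Two positions in the same cycle colour: two new vertices v, v′ share one neighbour, and their other neighbours
  -- are the ends of a path of L ∸ 3 shifts.
  position-cycle : ∀ {ψ φ} {s s′ : Fin n} {i c : Fin q₁} → s Fin.< s′ → ψ (inj₂ i) ≡ c ↑ˡ q₂ → φ s ≡ c ↑ˡ q₂ → φ s′ ≡ c ↑ˡ q₂ →
                   Copy (Edge⁺ ψ φ (c ↑ˡ q₂)) _≈⁺_ (cycle (suc L))
  position-cycle {ψ} {φ} {s} {s′} {i} {c} s<s′ eᵢ es es′ = cycle-copy (λ {x} {y} → Edge⁺-sym x y) C
    where
    s≢s′ : s ≢ s′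
    s≢s′ e = ℕ.<⇒≢ s<s′ (cong toℕ e)

    m₀≤L : m₀ ≤ L
    m₀≤L = ℕ.m≤n+m m₀ 3

    1≤m₀ : 1 ≤ m₀
    1≤m₀ = odd-positive m₀ m₀-odd

    arr : ∀ {k} → k ≤ L → Config
    arr = arrangement s i

    p : ∀ {k} → k ≤ m₀ → Vertex⁺
    p le = inj₁ (pos s (arr (ℕ.≤-trans le m₀≤L)))

    v w : Vertex⁺
    v = inj₂ (arr m₀≤L)
    w = inj₁ (pos s′ (arr {0} z≤n))

    inner : ℕ → Vertex⁺
    inner = select m₀ p v w

    point : ℕ → Vertex⁺
    point zero = inj₂ (arr {0} z≤n)
    point (suc k) = inner k

    E : Vertex⁺ → Vertex⁺ → Set
    E = Edge⁺ ψ φ (c ↑ˡ q₂)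

    arr-irr : ∀ {k} (le le′ : k ≤ L) → arr le ≡ arr le′
    arr-irr le le′ = cong arr (ℕ.≤-irrelevant le le′)

    inner-low : ∀ {k} (le : k ≤ L) → k ≤ m₀ → inner k ≡ inj₁ (pos s (arr le))
    inner-low {k} le le₀ = trans (select-low {m = m₀} p v w le₀) (cong (λ e → inj₁ (pos s e)) (arr-irr (ℕ.≤-trans le₀ m₀≤L) le))

    inner-v : inner (suc m₀) ≡ inj₂ (arr m₀≤L)
    inner-v = select-middle {m = m₀} p v w

    inner-w : inner (2 + m₀) ≡ inj₁ (pos s′ (arr {0} z≤n))
    inner-w = select-high {m = m₀} p v w

    shifted : ∀ {k} (le : k ≤ L) (le′ : suc k ≤ L) → E (inj₁ (pos s (arr le))) (inj₁ (pos s (arr le′)))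
    shifted le le′ = inj₁ (subst (λ z → Edge ψ z (pos s (arr le)) (pos s (arr le′))) eᵢ (pos-shift s i le le′))

    step : ∀ k → k < L → E (point k) (point (suc k))
    step zero lt = subst (E (inj₂ (arr {0} z≤n))) (sym (inner-low {0} z≤n z≤n)) (attached s es ≈-refl)
    step (suc k) lt = go k (ℕ.≤-pred (ℕ.≤-pred lt)) (ℕ.<-cmp k m₀)
      where
      go : ∀ k → k ≤ suc m₀ → Tri (k < m₀) (k ≡ m₀) (m₀ < k) → E (inner k) (inner (suc k))
      go k le (tri< k<m _ _) = subst₂ E (sym (inner-low (ℕ.≤-trans (ℕ.<⇒≤ k<m) m₀≤L) (ℕ.<⇒≤ k<m))) (sym (inner-low (ℕ.≤-trans k<m m₀≤L) k<m))
        (shifted (ℕ.≤-trans (ℕ.<⇒≤ k<m) m₀≤L) (ℕ.≤-trans k<m m₀≤L))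
      go k le (tri≈ _ e _) = subst (λ k → E (inner k) (inner (suc k))) (sym e)
        (subst₂ E (sym (inner-low m₀≤L ℕ.≤-refl)) (sym inner-v) (attached s es ≈-refl))
      go k le (tri> _ _ gt) = subst (λ k → E (inner k) (inner (suc k))) (ℕ.≤-antisym gt le)
        (subst₂ E (sym inner-v) (sym inner-w) (attached s′ es′ (pos-same (s≢s′ ∘ sym) i {0} {m₀} z≤n m₀≤L)))

    data View (k : ℕ) : Set where
      low : (le : k ≤ L) → k ≤ m₀ → inner k ≡ inj₁ (pos s (arr le)) → View k
      isv : k ≡ suc m₀ → inner k ≡ inj₂ (arr m₀≤L) → View k
      isw : k ≡ 2 + m₀ → inner k ≡ inj₁ (pos s′ (arr {0} z≤n)) → View k

    view : ∀ k → suc k ≤ L → View k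
    view k le with ℕ.<-cmp k (suc m₀)
    ... | tri< lt _ _ = low (ℕ.≤-trans (ℕ.≤-pred lt) m₀≤L) (ℕ.≤-pred lt) (inner-low (ℕ.≤-trans (ℕ.≤-pred lt) m₀≤L) (ℕ.≤-pred lt))
    ... | tri≈ _ refl _ = isv refl inner-v
    ... | tri> _ _ gt with ℕ.≤-antisym (ℕ.≤-pred le) gt
    ...   | refl = isw refl inner-w

    spread : ∀ {k} → k ≤ L → ∀ j → Windows.Spread (suc L) (height s i k j)
    spread = height-spread s i

    view-apart : ∀ {k k′} → View k → View k′ → inner k ≈⁺ inner k′ → k ≡ k′
    view-apart (low le _ e) (low le′ _ e′) h = pos-apart s i le le′ (subst₂ _≈⁺_ e e′ h)
    view-apart (low le _ e) (isv _ e′) h = ⊥-elim (subst₂ _≈⁺_ e e′ h)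
    view-apart {k} (low le _ e) (isw _ e′) h = ⊥-elim (pos-apart′ s≢s′ (height s i k) (spread {k} le) (height s i 0) (spread {0} z≤n) (subst₂ _≈⁺_ e e′ h))
    view-apart (isv _ e) (low le _ e′) h = ⊥-elim (subst₂ _≈⁺_ e e′ h)
    view-apart (isv k≡ _) (isv k≡′ _) h = trans k≡ (sym k≡′)
    view-apart (isv _ e) (isw _ e′) h = ⊥-elim (subst₂ _≈⁺_ e e′ h)
    view-apart {_} {k} (isw _ e) (low le _ e′) h = ⊥-elim (pos-apart′ (s≢s′ ∘ sym) (height s i 0) (spread {0} z≤n) (height s i k) (spread {k} le) (subst₂ _≈⁺_ e e′ h))
    view-apart (isw _ e) (isv _ e′) h = ⊥-elim (subst₂ _≈⁺_ e e′ h)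
    view-apart (isw k≡ _) (isw k≡′ _) h = trans k≡ (sym k≡′)

    zero-apart : ∀ {k} → View k → ¬ inj₂ (arr {0} z≤n) ≈⁺ inner k
    zero-apart (low _ _ e) h = subst (inj₂ (arr {0} z≤n) ≈⁺_) e h
    zero-apart (isw _ e) h = subst (inj₂ (arr {0} z≤n) ≈⁺_) e h
    zero-apart (isv _ e) h = ℕ.<⇒≢ 1≤m₀ (pos-apart s i z≤n m₀≤L (subst (inj₂ (arr {0} z≤n) ≈⁺_) e h s))

    zero-apart′ : ∀ {k} → View k → ¬ inner k ≈⁺ inj₂ (arr {0} z≤n)
    zero-apart′ (low _ _ e) h = subst (_≈⁺ inj₂ (arr {0} z≤n)) e h
    zero-apart′ (isw _ e) h = subst (_≈⁺ inj₂ (arr {0} z≤n)) e h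
    zero-apart′ (isv _ e) h = ℕ.<⇒≢ 1≤m₀ (sym (pos-apart s i m₀≤L z≤n (subst (_≈⁺ inj₂ (arr {0} z≤n)) e h s)))

    point-apart : ∀ {k k′} → k ≤ L → k′ ≤ L → point k ≈⁺ point k′ → k ≡ k′
    point-apart {zero} {zero} le le′ h = refl
    point-apart {zero} {suc k′} le le′ h = ⊥-elim (zero-apart (view k′ le′) h)
    point-apart {suc k} {zero} le le′ h = ⊥-elim (zero-apart′ (view k le) h)
    point-apart {suc k} {suc k′} le le′ h = cong suc (view-apart (view k le) (view k′ le′) h)

    C : Cycle {R = E} {_≈⁺_} L
    C = record { point = point ; step = λ {k} → step k
               ; close = subst (λ z → E z (point 0)) (sym inner-w) (attached s′ es′ ≈-refl)
               ; apart = λ {k} {k′} → point-apart {k} {k′} }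

  CliqueColoured : (EdgeType → Fin (q₁ + q₂)) → Set
  CliqueColoured ψ = ∀ {s s′ j} → s Fin.< s′ → Joined P j s s′ → ∃ λ j′ → ψ (inj₁ (s , s′)) ≡ q₁ ↑ʳ j′

  clique-edges : ∀ {ψ} → CliqueColoured ψ → ∀ f sp {j s s′} → Joined P j s s′ →
                 ∃ λ j′ → Edge↔ ψ (q₁ ↑ʳ j′) (pos s (blocks f sp)) (pos s′ (blocks f sp))
  clique-edges {ψ} cl f sp {j} {s} {s′} jn with F.<-cmp s s′
  ... | tri< lt _ _ = let (j′ , e) = cl lt jn in j′ , inj₁ (subst (λ z → Edge ψ z _ _) e (pos-edge lt jn f sp))
  ... | tri≈ _ refl _ = ⊥-elim (irreflexive P jn)
  ... | tri> _ _ gt = let (j′ , e) = cl gt (symmetric P jn) in j′ , inj₂ (subst (λ z → Edge ψ z _ _) e (pos-edge gt (symmetric P jn) f sp))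

  -- A shift in a clique colour joins two copies of one vertex of a clique-coloured K_{ρ+1}.
  shift-clique : ∀ {ψ φ} i j → CliqueColoured ψ → ψ (inj₂ i) ≡ q₁ ↑ʳ j → ∃ λ j → Copy (Edge⁺ ψ φ (q₁ ↑ʳ j)) _≈⁺_ (complete t)
  shift-clique {ψ} {φ} i j cl eᵢ with hits P (λ _ → true) (ℕ.≤-trans (ℕ.≤-reflexive (sym (Σ-one n))) (ℕ.m≤n+m _ q₁))
  ... | κ , _ , jn = cliques {q₁} {ψ = ψ} {φ} K j₀ (irreflexive-edges ψ) g (λ {a} {b} → h {a} {b})
    where
    e₀ e₁ : Config
    e₀ = arrangement (κ zero) i {0} z≤n
    e₁ = arrangement (κ zero) i {1} (s≤s z≤n)
    g : Fin (suc (suc ρ)) → Vertex⁺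
    g zero    = inj₁ (pos (κ zero) e₁)
    g (suc a) = inj₁ (pos (κ a) e₀)
    resp : ∀ {c x y y′} → y ≈ y′ → Edge↔ ψ c x y′ → Edge↔ ψ c x y
    resp e (inj₁ h) = inj₁ (Edge-resp ≈-refl e h)
    resp e (inj₂ h) = inj₂ (Edge-resp e ≈-refl h)
    first : ∀ a → ∃ λ j → Edge↔ ψ (q₁ ↑ʳ j) (pos (κ zero) e₁) (pos (κ a) e₀)
    first zero = j , inj₂ (subst (λ z → Edge ψ z (pos (κ zero) e₀) (pos (κ zero) e₁)) eᵢ (pos-shift (κ zero) i z≤n (s≤s z≤n)))
    first (suc a) = let (_ , jn₀) = jn {zero} {suc a} (λ ())
                        (j′ , h) = clique-edges {ψ} cl (height (κ zero) i 1) (height-spread (κ zero) i (s≤s z≤n)) jn₀ in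
                    j′ , resp (pos-same (λ e → irreflexive P (subst (Joined P _ (κ zero)) e jn₀)) i {0} {1} z≤n (s≤s z≤n)) h
    h : ∀ {a b} → a ≢ b → ∃ λ j → Edge⁺ ψ φ (q₁ ↑ʳ j) (g a) (g b)
    h {zero} {zero} ne = ⊥-elim (ne refl)
    h {zero} {suc b} ne = first b
    h {suc a} {zero} ne = let (j′ , e) = first a in j′ , Edge↔-sym e
    h {suc a} {suc b} ne = clique-edges {ψ} cl (height (κ zero) i 0) (height-spread (κ zero) i z≤n) (proj₂ (jn (ne ∘ cong suc)))

  -- Each case relies on the failure of those before it. Clique-coloured pair types make the cliques
  -- of positions available; then the shift types must be cycle-coloured, injectively and hence
  -- bijectively, so that the colour repeated at two positions is also the colour of some shift.
  forced : ∀ ψ φ → (∃ λ c → Copy (Edge⁺ ψ φ (c ↑ˡ q₂)) _≈⁺_ (cycle (suc L))) ⊎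
                   (∃ λ j → Copy (Edge⁺ ψ φ (q₁ ↑ʳ j)) _≈⁺_ (complete t))
  forced ψ φ with F.any? (λ s → F.any? λ s′ → (s F.<? s′) ×-dec joined? P s s′ ×-dec F.any? λ c → ψ (inj₁ (s , s′)) F.≟ c ↑ˡ q₂)
  ... | yes (s , s′ , lt , (j , jn) , c , e) = inj₁ (c , pair-cycle lt jn {ψ} {φ} c e)
  ... | no ¬pair = main
    where
    cl : CliqueColoured ψ
    cl {s} {s′} {j} lt jn with classify q₁ (ψ (inj₁ (s , s′)))
    ... | inj₁ (c , e) = ⊥-elim (¬pair (s , s′ , lt , (j , jn) , c , e))
    ... | inj₂ p = p
    main : (∃ λ c → Copy (Edge⁺ ψ φ (c ↑ˡ q₂)) _≈⁺_ (cycle (suc L))) ⊎ (∃ λ j → Copy (Edge⁺ ψ φ (q₁ ↑ʳ j)) _≈⁺_ (complete t))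
    main with F.any? (λ i → F.any? λ j → ψ (inj₂ i) F.≟ q₁ ↑ʳ j)
    ... | yes (i , j , e) = inj₂ (shift-clique i j (λ {s} {s′} {j} → cl {s} {s′} {j}) e)
    ... | no ¬shift = main₁
      where
      colour-of : ∀ i → ∃ λ c → ψ (inj₂ i) ≡ c ↑ˡ q₂
      colour-of i with classify q₁ (ψ (inj₂ i))
      ... | inj₁ p = p
      ... | inj₂ (j , e) = ⊥-elim (¬shift (i , j , e))
      f : Fin q₁ → Fin q₁
      f = proj₁ ∘ colour-of
      main₁ : (∃ λ c → Copy (Edge⁺ ψ φ (c ↑ˡ q₂)) _≈⁺_ (cycle (suc L))) ⊎ (∃ λ j → Copy (Edge⁺ ψ φ (q₁ ↑ʳ j)) _≈⁺_ (complete t))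
      main₁ with F.any? (λ i → F.any? λ j → (i F.<? j) ×-dec (f i F.≟ f j))
      ... | yes (i , j , lt , e) = inj₁ (f i , shift-cycle (λ e → ℕ.<⇒≢ lt (cong toℕ e)) (proj₂ (colour-of i))
                                     (trans (proj₂ (colour-of j)) (cong (_↑ˡ q₂) (sym e))))
      ... | no ¬eq with repeated-or-clique P φ
      ...   | inj₂ pc = inj₂ (clique-at {q₁} {ψ = ψ} {φ} K j₀ (irreflexive-edges ψ) P pc (blocks (λ _ b → b * r) (λ _ b → ℕ.≤-reflexive (ℕ.+-comm (b * r) r)))
                          (clique-edges {ψ} (λ {s} {s′} {j} → cl {s} {s′} {j}) (λ _ b → b * r) (λ _ b → ℕ.≤-reflexive (ℕ.+-comm (b * r) r))))
      ...   | inj₁ (s , s′ , lt , c , es , es′) with injective-surjective f f-inj c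
        where
        f-inj : ∀ {i j} → f i ≡ f j → i ≡ j
        f-inj {i} {j} e with F.<-cmp i j
        ... | tri< lt _ _ = ⊥-elim (¬eq (i , j , lt , e))
        ... | tri≈ _ p _ = p
        ... | tri> _ _ gt = ⊥-elim (¬eq (j , i , gt , sym e))
      ...     | i , fi≡c = inj₁ (c , position-cycle {ψ} {φ} lt (trans (proj₂ (colour-of i)) (cong (_↑ˡ q₂) fi≡c)) es es′)

-- Even cycles

double : ℕ → ℕ
double zero    = zero
double (suc h) = suc (suc (double h))

double-≤ : ∀ {i j} → double i ≤ double j → i ≤ j
double-≤ {zero} _ = z≤n
double-≤ {suc i} {suc j} (s≤s (s≤s le)) = s≤s (double-≤ le)

double-< : ∀ i j → suc (double i) ≤ double j → i < j
double-< zero (suc j) _ = s≤s z≤n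
double-< (suc i) (suc j) (s≤s (s≤s le)) = s≤s (double-< i j le)

data Parity : ℕ → Set where
  isDouble     : ∀ i → Parity (double i)
  isSucDouble  : ∀ i → Parity (suc (double i))

parity : ∀ k → Parity k
parity zero = isDouble 0
parity (suc k) with parity k
... | isDouble i = isSucDouble i
... | isSucDouble i = isDouble (suc i)

interleave : {A : Set} → (ℕ → A) → (ℕ → A) → ℕ → A
interleave x y zero          = x 0
interleave x y (suc zero)    = y 0
interleave x y (suc (suc k)) = interleave (x ∘ suc) (y ∘ suc) k

interleave-even : ∀ {A : Set} (x y : ℕ → A) i → interleave x y (double i) ≡ x i
interleave-even x y zero    = refl
interleave-even x y (suc i) = interleave-even (x ∘ suc) (y ∘ suc) i

interleave-odd : ∀ {A : Set} (x y : ℕ → A) i → interleave x y (suc (double i)) ≡ y i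
interleave-odd x y zero    = refl
interleave-odd x y (suc i) = interleave-odd (x ∘ suc) (y ∘ suc) i

module _ {A : Set} {R _≈_ : A → A → Set} where

  -- The even cycle x₀ y₀ x₁ y₁ ... . Separation of the two classes is asked in both directions,
  -- since `≈` is an arbitrary relation here.
  record Alternating (h : ℕ) : Set where
    field
      x y    : ℕ → A
      xy     : ∀ {i} → i ≤ h → R (x i) (y i)
      yx     : ∀ {i} → i < h → R (y i) (x (suc i))
      yx₀    : R (y h) (x 0)
      x-apart : ∀ {i j} → i ≤ h → j ≤ h → x i ≈ x j → i ≡ j
      y-apart : ∀ {i j} → i ≤ h → j ≤ h → y i ≈ y j → i ≡ j
      xy-apart : ∀ {i j} → i ≤ h → j ≤ h → ¬ x i ≈ y j
      yx-apart : ∀ {i j} → i ≤ h → j ≤ h → ¬ y i ≈ x j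

  alternating-cycle : ∀ {h} → Alternating h → Cycle {R = R} {_≈_} (suc (double h))
  alternating-cycle {h} alt = record
    { point = p ; step = λ {k} lt → step k (parity k) lt
    ; close = subst (λ z → R z (x 0)) (sym (odd h)) yx₀
    ; apart = λ {k} {k′} le le′ e → apart (parity k) (parity k′) le le′ e }
    where
    open Alternating alt
    p : ℕ → A
    p = interleave x y
    ev : ∀ i → p (double i) ≡ x i
    ev = interleave-even x y
    odd : ∀ i → p (suc (double i)) ≡ y i
    odd = interleave-odd x y
    halve : ∀ {i} → double i ≤ suc (double h) → i ≤ h
    halve {zero} le = z≤n
    halve {suc i} (s≤s le) = double-< i h le
    step : ∀ k → Parity k → k < suc (double h) → R (p k) (p (suc k))
    step _ (isDouble i) lt = subst₂ R (sym (ev i)) (sym (odd i)) (xy (double-≤ (ℕ.≤-pred lt)))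
    step _ (isSucDouble i) lt = subst₂ R (sym (odd i)) (sym (ev (suc i))) (yx (double-< i h (ℕ.≤-pred lt)))
    apart : ∀ {k k′} → Parity k → Parity k′ → k ≤ suc (double h) → k′ ≤ suc (double h) → p k ≈ p k′ → k ≡ k′
    apart (isDouble i) (isDouble j) le le′ e = cong double (x-apart (halve le) (halve le′) (subst₂ _≈_ (ev i) (ev j) e))
    apart (isDouble i) (isSucDouble j) le le′ e = ⊥-elim (xy-apart (halve le) (double-≤ (ℕ.≤-pred le′)) (subst₂ _≈_ (ev i) (odd j) e))
    apart (isSucDouble i) (isDouble j) le le′ e = ⊥-elim (yx-apart (double-≤ (ℕ.≤-pred le)) (halve le′) (subst₂ _≈_ (odd i) (ev j) e))
    apart (isSucDouble i) (isSucDouble j) le le′ e = cong (suc ∘ double) (y-apart (double-≤ (ℕ.≤-pred le)) (double-≤ (ℕ.≤-pred le′)) (subst₂ _≈_ (odd i) (odd j) e))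

-- A colouring of `K_ρ` without monochromatic `K_t`. The diagonal of `χ` has no meaning, whence the
-- condition that the images be distinct.
record CliqueColouring (q t ρ : ℕ) : Set where
  field
    χ     : Fin ρ → Fin ρ → Fin q
    χ-sym : ∀ a b → χ a b ≡ χ b a
    χ-free : ∀ j (f : Fin t → Fin ρ) → ¬ (∀ {u v} → u ≢ v → f u ≢ f v × χ (f u) (f v) ≡ j)
open CliqueColouring public

-- The sorts of the even construction: a hub vertex of role a carries one number in the coordinate a, and a
-- vertex of position s carries Q + 1 numbers in every coordinate, each of which names a hub neighbour.
module EvenSystem {q₂ t ρ n : ℕ} (Q : ℕ) (P : Pattern (suc Q) q₂ t (suc ρ) n) (X : CliqueColouring q₂ t (suc ρ)) (j₀ : Fin q₂) where

  q₁ : ℕ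
  q₁ = suc Q

  hubs : ℕ
  hubs = suc ρ

  EdgeType : Set
  EdgeType = (Fin hubs × Fin hubs) ⊎ ((Fin n × (Fin hubs × Fin q₁)) ⊎ (Fin n × Fin n))

  pattern hh a a′ = inj₁ (a , a′)
  pattern zh s a g = inj₂ (inj₁ (s , (a , g)))
  pattern zz s s′ = inj₂ (inj₂ (s , s′))

  VertexSort : Set
  VertexSort = Fin hubs ⊎ Fin n

  slotCount : ℕ
  slotCount = hubs * q₁

  hubOf : Fin slotCount → Fin hubs
  hubOf d = quotient q₁ d

  numberOf : Fin slotCount → Fin q₁
  numberOf d = remainder {hubs} q₁ d

  coord : VertexSort → Fin slotCount → Fin hubs
  coord (inj₁ a) d = a
  coord (inj₂ s) d = hubOf d

  from to : EdgeType → VertexSort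
  from (hh a a′) = inj₁ a
  from (zh s a g) = inj₂ s
  from (zz s s′) = inj₂ s
  to (hh a a′) = inj₁ a′
  to (zh s a g) = inj₁ a
  to (zz s s′) = inj₂ s′

  fromIx toIx : EdgeType → Fin slotCount → ℕ
  fromIx (hh a a′) d = 0
  fromIx (zh s a g) d = toℕ (numberOf d)
  fromIx (zz s s′) d = toℕ (numberOf d)
  toIx (hh a a′) d = 0
  toIx (zh s a g) d = toℕ g
  toIx (zz s s′) d = q₁ + toℕ (numberOf d)

  B : ℕ
  B = (2 + n) * q₁

  q₁≤B : q₁ + q₁ ≤ B
  q₁≤B = ℕ.+-monoʳ-≤ q₁ (ℕ.m≤m+n q₁ (n * q₁))

  small : ∀ (g : Fin q₁) → toℕ g < B
  small g = ℕ.<-≤-trans (F.toℕ<n g) (ℕ.≤-trans (ℕ.m≤m+n q₁ q₁) q₁≤B)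

  fromIx-< : ∀ τ d → fromIx τ d < B
  fromIx-< (hh a a′) d = s≤s z≤n
  fromIx-< (zh s a g) d = small (numberOf d)
  fromIx-< (zz s s′) d = small (numberOf d)

  toIx-< : ∀ τ d → toIx τ d < B
  toIx-< (hh a a′) d = s≤s z≤n
  toIx-< (zh s a g) d = small g
  toIx-< (zz s s′) d = ℕ.<-≤-trans (ℕ.+-monoʳ-< q₁ (F.toℕ<n (numberOf d))) q₁≤B

  posIx : Fin n → Fin slotCount → ℕ
  posIx s d = toℕ s * q₁ + toℕ (numberOf d)

  posIx-< : ∀ s d → posIx s d < B
  posIx-< s d = ℕ.<-≤-trans (ℕ.+-monoʳ-< (toℕ s * q₁) (F.toℕ<n (numberOf d)))
    (ℕ.≤-trans (ℕ.≤-reflexive (ℕ.+-comm (toℕ s * q₁) q₁)) (ℕ.*-monoˡ-≤ q₁ (ℕ.≤-trans (F.toℕ<n s) (ℕ.m≤n+m n 2))))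

  isValid : EdgeType → Bool
  isValid (hh a a′) = ⌊ a F.<? a′ ⌋
  isValid (zh s a g) = true
  isValid (zz s s′) = ⌊ s F.<? s′ ⌋ ∧ ⌊ joined? P s s′ ⌋

  system : System n
  system = record
    { Sort = VertexSort ; Type = EdgeType
    ; sorts = finite-⊎ (finite-Fin hubs) (finite-Fin n)
    ; types = finite-⊎ (finite-× (finite-Fin hubs) (finite-Fin hubs))
                (finite-⊎ (finite-× (finite-Fin n) (finite-× (finite-Fin hubs) (finite-Fin q₁))) (finite-× (finite-Fin n) (finite-Fin n)))
    ; slots = slotCount ; coordinates = hubs ; bound = B ; coordinate = coord
    ; source = from ; target = to ; sourceIx = fromIx ; targetIx = toIx ; sourceIx< = fromIx-< ; targetIx< = toIx-<
    ; valid = isValid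
    ; position = inj₂ ; positionIx = posIx ; positionIx< = posIx-< }

  open Edges system public

  -- In the clique colours a vertex of a position plays role `zero` of the colouring `X`. Its edges
  -- to the hub vertices of that same role have no colour to inherit from `X`; they are the ones
  -- that carry the cycle colours.
  ψ₀ : EdgeType → Fin (q₁ + q₂)
  ψ₀ (hh a a′) = q₁ ↑ʳ χ X a a′
  ψ₀ (zh s zero g) = g ↑ˡ q₂
  ψ₀ (zh s (suc a) g) = q₁ ↑ʳ χ X zero (suc a)
  ψ₀ (zz s s′) with joined? P s s′
  ... | yes (j , _) = q₁ ↑ʳ j
  ... | no _ = q₁ ↑ʳ j₀

  clique≢cycle : ∀ {c : Fin q₁} {j : Fin q₂} → q₁ ↑ʳ j ≢ c ↑ˡ q₂
  clique≢cycle {c} {j} e = contradiction (trans (sym (F.splitAt-↑ʳ q₁ q₂ j)) (trans (cong (splitAt q₁) e) (F.splitAt-↑ˡ q₁ c q₂))) λ ()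

  read : Vertex → Fin hubs → Fin q₁ → ℕ
  read (_ , u) a g = u (combine a g)

  hubOf-combine : ∀ (a : Fin hubs) (g : Fin q₁) → hubOf (combine a g) ≡ a
  hubOf-combine a g = cong proj₁ (F.remQuot-combine a g)

  numberOf-combine : ∀ (a : Fin hubs) (g : Fin q₁) → numberOf (combine a g) ≡ g
  numberOf-combine a g = cong proj₂ (F.remQuot-combine {hubs} a g)

  -- In the intended colouring each vertex of a position has a single neighbour in a given cycle colour.
  cycle-edge : ∀ {c x y} → Edge ψ₀ (c ↑ˡ q₂) x y → (∃ λ s → proj₁ x ≡ inj₂ s) × y ≈ (inj₁ zero , λ _ → read x zero c)
  cycle-edge (edge (hh a a′) ok eq e ex ey) = ⊥-elim (clique≢cycle eq)
  cycle-edge (edge (zh s (suc a) g) ok eq e ex ey) = ⊥-elim (clique≢cycle eq)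
  cycle-edge (edge (zz s s′) ok eq e ex ey) with joined? P s s′
  ... | yes _ = ⊥-elim (clique≢cycle eq)
  ... | no _ = ⊥-elim (clique≢cycle eq)
  cycle-edge {c} {x} {y} (edge (zh s zero g) ok eq e (sx , ux) (sy , uy)) with F.↑ˡ-injective q₂ g c eq
  ... | refl = (s , sx) , sy , λ d → trans (uy d) (sym (trans (ux (combine {hubs} zero g))
        (cong₂ (λ a g → values e a (toℕ g)) (hubOf-combine zero g) (numberOf-combine zero g))))

  -- Every edge of a cycle colour has an end in a position, and this end has degree one in that
  -- colour. The end of the first edge that lies in a position would have a second edge on the
  -- cycle.
  no-cycle : ∀ {L} → 2 ≤ L → ∀ c → ¬ Copy (Edge↔ ψ₀ (c ↑ˡ q₂)) _≈_ (cycle (suc L))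
  no-cycle {L} 2≤L c K = go (step 1≤L) (step 2≤L) close
    where
    1≤L : 1 ≤ L
    1≤L = ℕ.≤-trans (s≤s z≤n) 2≤L
    open Cycle (copy-cycle {R = Edge↔ ψ₀ (c ↑ˡ q₂)} {_≈_} 1≤L K)
    clash : ∀ {x y z} → Edge ψ₀ (c ↑ˡ q₂) x y → ¬ Edge ψ₀ (c ↑ˡ q₂) y z
    clash h h′ with cycle-edge h | cycle-edge h′
    ... | _ , (e , _) | (_ , e′) , _ = contradiction (trans (sym e) e′) λ ()
    same : ∀ {x y z} → Edge ψ₀ (c ↑ˡ q₂) x y → Edge ψ₀ (c ↑ˡ q₂) x z → y ≈ z
    same h h′ = ≈-trans (proj₂ (cycle-edge h)) (≈-sym (proj₂ (cycle-edge h′)))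
    E : Vertex → Vertex → Set
    E = Edge↔ ψ₀ (c ↑ˡ q₂)
    go : E (point 0) (point 1) → E (point 1) (point 2) → E (point L) (point 0) → ⊥
    go (inj₂ h) (inj₁ h′) _ = contradiction (apart z≤n 2≤L (same h h′)) λ ()
    go (inj₂ h) (inj₂ h′) _ = clash h′ h
    go (inj₁ h) _ (inj₁ h′) = clash h′ h
    go (inj₁ h) _ (inj₂ h′) = ℕ.<⇒≢ 2≤L (apart 1≤L ℕ.≤-refl (same h h′))

  data CliqueEdge (j : Fin q₂) : Vertex → Vertex → Set where
    hubs-edge : ∀ {x y} a a′ → proj₁ x ≡ inj₁ a → proj₁ y ≡ inj₁ a′ → a ≢ a′ → χ X a a′ ≡ j → CliqueEdge j x y
    down-edge : ∀ {x y} s a g → proj₁ x ≡ inj₂ s → proj₁ y ≡ inj₁ (suc a) → (∀ d → proj₂ y d ≡ read x (suc a) g) →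
                χ X zero (suc a) ≡ j → CliqueEdge j x y
    up-edge   : ∀ {x y} s a g → proj₁ x ≡ inj₁ (suc a) → proj₁ y ≡ inj₂ s → (∀ d → proj₂ x d ≡ read y (suc a) g) →
                χ X zero (suc a) ≡ j → CliqueEdge j x y
    level-edge : ∀ {x y} s s′ → proj₁ x ≡ inj₂ s → proj₁ y ≡ inj₂ s′ → Joined P j s s′ →
                 (∀ a g g′ → read x a g ≢ read y a g′) → CliqueEdge j x y

  CliqueEdge-sym : ∀ {j x y} → CliqueEdge j x y → CliqueEdge j y x
  CliqueEdge-sym (hubs-edge a a′ ex ey ne e) = hubs-edge a′ a ey ex (ne ∘ sym) (trans (χ-sym X a′ a) e)
  CliqueEdge-sym (down-edge s a g ex ey u e) = up-edge s a g ey ex u e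
  CliqueEdge-sym (up-edge s a g ex ey u e) = down-edge s a g ey ex u e
  CliqueEdge-sym (level-edge s s′ ex ey jn ne) = level-edge s′ s ey ex (symmetric P jn) λ a g g′ → ne a g′ g ∘ sym

  clique-edge : ∀ {j x y} → Edge ψ₀ (q₁ ↑ʳ j) x y → CliqueEdge j x y
  clique-edge {j} (edge (hh a a′) ok eq e (ex , _) (ey , _)) =
    hubs-edge a a′ ex ey (λ e → ℕ.<⇒≢ (⌊⌋-sound (a F.<? a′) ok) (cong toℕ e)) (F.↑ʳ-injective q₁ _ _ eq)
  clique-edge (edge (zh s zero g) ok eq e ex ey) = ⊥-elim (clique≢cycle (sym eq))
  clique-edge (edge (zh s (suc a) g) ok eq e (ex , ux) (ey , uy)) = down-edge s a g ex ey
    (λ d → trans (uy d) (sym (trans (ux (combine (suc a) g)) (cong₂ (λ a g → values e a (toℕ g)) (hubOf-combine (suc a) g) (numberOf-combine (suc a) g)))))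
    (F.↑ʳ-injective q₁ _ _ eq)
  clique-edge {j} {x} {y} (edge (zz s s′) ok eq e (ex , ux) (ey , uy)) with joined? P s s′ | ok
  ... | no _ | ok = contradiction (proj₂ (∧-sound {⌊ s F.<? s′ ⌋} ok)) λ ()
  ... | yes (j′ , jn) | ok with F.↑ʳ-injective q₁ j′ j eq
  ...   | refl = level-edge s s′ ex ey jn λ a g g′ same → ℕ.<⇒≢ (lt a g g′) (trans (sym (rx a g)) (trans same (ry a g′)))
    where
    rx : ∀ a g → read x a g ≡ values e a (toℕ g)
    rx a g = trans (ux (combine a g)) (cong₂ (λ a g → values e a (toℕ g)) (hubOf-combine a g) (numberOf-combine a g))
    ry : ∀ a g → read y a g ≡ values e a (q₁ + toℕ g)
    ry a g = trans (uy (combine a g)) (cong₂ (λ a g → values e a (q₁ + toℕ g)) (hubOf-combine a g) (numberOf-combine a g))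
    lt : ∀ a (g g′ : Fin q₁) → values e a (toℕ g) < values e a (q₁ + toℕ g′)
    lt a g g′ = increasing e a (ℕ.<-≤-trans (F.toℕ<n g) (ℕ.m≤m+n q₁ _)) (ℕ.<-≤-trans (ℕ.+-monoʳ-< q₁ (F.toℕ<n g′)) q₁≤B)

  -- Two adjacent vertices of positions have no common hub neighbour, so a clique with a hub vertex uses distinct roles.
  no-clique : ∀ j → ¬ Copy (Edge↔ ψ₀ (q₁ ↑ʳ j)) _≈_ (complete t)
  no-clique j K = split (searchable-Fin {P = λ u → ∃ λ s → proj₁ (vertex K u) ≡ inj₂ s} {Q = λ u → ∃ λ a → proj₁ (vertex K u) ≡ inj₁ a}
      (λ { refl p → p }) (λ u → sortOf (proj₁ (vertex K u)) refl))
    where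
    V : Fin t → Vertex
    V = vertex K
    sortOf : ∀ {v} (s : VertexSort) → v ≡ s → (∃ λ s → v ≡ inj₂ s) ⊎ (∃ λ a → v ≡ inj₁ a)
    sortOf (inj₁ a) e = inj₂ (a , e)
    sortOf (inj₂ s) e = inj₁ (s , e)
    E : ∀ {u v} → u ≢ v → CliqueEdge j (V u) (V v)
    E {u} {v} ne with preserves K u v (complete-adj {u = u} {v} ne)
    ... | inj₁ h = clique-edge h
    ... | inj₂ h = CliqueEdge-sym (clique-edge h)
    split : (∀ u → ∃ λ s → proj₁ (V u) ≡ inj₂ s) ⊎ (∃ λ u → ∃ λ a → proj₁ (V u) ≡ inj₁ a) → ⊥
    split (inj₁ allz) = clique-free P j (proj₁ ∘ allz) λ {u} {v} ne → joined (E ne)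
      where
      joined : ∀ {u v} → CliqueEdge j (V u) (V v) → Joined P j (proj₁ (allz u)) (proj₁ (allz v))
      joined {u} {v} (level-edge s s′ ex ey jn _) = subst₂ (Joined P j)
        (inj₂-injective (trans (sym ex) (proj₂ (allz u)))) (inj₂-injective (trans (sym ey) (proj₂ (allz v)))) jn
      joined {u} {v} (hubs-edge a a′ ex ey ne e) = contradiction (trans (sym ex) (proj₂ (allz u))) λ ()
      joined {u} {v} (down-edge s a g ex ey _ e) = contradiction (trans (sym ey) (proj₂ (allz v))) λ ()
      joined {u} {v} (up-edge s a g ex ey _ e) = contradiction (trans (sym ex) (proj₂ (allz u))) λ ()
    split (inj₂ (w , b , ew)) = χ-free X j role λ {u} {v} ne → roles u v ne (E ne) refl refl
      where
      roleOf : VertexSort → Fin hubs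
      roleOf (inj₁ a) = a
      roleOf (inj₂ _) = zero
      role : Fin t → Fin hubs
      role u = roleOf (proj₁ (V u))
      w≢ : ∀ {u s} → proj₁ (V u) ≡ inj₂ s → u ≢ w
      w≢ e refl = contradiction (trans (sym e) ew) λ ()
      common : ∀ {u s} → proj₁ (V u) ≡ inj₂ s → CliqueEdge j (V u) (V w) → ∃ λ g → ∀ d → proj₂ (V w) d ≡ read (V u) b g
      common eu (down-edge s a g _ ey r _) with inj₁-injective (trans (sym ey) ew)
      ... | refl = g , r
      common eu (hubs-edge _ _ ex _ _ _) = contradiction (trans (sym ex) eu) λ ()
      common eu (up-edge _ _ _ ex _ _ _) = contradiction (trans (sym ex) eu) λ ()
      common eu (level-edge _ _ _ ey _ _) = contradiction (trans (sym ey) ew) λ ()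
      roles : ∀ u v → u ≢ v → ∀ {x y} → CliqueEdge j x y → x ≡ V u → y ≡ V v → role u ≢ role v × χ X (role u) (role v) ≡ j
      roles u v ne (hubs-edge a a′ ex ey a≢a′ e) refl refl rewrite ex | ey = a≢a′ , e
      roles u v ne (down-edge s a g ex ey _ e) refl refl rewrite ex | ey = (λ ()) , e
      roles u v ne (up-edge s a g ex ey _ e) refl refl rewrite ex | ey = (λ ()) , trans (χ-sym X (suc a) zero) e
      roles u v ne (level-edge s s′ ex ey _ disjoint) refl refl with common ex (E (w≢ ex)) | common ey (E (w≢ ey))
      ... | g , r | g′ , r′ = ⊥-elim (disjoint b g g′ (trans (sym (r (combine b g))) (r′ (combine b g))))

-- An increasing sequence with prescribed values at two indices.
through : (g g′ lo hi : ℕ) → ℕ → ℕ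
through g g′ lo hi q with q <? g′
... | yes _ = (lo ∸ g) + q
... | no _  = (hi ∸ g′) + q

through-lo : ∀ {g g′ lo hi} → g < g′ → g ≤ lo → through g g′ lo hi g ≡ lo
through-lo {g} {g′} lt le with g <? g′
... | yes _ = ℕ.m∸n+n≡m le
... | no ¬lt = ⊥-elim (¬lt lt)

through-hi : ∀ {g g′ lo hi} → g′ ≤ hi → through g g′ lo hi g′ ≡ hi
through-hi {g} {g′} le with g′ <? g′
... | yes lt = ⊥-elim (ℕ.<-irrefl refl lt)
... | no _ = ℕ.m∸n+n≡m le

through-increasing : ∀ {g g′ lo hi} → g ≤ lo → lo + g′ ≤ hi → StrictlyIncreasing (through g g′ lo hi)
through-increasing {g} {g′} {lo} {hi} le le′ {i} {j} i<j with i <? g′ | j <? g′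
... | yes _ | yes _ = ℕ.+-monoʳ-< (lo ∸ g) i<j
... | no _ | no _ = ℕ.+-monoʳ-< (hi ∸ g′) i<j
... | no ¬i | yes j< = ⊥-elim (¬i (ℕ.<-trans i<j j<))
... | yes i< | no ¬j = ℕ.≤-<-trans (ℕ.+-monoˡ-≤ i (ℕ.m∸n≤m lo g)) (ℕ.<-≤-trans (ℕ.+-monoʳ-< lo i<)
        (ℕ.≤-trans le′ (ℕ.≤-trans (ℕ.≤-reflexive (sym (ℕ.m∸n+n≡m (ℕ.≤-trans (ℕ.m≤n+m g′ lo) le′)))) (ℕ.+-monoʳ-≤ (hi ∸ g′) (ℕ.≮⇒≥ ¬j)))))

other : ∀ {m} → 2 ≤ m → (a : Fin m) → ∃ λ a′ → a′ ≢ a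
other (s≤s (s≤s z≤n)) zero = suc zero , λ ()
other (s≤s (s≤s z≤n)) (suc a) = zero , λ ()

third : ∀ {m} → 3 ≤ m → (a b : Fin m) → ∃ λ c → c ≢ a × c ≢ b
third (s≤s (s≤s (s≤s z≤n))) a b with zero F.≟ a | zero F.≟ b
... | no p | no q = zero , p , q
... | yes refl | _ with suc zero F.≟ b
...   | no q = suc zero , (λ ()) , q
...   | yes refl = suc (suc zero) , (λ ()) , λ ()
third (s≤s (s≤s (s≤s z≤n))) a b | no p | yes refl with suc zero F.≟ a
...   | no q = suc zero , q , λ ()
...   | yes refl = suc (suc zero) , (λ ()) , λ ()

-- Even cycles: copies forced in every colouring

module EvenColours {q₂ t ρ n : ℕ} (Q : ℕ) (P : Pattern (suc Q) q₂ t (suc ρ) n) (X : CliqueColouring q₂ t (suc ρ)) (j₀ : Fin q₂)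
                   (K : CliqueRamsey q₂ t (suc (suc ρ))) (1≤ρ : 1 ≤ ρ) (3≤n : 3 ≤ n) (h : ℕ) (1≤h : 1 ≤ h) where

  open EvenSystem Q P X j₀
  open Windows Q

  L : ℕ
  L = suc (double h)

  hub : Fin hubs → ℕ → Vertex
  hub a y = inj₁ a , λ _ → y

  strand : Fin n → (Fin hubs → ℕ → ℕ) → Vertex
  strand s e = inj₂ s , λ d → e (hubOf d) (toℕ (numberOf d))

  plain : Fin n → (Fin hubs → ℕ) → Vertex
  plain s b = strand s λ a q → b a + q

  origin : Fin slotCount
  origin = combine {hubs} {q₁} zero zero

  hub-apart : ∀ {a y y′} → hub a y ≈ hub a y′ → y ≡ y′
  hub-apart (_ , e) = e origin

  strand-apart : ∀ {s e e′} → strand s e ≈ strand s e′ → ∀ a → e a 0 ≡ e′ a 0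
  strand-apart {s} {e} {e′} (_ , eq) a = trans (sym (at₀ e)) (trans (eq (combine a zero)) (at₀ e′))
    where
    at₀ : ∀ e → e (hubOf (combine {hubs} {q₁} a zero)) (toℕ (numberOf (combine {hubs} {q₁} a zero))) ≡ e a 0
    at₀ e = cong₂ (λ a g → e a (toℕ g)) (hubOf-combine a zero) (numberOf-combine a zero)

  plain-apart : ∀ {s b b′} → plain s b ≈ plain s b′ → ∀ a → b a ≡ b′ a
  plain-apart {s} {b} {b′} e a = ℕ.+-cancelʳ-≡ 0 (b a) (b′ a) (strand-apart {s} {λ a q → b a + q} {λ a q → b′ a + q} e a)

  Inc : (Fin hubs → ℕ → ℕ) → Set
  Inc e = ∀ a → StrictlyIncreasing (e a)

  toConfig : ∀ e → Inc e → Config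
  toConfig e inc = config e λ a lt _ → inc a lt

  Edge-resp : ∀ {k} {ψ : EdgeType → Fin k} {c x x′ y y′} → x ≈ x′ → y ≈ y′ → Edge ψ c x′ y′ → Edge ψ c x y
  Edge-resp ex ey (edge τ ok eq e hx hy) = edge τ ok eq e (≈-trans ex hx) (≈-trans ey hy)

  recolour : ∀ {k} {ψ : EdgeType → Fin k} {c c′ x y} → c ≡ c′ → Edge ψ c x y → Edge ψ c′ x y
  recolour refl h = h

  hub-edge : ∀ {k} {ψ : EdgeType → Fin k} {a a′} → a Fin.< a′ → ∀ y y′ → Edge ψ (ψ (hh a a′)) (hub a y) (hub a′ y′)
  hub-edge {a = a} {a′} lt y y′ = edge (hh a a′) (⌊⌋-complete (a F.<? a′) lt) refl
    (toConfig (λ p i → base p + i) (λ p → ℕ.+-monoʳ-< (base p)))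
    (refl , λ _ → sym (trans (ℕ.+-identityʳ _) base-a)) (refl , λ _ → sym (trans (ℕ.+-identityʳ _) base-a′))
    where
    base : Fin hubs → ℕ
    base p with p F.≟ a
    ... | yes _ = y
    ... | no _ = y′
    base-a : base a ≡ y
    base-a with a F.≟ a
    ... | yes _ = refl
    ... | no ¬p = ⊥-elim (¬p refl)
    base-a′ : base a′ ≡ y′
    base-a′ with a′ F.≟ a
    ... | yes e = ⊥-elim (ℕ.<⇒≢ lt (cong toℕ (sym e)))
    ... | no _ = refl

  down : ∀ {k} {ψ : EdgeType → Fin k} s a g e → Inc e → ∀ {y} → e a (toℕ g) ≡ y → Edge ψ (ψ (zh s a g)) (strand s e) (hub a y)
  down s a g e inc eq = edge (zh s a g) refl refl (toConfig e inc) (refl , λ _ → refl) (refl , λ _ → sym eq)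

  level : ∀ {k} {ψ : EdgeType → Fin k} {s s′ j} → s Fin.< s′ → Joined P j s s′ → ∀ {b b′} → (∀ a → b a + q₁ ≤ b′ a) →
          Edge ψ (ψ (zz s s′)) (plain s b) (plain s′ b′)
  level {s = s} {s′} {j} lt jn {b} {b′} le = edge (zz s s′)
    (cong₂ _∧_ (⌊⌋-complete (s F.<? s′) lt) (⌊⌋-complete (joined? P s s′) (j , jn))) refl
    (toConfig (λ a → jump (b a) (b′ a)) (λ a → jump-increasing (le a)))
    (refl , λ d → jump-low (b (hubOf d)) (b′ (hubOf d)) (F.toℕ<n (numberOf d)))
    (refl , λ d → jump-high (b (hubOf d)) (b′ (hubOf d)) (toℕ (numberOf d)))

  irreflexive-edges : ∀ {k} (ψ : EdgeType → Fin k) → Irreflexive ψ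
  irreflexive-edges ψ (edge (hh a a′) ok _ e (ex , _) (ey , _)) (eq , _) =
    ℕ.<⇒≢ (⌊⌋-sound (a F.<? a′) ok) (cong toℕ (inj₁-injective (trans (sym ex) (trans eq ey))))
  irreflexive-edges ψ (edge (zh s a g) ok _ e (ex , _) (ey , _)) (eq , _) = contradiction (trans (sym ex) (trans eq ey)) λ ()
  irreflexive-edges ψ (edge (zz s s′) ok _ e (ex , _) (ey , _)) (eq , _) =
    ℕ.<⇒≢ (⌊⌋-sound (s F.<? s′) (proj₁ (∧-sound ok))) (cong toℕ (inj₂-injective (trans (sym ex) (trans eq ey))))

  module _ {ψ : EdgeType → Fin (q₁ + q₂)} {φ : Fin n → Fin (q₁ + q₂)} {c : Fin q₁} where

    E : Vertex⁺ → Vertex⁺ → Set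
    E = Edge⁺ ψ φ (c ↑ˡ q₂)

    CycleCopy : Set
    CycleCopy = Copy E _≈⁺_ (cycle (suc L))

    alternate : Alternating {R = E} {_≈⁺_} h → CycleCopy
    alternate A = cycle-copy (λ {x} {y} → Edge⁺-sym x y) (alternating-cycle A)

    -- Hub vertices of two roles are adjacent whatever their numbers, so this type contains
    -- arbitrarily large complete bipartite graphs.
    hub-cycle : ∀ {a a′} → a Fin.< a′ → ψ (hh a a′) ≡ c ↑ˡ q₂ → CycleCopy
    hub-cycle {a} {a′} lt eq = alternate record
      { x = inj₁ ∘ hub a ; y = inj₁ ∘ hub a′
      ; xy = λ {i} _ → inj₁ (recolour eq (hub-edge lt i i))
      ; yx = λ {i} _ → inj₂ (recolour eq (hub-edge lt (suc i) i))
      ; yx₀ = inj₂ (recolour eq (hub-edge lt 0 h))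
      ; x-apart = λ {i} {j} _ _ → hub-apart {a} {i} {j}
      ; y-apart = λ {i} {j} _ _ → hub-apart {a′} {i} {j}
      ; xy-apart = λ _ _ (e , _) → a≢a′ (inj₁-injective e)
      ; yx-apart = λ _ _ (e , _) → a≢a′ (sym (inj₁-injective e)) }
      where
      a≢a′ : a ≢ a′
      a≢a′ e = ℕ.<⇒≢ lt (cong toℕ e)

    -- All windows of the vertices `Y′` lie above all those of the vertices `X′`, which again gives
    -- a complete bipartite graph.
    level-cycle : ∀ {s s′ j} → s Fin.< s′ → Joined P j s s′ → ψ (zz s s′) ≡ c ↑ˡ q₂ → CycleCopy
    level-cycle {s} {s′} lt jn eq = alternate record
      { x = λ i → inj₁ (plain s (X′ i)) ; y = λ i → inj₁ (plain s′ (Y′ i))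
      ; xy = λ {i} le → inj₁ (joins {i} {i} le)
      ; yx = λ {i} le → inj₂ (joins {suc i} {i} le)
      ; yx₀ = inj₂ (joins {0} {h} z≤n)
      ; x-apart = λ {i} {j} _ _ e → ℕ.*-cancelʳ-≡ i j q₁ (plain-apart {s} {X′ i} {X′ j} e zero)
      ; y-apart = λ {i} {j} _ _ e → ℕ.+-cancelˡ-≡ (suc h) i j (ℕ.*-cancelʳ-≡ (suc h + i) (suc h + j) q₁ (plain-apart {s′} {Y′ i} {Y′ j} e zero))
      ; xy-apart = λ _ _ (e , _) → s≢s′ (inj₂-injective e)
      ; yx-apart = λ _ _ (e , _) → s≢s′ (sym (inj₂-injective e)) }
      where
      s≢s′ : s ≢ s′
      s≢s′ e = ℕ.<⇒≢ lt (cong toℕ e)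
      X′ Y′ : ℕ → Fin hubs → ℕ
      X′ i _ = i * q₁
      Y′ i _ = (suc h + i) * q₁
      joins : ∀ {i j} → i ≤ h → Edge ψ (c ↑ˡ q₂) (plain s (X′ i)) (plain s′ (Y′ j))
      joins {i} {j} le = recolour eq (level lt jn {X′ i} {Y′ j} λ _ → ℕ.≤-trans (ℕ.≤-reflexive (ℕ.+-comm (i * q₁) q₁))
        (ℕ.*-monoˡ-≤ q₁ (ℕ.≤-trans (s≤s le) (ℕ.m≤m+n (suc h) j))))

    -- The cycle is a subdivision of one through hub vertices of role a, by vertices of position s.
    number-cycle : ∀ s a {g g′ : Fin q₁} → g Fin.< g′ → ψ (zh s a g) ≡ c ↑ˡ q₂ → ψ (zh s a g′) ≡ c ↑ˡ q₂ → CycleCopy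
    number-cycle s a {g} {g′} lt eq eq′ = alternate record
      { x = inj₁ ∘ hub a ∘ Y ; y = λ i → inj₁ (strand s (seq i))
      ; xy = λ {i} le → inj₂ (first i (ℕ.m≤n⇒m<n∨m≡n le))
      ; yx = λ {i} lt → inj₁ (down-g′ i (cong (λ z → proj₂ z) (ends-below lt)))
      ; yx₀ = inj₁ (down-g h (cong (λ z → proj₁ z) ends-top))
      ; x-apart = λ {i} {j} _ _ e → ℕ.suc-injective (ℕ.*-cancelʳ-≡ (suc i) (suc j) q₁ (hub-apart {a} {Y i} {Y j} e))
      ; y-apart = λ {i} {j} _ _ e → ℕ.+-cancelʳ-≡ 0 i j (trans (sym (seq-b i)) (trans (strand-apart {s} {seq i} {seq j} e b) (seq-b j)))
      ; xy-apart = λ _ _ (e , _) → contradiction e λ ()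
      ; yx-apart = λ _ _ (e , _) → contradiction e λ () }
      where
      -- If `h` is 1, both strands have the same two hub neighbours; a second coordinate tells them
      -- apart. It exists because there are at least two roles.
      b : Fin hubs
      b = proj₁ (other (s≤s 1≤ρ) a)
      -- Multiples of `q₁`, starting with `q₁` itself, leave room for the entries before index `g`
      -- and for those between `g` and `g′`. The closing strand takes `Y 0` and `Y h`, so that the
      -- smaller number always belongs to `g`.
      Y : ℕ → ℕ
      Y i = suc i * q₁
      ends : ℕ → ℕ × ℕ
      ends i with i <? h
      ... | yes _ = Y i , Y (suc i)
      ... | no _  = Y 0 , Y h
      ends-below : ∀ {i} → i < h → ends i ≡ (Y i , Y (suc i))
      ends-below {i} lt with i <? h
      ... | yes _ = refl
      ... | no ¬lt = ⊥-elim (¬lt lt)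
      ends-top : ends h ≡ (Y 0 , Y h)
      ends-top with h <? h
      ... | yes lt = ⊥-elim (ℕ.<-irrefl refl lt)
      ... | no _ = refl
      low : ∀ i → q₁ ≤ proj₁ (ends i)
      low i with i <? h
      ... | yes _ = ℕ.m≤m+n q₁ (i * q₁)
      ... | no _ = ℕ.m≤m+n q₁ 0
      gap : ∀ i → proj₁ (ends i) + q₁ ≤ proj₂ (ends i)
      gap i with i <? h
      ... | yes _ = ℕ.≤-reflexive (ℕ.+-comm (Y i) q₁)
      ... | no _ = ℕ.≤-trans (ℕ.≤-reflexive (ℕ.+-comm (Y 0) q₁)) (ℕ.*-monoˡ-≤ q₁ (s≤s 1≤h))
      seqᵃ : ℕ → ℕ → ℕ
      seqᵃ i = through (toℕ g) (toℕ g′) (proj₁ (ends i)) (proj₂ (ends i))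
      seq : ℕ → Fin hubs → ℕ → ℕ
      seq i p with p F.≟ a
      ... | yes _ = seqᵃ i
      ... | no _  = i +_
      seq-a : ∀ i → seq i a ≡ seqᵃ i
      seq-a i with a F.≟ a
      ... | yes _ = refl
      ... | no ¬p = ⊥-elim (¬p refl)
      seq-b : ∀ i → seq i b 0 ≡ i + 0
      seq-b i with b F.≟ a
      ... | yes e = ⊥-elim (proj₂ (other (s≤s 1≤ρ) a) e)
      ... | no _ = refl
      g≤ : ∀ (g : Fin q₁) → toℕ g ≤ q₁
      g≤ g = ℕ.<⇒≤ (F.toℕ<n g)
      seq-inc : ∀ i → Inc (seq i)
      seq-inc i p with p F.≟ a
      ... | yes _ = through-increasing (ℕ.≤-trans (g≤ g) (low i)) (ℕ.≤-trans (ℕ.+-monoʳ-≤ _ (g≤ g′)) (gap i))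
      ... | no _ = ℕ.+-monoʳ-< i
      down-g : ∀ i {y} → proj₁ (ends i) ≡ y → Edge ψ (c ↑ˡ q₂) (strand s (seq i)) (hub a y)
      down-g i e = recolour eq (down s a g (seq i) (seq-inc i)
        (trans (cong (λ f → f (toℕ g)) (seq-a i)) (trans (through-lo lt (ℕ.≤-trans (g≤ g) (low i))) e)))
      down-g′ : ∀ i {y} → proj₂ (ends i) ≡ y → Edge ψ (c ↑ˡ q₂) (strand s (seq i)) (hub a y)
      down-g′ i e = recolour eq′ (down s a g′ (seq i) (seq-inc i)
        (trans (cong (λ f → f (toℕ g′)) (seq-a i)) (trans (through-hi {toℕ g} {toℕ g′} {proj₁ (ends i)} (ℕ.≤-trans (g≤ g′) (ℕ.≤-trans (ℕ.m≤n+m q₁ _) (gap i)))) e)))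
      first : ∀ i → i < h ⊎ i ≡ h → Edge ψ (c ↑ˡ q₂) (strand s (seq i)) (hub a (Y i))
      first i (inj₁ i<h) = down-g i (cong (λ z → proj₁ z) (ends-below i<h))
      first i (inj₂ refl) = down-g′ h (cong (λ z → proj₂ z) ends-top)

  blocks : (f : Fin hubs → ℕ → ℕ) → (∀ a → Spread (f a)) → Config
  blocks f sp = toConfig (λ a → block (f a)) (λ a → block-increasing {f a} (sp a))

  pos-blocks : ∀ f sp s → pos s (blocks f sp) ≈ plain s (λ a → f a (toℕ s))
  pos-blocks f sp s = refl , λ d → block-at (f (hubOf d)) (toℕ s) (F.toℕ<n (numberOf d))

  pos-edge : ∀ {k} {ψ : EdgeType → Fin k} {s s′ j} → s Fin.< s′ → Joined P j s s′ → ∀ f sp →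
             Edge ψ (ψ (zz s s′)) (pos s (blocks f sp)) (pos s′ (blocks f sp))
  pos-edge {s = s} {s′} lt jn f sp = Edge-resp (pos-blocks f sp s) (pos-blocks f sp s′)
    (level lt jn {λ a → f a (toℕ s)} {λ a → f a (toℕ s′)} λ a → spread-< {f a} (sp a) lt)

  W : ℕ
  W = (2 + h) * q₁

  module Arrangements (s s′ : Fin n) (s≢s′ : s ≢ s′) (b : Fin hubs) where

    -- The number of places by which the block of a position is moved, in the coordinate b only.
    moved : (i j m : ℕ) → ℕ → ℕ
    moved i j m p with p ℕ.≟ toℕ s | p ℕ.≟ toℕ s′
    ... | yes _ | _     = i
    ... | no _  | yes _ = j
    ... | no _  | no _  = m

    moved-s : ∀ i j m → moved i j m (toℕ s) ≡ i
    moved-s i j m with toℕ s ℕ.≟ toℕ s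
    ... | yes _ = refl
    ... | no ¬p = ⊥-elim (¬p refl)

    moved-s′ : ∀ i j m → moved i j m (toℕ s′) ≡ j
    moved-s′ i j m with toℕ s′ ℕ.≟ toℕ s | toℕ s′ ℕ.≟ toℕ s′
    ... | yes e | _ = ⊥-elim (s≢s′ (sym (F.toℕ-injective e)))
    ... | no _ | yes _ = refl
    ... | no _ | no ¬p = ⊥-elim (¬p refl)

    moved-off : ∀ i j m {u} → u ≢ s → u ≢ s′ → moved i j m (toℕ u) ≡ m
    moved-off i j m {u} p q with toℕ u ℕ.≟ toℕ s | toℕ u ℕ.≟ toℕ s′
    ... | yes e | _ = ⊥-elim (p (F.toℕ-injective e))
    ... | no _ | yes e = ⊥-elim (q (F.toℕ-injective e))
    ... | no _ | no _ = refl

    moved-≤ : ∀ {i j m} → i ≤ h → j ≤ h → m ≤ h → ∀ p → moved i j m p ≤ h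
    moved-≤ li lj lm p with p ℕ.≟ toℕ s | p ℕ.≟ toℕ s′
    ... | yes _ | _     = li
    ... | no _  | yes _ = lj
    ... | no _  | no _  = lm

    bases : ℕ → ℕ → Fin hubs → ℕ
    bases p k a with a F.≟ b
    ... | yes _ = p * W + k * q₁
    ... | no _  = p * W

    bases-b : ∀ p k → bases p k b ≡ p * W + k * q₁
    bases-b p k with b F.≟ b
    ... | yes _ = refl
    ... | no ¬p = ⊥-elim (¬p refl)

    bases-off : ∀ p k {a} → a ≢ b → bases p k a ≡ p * W
    bases-off p k {a} ne with a F.≟ b
    ... | yes e = ⊥-elim (ne e)
    ... | no _ = refl

    bases-injective : ∀ p {k k′} → bases p k b ≡ bases p k′ b → k ≡ k′
    bases-injective p {k} {k′} e = ℕ.*-cancelʳ-≡ k k′ q₁ (ℕ.+-cancelˡ-≡ (p * W) _ _ (trans (sym (bases-b p k)) (trans e (bases-b p k′))))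

    bases-spread : ∀ {k k′} p → k ≤ h → ∀ a → bases p k a + q₁ ≤ bases (suc p) k′ a
    bases-spread {k} {k′} p le a with a F.≟ b
    ... | yes _ = ℕ.≤-trans (ℕ.≤-reflexive (ℕ.+-assoc (p * W) _ q₁)) (ℕ.≤-trans (ℕ.+-monoʳ-≤ (p * W) room)
                    (ℕ.≤-trans (ℕ.≤-reflexive (ℕ.+-comm (p * W) W)) (ℕ.m≤m+n _ (k′ * q₁))))
      where
      room : k * q₁ + q₁ ≤ W
      room = ℕ.≤-trans (ℕ.≤-reflexive (ℕ.+-comm (k * q₁) q₁)) (ℕ.*-monoˡ-≤ q₁ (ℕ.≤-trans (s≤s le) (ℕ.n≤1+n _)))
    ... | no _ = ℕ.≤-trans (ℕ.+-monoʳ-≤ (p * W) (ℕ.m≤m+n q₁ _)) (ℕ.≤-reflexive (ℕ.+-comm (p * W) W))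

    module _ {i j m} (li : i ≤ h) (lj : j ≤ h) (lm : m ≤ h) where

      arrangement : Config
      arrangement = blocks (λ a p → bases p (moved i j m p) a) (λ a p → bases-spread p (moved-≤ li lj lm p) a)

      pos-arrangement : ∀ u → pos u arrangement ≈ plain u (bases (toℕ u) (moved i j m (toℕ u)))
      pos-arrangement u = pos-blocks (λ a p → bases p (moved i j m p) a) (λ a p → bases-spread p (moved-≤ li lj lm p) a) u

      pos-s : pos s arrangement ≈ plain s (bases (toℕ s) i)
      pos-s = subst (λ k → pos s arrangement ≈ plain s (bases (toℕ s) k)) (moved-s i j m) (pos-arrangement s)

      pos-s′ : pos s′ arrangement ≈ plain s′ (bases (toℕ s′) j)
      pos-s′ = subst (λ k → pos s′ arrangement ≈ plain s′ (bases (toℕ s′) k)) (moved-s′ i j m) (pos-arrangement s′)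

      pos-off : ∀ {u} → u ≢ s → u ≢ s′ → pos u arrangement ≈ plain u (bases (toℕ u) m)
      pos-off {u} p q = subst (λ k → pos u arrangement ≈ plain u (bases (toℕ u) k)) (moved-off i j m p q) (pos-arrangement u)

  -- Two positions in the same cycle colour.  The cycle alternates between vertices z of position s and w of
  -- position s′, joined by new vertices; if the number of these is odd, the last two are both z and share a hub neighbour.
  module _ {ψ : EdgeType → Fin (q₁ + q₂)} {φ : Fin n → Fin (q₁ + q₂)} {c : Fin q₁} {s s′ : Fin n} (lt : s Fin.< s′)
           (a : Fin hubs) (g : Fin q₁) (eψ : ψ (zh s a g) ≡ c ↑ˡ q₂) (es : φ s ≡ c ↑ˡ q₂) (es′ : φ s′ ≡ c ↑ˡ q₂) where

    private
      s≢s′ : s ≢ s′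
      s≢s′ e = ℕ.<⇒≢ lt (cong toℕ e)

      -- All displacements take place in the coordinate `b`. In the coordinate `a` the blocks stay
      -- fixed, so that the vertices `z i` share the hub neighbour `centre`.
      b : Fin hubs
      b = proj₁ (other (s≤s 1≤ρ) a)

      -- New vertices with equal neighbours at `s` and `s′` must still differ; the block of a third
      -- position records their index.
      u : Fin n
      u = proj₁ (third 3≤n s s′)

      open Arrangements s s′ s≢s′ b

      z w : ℕ → Vertex
      z i = plain s (bases (toℕ s) i)
      w j = plain s′ (bases (toℕ s′) j)

      x : ℕ → Vertex
      x = interleave z w

      R : Vertex⁺ → Vertex⁺ → Set
      R = Edge⁺ ψ φ (c ↑ˡ q₂)

      v : ∀ {i j m} → i ≤ h → j ≤ h → m ≤ h → Vertex⁺
      v li lj lm = inj₂ (arrangement li lj lm)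

      vz : ∀ {i j m} (li : i ≤ h) (lj : j ≤ h) (lm : m ≤ h) → R (v li lj lm) (inj₁ (z i))
      vz li lj lm = attached s es (≈-sym (pos-s li lj lm))

      vw : ∀ {i j m} (li : i ≤ h) (lj : j ≤ h) (lm : m ≤ h) → R (v li lj lm) (inj₁ (w j))
      vw li lj lm = attached s′ es′ (≈-sym (pos-s′ li lj lm))

      v-apart : ∀ {i j m i′ j′ m′} (li : i ≤ h) (lj : j ≤ h) (lm : m ≤ h) (li′ : i′ ≤ h) (lj′ : j′ ≤ h) (lm′ : m′ ≤ h) →
                v li lj lm ≈⁺ v li′ lj′ lm′ → m ≡ m′
      v-apart {m = m} {m′ = m′} li lj lm li′ lj′ lm′ e = bases-injective (toℕ u) (plain-apart {u} {bases (toℕ u) m} {bases (toℕ u) m′}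
        (≈-trans (≈-sym (pos-off li lj lm u≢s u≢s′)) (≈-trans (e u) (pos-off li′ lj′ lm′ u≢s u≢s′))) b)
        where
        u≢s : u ≢ s
        u≢s = proj₁ (proj₂ (third 3≤n s s′))
        u≢s′ : u ≢ s′
        u≢s′ = proj₂ (proj₂ (third 3≤n s s′))

      centre : ℕ
      centre = toℕ s * W + toℕ g

      zy : ∀ i → R (inj₁ (z i)) (inj₁ (hub a centre))
      zy i = inj₁ (recolour eψ (down s a g (λ p q → bases (toℕ s) i p + q) (λ p → ℕ.+-monoʳ-< (bases (toℕ s) i p))
               (cong (_+ toℕ g) (bases-off (toℕ s) i (λ e → proj₂ (other (s≤s 1≤ρ) a) (sym e))))))

      z-apart : ∀ {i j} → z i ≈ z j → i ≡ j
      z-apart {i} {j} e = bases-injective (toℕ s) (plain-apart {s} {bases (toℕ s) i} {bases (toℕ s) j} e b)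

      w-apart : ∀ {i j} → w i ≈ w j → i ≡ j
      w-apart {i} {j} e = bases-injective (toℕ s′) (plain-apart {s′} {bases (toℕ s′) i} {bases (toℕ s′) j} e b)

      x-even : ∀ i → x (double i) ≡ z i
      x-even = interleave-even z w

      x-odd : ∀ i → x (suc (double i)) ≡ w i
      x-odd = interleave-odd z w

      x-apart′ : ∀ {k k′} → Parity k → Parity k′ → x k ≈ x k′ → k ≡ k′
      x-apart′ (isDouble i) (isDouble j) e = cong double (z-apart (subst₂ _≈_ (x-even i) (x-even j) e))
      x-apart′ (isSucDouble i) (isSucDouble j) e = cong (suc ∘ double) (w-apart (subst₂ _≈_ (x-odd i) (x-odd j) e))
      x-apart′ (isDouble i) (isSucDouble j) e = ⊥-elim (s≢s′ (inj₂-injective (proj₁ (subst₂ _≈_ (x-even i) (x-odd j) e))))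
      x-apart′ (isSucDouble i) (isDouble j) e = ⊥-elim (s≢s′ (sym (inj₂-injective (proj₁ (subst₂ _≈_ (x-odd i) (x-even j) e)))))

      half-≤ : ∀ {i k} → double i ≤ k → i ≤ k
      half-≤ {zero} _ = z≤n
      half-≤ {suc i} {suc (suc k)} (s≤s (s≤s le)) = s≤s (ℕ.≤-trans (half-≤ le) (ℕ.n≤1+n k))

      half-< : ∀ {i k} → suc (double i) ≤ k → suc i ≤ k
      half-< {i} {suc k} (s≤s le) = s≤s (half-≤ le)

      record Link (k : ℕ) (k≤h : k ≤ h) : Set where
        field
          i j : ℕ
          li  : i ≤ h
          lj  : j ≤ h
          here : R (v li lj k≤h) (inj₁ (x k))
          next : R (v li lj k≤h) (inj₁ (x (suc k)))

      link : ∀ {k} → Parity k → (k<h : k < h) (k≤h : k ≤ h) → Link k k≤h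
      link (isDouble i) k<h k≤h = record { i = i ; j = i ; li = half-≤ k≤h ; lj = half-≤ k≤h
        ; here = subst (R (v (half-≤ k≤h) (half-≤ k≤h) k≤h) ∘ inj₁) (sym (x-even i)) (vz (half-≤ k≤h) (half-≤ k≤h) k≤h)
        ; next = subst (R (v (half-≤ k≤h) (half-≤ k≤h) k≤h) ∘ inj₁) (sym (x-odd i)) (vw (half-≤ k≤h) (half-≤ k≤h) k≤h) }
      link (isSucDouble i) k<h k≤h = record { i = suc i ; j = i ; li = li ; lj = ℕ.<⇒≤ li
        ; here = subst (R (v li (ℕ.<⇒≤ li) k≤h) ∘ inj₁) (sym (x-odd i)) (vw li (ℕ.<⇒≤ li) k≤h)
        ; next = subst (R (v li (ℕ.<⇒≤ li) k≤h) ∘ inj₁) (sym (x-even (suc i))) (vz li (ℕ.<⇒≤ li) k≤h) }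
        where
        li : suc i ≤ h
        li = half-< k≤h

      record Last : Set where
        field
          vertexᴸ : Vertex⁺
          here : R (inj₁ (x h)) vertexᴸ
          next : R vertexᴸ (inj₁ (x 0))
          new  : ∀ {k} (k<h : k < h) {i j} (li : i ≤ h) (lj : j ≤ h) → ¬ v li lj (ℕ.<⇒≤ k<h) ≈⁺ vertexᴸ
          new′ : ∀ {k} (k<h : k < h) {i j} (li : i ≤ h) (lj : j ≤ h) → ¬ vertexᴸ ≈⁺ v li lj (ℕ.<⇒≤ k<h)
          off  : ∀ k → ¬ inj₁ (x k) ≈⁺ vertexᴸ
          off′ : ∀ k → ¬ vertexᴸ ≈⁺ inj₁ (x k)

      sort-x : ∀ {k} → Parity k → ∃ λ p → proj₁ (x k) ≡ inj₂ p
      sort-x (isDouble i) = s , cong proj₁ (x-even i)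
      sort-x (isSucDouble i) = s′ , cong proj₁ (x-odd i)

      last : ∀ {k} → Parity k → k ≡ h → Last
      last (isDouble i) e = record
        { vertexᴸ = inj₁ (hub a centre)
        ; here = subst (λ y → R (inj₁ y) (inj₁ (hub a centre))) (trans (sym (x-even i)) (cong x e)) (zy i)
        ; next = Edge↔-sym (zy 0)
        ; new = λ _ _ _ () ; new′ = λ _ _ _ ()
        ; off = λ k (e , _) → contradiction (trans (sym (proj₂ (sort-x (parity k)))) e) λ ()
        ; off′ = λ k (e , _) → contradiction (trans e (proj₂ (sort-x (parity k)))) λ () }
      last (isSucDouble i) e = record
        { vertexᴸ = v {0} z≤n li ℕ.≤-refl
        ; here = subst (λ y → R (inj₁ y) (v {0} z≤n li ℕ.≤-refl)) (trans (sym (x-odd i)) (cong x e)) (vw {0} z≤n li ℕ.≤-refl)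
        ; next = vz {0} z≤n li ℕ.≤-refl
        ; new = λ k<h lp lq eq → ℕ.<⇒≢ k<h (v-apart lp lq (ℕ.<⇒≤ k<h) z≤n li ℕ.≤-refl eq)
        ; new′ = λ k<h lp lq eq → ℕ.<⇒≢ k<h (sym (v-apart z≤n li ℕ.≤-refl lp lq (ℕ.<⇒≤ k<h) eq))
        ; off = λ k () ; off′ = λ k () }
        where
        li : i ≤ h
        li = ℕ.<⇒≤ (half-< (ℕ.≤-reflexive e))

      the-last : Last
      the-last = last (parity h) refl

      the-link : ∀ {k} (k<h : k < h) → Link k (ℕ.<⇒≤ k<h)
      the-link {k} k<h = link (parity k) k<h (ℕ.<⇒≤ k<h)

      choose : ∀ {k} → Dec (k < h) → Vertex⁺
      choose (yes k<h) = v (Link.li (the-link k<h)) (Link.lj (the-link k<h)) (ℕ.<⇒≤ k<h)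
      choose (no _)    = Last.vertexᴸ the-last

      choose-here : ∀ {k} (d : Dec (k < h)) → k ≤ h → R (inj₁ (x k)) (choose d)
      choose-here (yes k<h) _ = Link.here (the-link k<h)
      choose-here {k} (no ¬lt) le = subst (λ k → R (inj₁ (x k)) (Last.vertexᴸ the-last)) (ℕ.≤-antisym (ℕ.≮⇒≥ ¬lt) le) (Last.here the-last)

      choose-next : ∀ {k} (d : Dec (k < h)) → k < h → R (choose d) (inj₁ (x (suc k)))
      choose-next (yes k<h) _ = Link.next (the-link k<h)
      choose-next (no ¬lt) lt = ⊥-elim (¬lt lt)

      choose-last : (d : Dec (h < h)) → R (choose d) (inj₁ (x 0))
      choose-last (yes lt) = ⊥-elim (ℕ.<-irrefl refl lt)
      choose-last (no _) = Last.next the-last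

      choose-apart : ∀ {k k′} (d : Dec (k < h)) (d′ : Dec (k′ < h)) → k ≤ h → k′ ≤ h → choose d ≈⁺ choose d′ → k ≡ k′
      choose-apart (yes k<h) (yes k′<h) _ _ e = v-apart (Link.li (the-link k<h)) (Link.lj (the-link k<h)) (ℕ.<⇒≤ k<h)
        (Link.li (the-link k′<h)) (Link.lj (the-link k′<h)) (ℕ.<⇒≤ k′<h) e
      choose-apart (yes k<h) (no _) _ _ e = ⊥-elim (Last.new the-last k<h (Link.li (the-link k<h)) (Link.lj (the-link k<h)) e)
      choose-apart (no _) (yes k′<h) _ _ e = ⊥-elim (Last.new′ the-last k′<h (Link.li (the-link k′<h)) (Link.lj (the-link k′<h)) e)
      choose-apart (no ¬p) (no ¬q) le le′ e = trans (ℕ.≤-antisym le (ℕ.≮⇒≥ ¬p)) (ℕ.≤-antisym (ℕ.≮⇒≥ ¬q) le′)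

      choose-off : ∀ {k} k′ (d : Dec (k < h)) → ¬ inj₁ (x k′) ≈⁺ choose d
      choose-off k′ (yes k<h) ()
      choose-off k′ (no _) e = Last.off the-last k′ e

      choose-off′ : ∀ {k} k′ (d : Dec (k < h)) → ¬ choose d ≈⁺ inj₁ (x k′)
      choose-off′ k′ (yes k<h) ()
      choose-off′ k′ (no _) e = Last.off′ the-last k′ e

    position-cycle : CycleCopy {ψ} {φ} {c}
    position-cycle = alternate {ψ} {φ} {c} record
      { x = inj₁ ∘ x ; y = λ k → choose (k <? h)
      ; xy = λ {k} le → choose-here (k <? h) le
      ; yx = λ {k} lt → choose-next (k <? h) lt
      ; yx₀ = choose-last (h <? h)
      ; x-apart = λ {k} {k′} _ _ → x-apart′ (parity k) (parity k′)
      ; y-apart = λ {k} {k′} le le′ → choose-apart (k <? h) (k′ <? h) le le′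
      ; xy-apart = λ {k} {k′} _ _ → choose-off k (k′ <? h)
      ; yx-apart = λ {k} {k′} _ _ → choose-off′ k′ (k <? h) }

module EvenForced {q₂ t ρ n : ℕ} (Q : ℕ) (P : Pattern (suc Q) q₂ t (suc ρ) n) (X : CliqueColouring q₂ t (suc ρ)) (j₀ : Fin q₂)
                  (K : CliqueRamsey q₂ t (suc (suc ρ))) (1≤ρ : 1 ≤ ρ) (3≤n : 3 ≤ n) (h : ℕ) (1≤h : 1 ≤ h) where

  open EvenSystem Q P X j₀
  open Windows Q
  open EvenColours Q P X j₀ K 1≤ρ 3≤n h 1≤h

  module _ (ψ : EdgeType → Fin (q₁ + q₂)) (φ : Fin n → Fin (q₁ + q₂)) where

    CycleFound CliqueFound : Set
    CycleFound = ∃ λ c → Copy (Edge⁺ ψ φ (c ↑ˡ q₂)) _≈⁺_ (cycle (suc L))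
    CliqueFound = ∃ λ j → Copy (Edge⁺ ψ φ (q₁ ↑ʳ j)) _≈⁺_ (complete t)

    IsCycleColour IsCliqueColour : Fin (q₁ + q₂) → Set
    IsCycleColour i = ∃ λ c → i ≡ c ↑ˡ q₂
    IsCliqueColour i = ∃ λ j → i ≡ q₁ ↑ʳ j

    clique-colour : ∀ {i} → ¬ IsCycleColour i → IsCliqueColour i
    clique-colour {i} no-c with classify q₁ i
    ... | inj₁ p = ⊥-elim (no-c p)
    ... | inj₂ p = p

    cycle-colour? : ∀ i → Dec (IsCycleColour i)
    cycle-colour? i = F.any? λ c → i F.≟ c ↑ˡ q₂

    HubCycle LevelCycle NumberCycle : Set
    HubCycle = ∃ λ a → ∃ λ a′ → a Fin.< a′ × IsCycleColour (ψ (hh a a′))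
    LevelCycle = ∃ λ s → ∃ λ s′ → s Fin.< s′ × (∃ λ j → Joined P j s s′) × IsCycleColour (ψ (zz s s′))
    NumberCycle = ∃ λ s → ∃ λ a → ∃ λ g → ∃ λ g′ → g Fin.< g′ × ∃ λ c → ψ (zh s a g) ≡ c ↑ˡ q₂ × ψ (zh s a g′) ≡ c ↑ˡ q₂

    module _ (no-hub : ¬ HubCycle) (no-level : ¬ LevelCycle) where

      hubs-joined : ∀ {a a′} → a ≢ a′ → ∀ y y′ → ∃ λ j → Edge⁺ ψ φ (q₁ ↑ʳ j) (inj₁ (hub a y)) (inj₁ (hub a′ y′))
      hubs-joined {a} {a′} ne y y′ = go (F.<-cmp a a′)
        where
        coloured : ∀ {a a′} → a Fin.< a′ → IsCliqueColour (ψ (hh a a′))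
        coloured {a} {a′} lt = clique-colour λ p → no-hub (a , a′ , lt , p)
        go : Tri (a Fin.< a′) (a ≡ a′) (a′ Fin.< a) → ∃ λ j → Edge⁺ ψ φ (q₁ ↑ʳ j) (inj₁ (hub a y)) (inj₁ (hub a′ y′))
        go (tri< lt _ _) = proj₁ (coloured lt) , inj₁ (recolour (proj₂ (coloured lt)) (hub-edge lt y y′))
        go (tri≈ _ e _) = ⊥-elim (ne e)
        go (tri> _ _ gt) = proj₁ (coloured gt) , inj₂ (recolour (proj₂ (coloured gt)) (hub-edge gt y′ y))

      -- One strand is adjacent to a hub vertex of each role through the numbers in `G`, and hub
      -- vertices of different roles are adjacent anyway. This is a clique-coloured complete graph
      -- on `suc hubs` vertices, one more than `X` colours.
      hub-clique : ∀ s → (∀ a → ∃ λ g → IsCliqueColour (ψ (zh s a g))) → CliqueFound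
      hub-clique s G = cliques {q₁} {ψ = ψ} {φ} K j₀ (irreflexive-edges ψ) vertices joined
        where
        number : Fin hubs → ℕ
        number a = toℕ (proj₁ (G a))
        vertices : Fin (suc hubs) → Vertex⁺
        vertices zero = inj₁ (strand s λ _ q → q)
        vertices (suc a) = inj₁ (hub a (number a))
        edge-down : ∀ a → Edge ψ (q₁ ↑ʳ proj₁ (proj₂ (G a))) (strand s λ _ q → q) (hub a (number a))
        edge-down a = recolour (proj₂ (proj₂ (G a))) (down s a (proj₁ (G a)) (λ _ q → q) (λ _ → id) refl)
        joined : ∀ {u v} → u ≢ v → ∃ λ j → Edge⁺ ψ φ (q₁ ↑ʳ j) (vertices u) (vertices v)
        joined {zero} {zero} ne = ⊥-elim (ne refl)
        joined {zero} {suc a} ne = proj₁ (proj₂ (G a)) , inj₁ (edge-down a)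
        joined {suc a} {zero} ne = proj₁ (proj₂ (G a)) , inj₂ (edge-down a)
        joined {suc a} {suc a′} ne = hubs-joined (ne ∘ cong suc) (number a) (number a′)

      position-clique : CliquePositions P φ → CliqueFound
      position-clique pc = clique-at {q₁} {ψ = ψ} {φ} K j₀ (irreflexive-edges ψ) P pc (blocks (λ _ p → p * q₁) spread) position-edges
        where
        spread : ∀ a → Spread (λ p → p * q₁)
        spread _ p = ℕ.≤-reflexive (ℕ.+-comm (p * q₁) q₁)
        coloured : ∀ {s s′ j} → s Fin.< s′ → Joined P j s s′ → IsCliqueColour (ψ (zz s s′))
        coloured {s} {s′} {j} lt jn = clique-colour λ p → no-level (s , s′ , lt , (j , jn) , p)
        position-edges : ∀ {j s s′} → Joined P j s s′ → ∃ λ j′ → Edge↔ ψ (q₁ ↑ʳ j′) (pos s (blocks (λ _ p → p * q₁) spread)) (pos s′ (blocks (λ _ p → p * q₁) spread))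
        position-edges {j} {s} {s′} jn = go (F.<-cmp s s′)
          where
          go : Tri (s Fin.< s′) (s ≡ s′) (s′ Fin.< s) → ∃ λ j′ → Edge↔ ψ (q₁ ↑ʳ j′) (pos s (blocks (λ _ p → p * q₁) spread)) (pos s′ (blocks (λ _ p → p * q₁) spread))
          go (tri< lt _ _) = proj₁ (coloured lt jn) , inj₁ (recolour (proj₂ (coloured lt jn)) (pos-edge lt jn (λ _ p → p * q₁) spread))
          go (tri≈ _ refl _) = ⊥-elim (irreflexive P jn)
          go (tri> _ _ gt) = proj₁ (coloured gt (symmetric P jn)) ,
            inj₂ (recolour (proj₂ (coloured gt (symmetric P jn))) (pos-edge gt (symmetric P jn) (λ _ p → p * q₁) spread))

      module _ (no-number : ¬ NumberCycle) where

        -- If some role has only cycle colours at `s`, its `q₁` numbers use all of them, in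
        -- particular the repeated colour `c`. Otherwise every role offers a number of clique
        -- colour.
        pair : Repeated P φ → CycleFound ⊎ CliqueFound
        pair (s , s′ , lt , c , es , es′) = role (F.any? λ a → F.all? λ g → cycle-colour? (ψ (zh s a g)))
          where
          role : Dec (∃ λ a → ∀ g → IsCycleColour (ψ (zh s a g))) → CycleFound ⊎ CliqueFound
          role (yes (a , cyc)) = inj₁ (c , position-cycle {ψ} {φ} lt a (proj₁ hit) (trans (proj₂ (cyc (proj₁ hit))) (cong (_↑ˡ q₂) (proj₂ hit))) es es′)
            where
            f : Fin q₁ → Fin q₁
            f g = proj₁ (cyc g)
            f-injective : ∀ {g g′} → f g ≡ f g′ → g ≡ g′
            f-injective {g} {g′} e = go (F.<-cmp g g′)
              where
              go : Tri (g Fin.< g′) (g ≡ g′) (g′ Fin.< g) → g ≡ g′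
              go (tri< lt _ _) = ⊥-elim (no-number (s , a , g , g′ , lt , f g , proj₂ (cyc g) , trans (proj₂ (cyc g′)) (cong (_↑ˡ q₂) (sym e))))
              go (tri≈ _ p _) = p
              go (tri> _ _ gt) = ⊥-elim (no-number (s , a , g′ , g , gt , f g , trans (proj₂ (cyc g′)) (cong (_↑ˡ q₂) (sym e)) , proj₂ (cyc g)))
            hit : ∃ λ g → f g ≡ c
            hit = injective-surjective f f-injective c
          role (no ¬a) = inj₂ (hub-clique s λ a → some a (F.any? λ g → F.any? λ j → ψ (zh s a g) F.≟ q₁ ↑ʳ j))
            where
            some : ∀ a → Dec (∃ λ g → IsCliqueColour (ψ (zh s a g))) → ∃ λ g → IsCliqueColour (ψ (zh s a g))
            some a (yes p) = p
            some a (no ¬g) = ⊥-elim (¬a (a , λ g → cyc g (classify q₁ (ψ (zh s a g)))))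
              where
              cyc : ∀ g → IsCycleColour (ψ (zh s a g)) ⊎ IsCliqueColour (ψ (zh s a g)) → IsCycleColour (ψ (zh s a g))
              cyc g (inj₁ p) = p
              cyc g (inj₂ p) = ⊥-elim (¬g (g , p))

        settled : CycleFound ⊎ CliqueFound
        settled = go (repeated-or-clique P φ)
          where
          go : Repeated P φ ⊎ CliquePositions P φ → CycleFound ⊎ CliqueFound
          go (inj₁ r) = pair r
          go (inj₂ pc) = inj₂ (position-clique pc)

    forced : CycleFound ⊎ CliqueFound
    forced = hub-case (F.any? λ a → F.any? λ a′ → (a F.<? a′) ×-dec cycle-colour? (ψ (hh a a′)))
      where
      number-case : ¬ HubCycle → ¬ LevelCycle → Dec NumberCycle → CycleFound ⊎ CliqueFound
      number-case no-h no-l (yes (s , a , g , g′ , lt , c , e , e′)) = inj₁ (c , number-cycle {ψ} {φ} s a lt e e′)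
      number-case no-h no-l (no no-n) = settled no-h no-l no-n
      level-case : ¬ HubCycle → Dec LevelCycle → CycleFound ⊎ CliqueFound
      level-case no-h (yes (s , s′ , lt , (j , jn) , c , e)) = inj₁ (c , level-cycle {ψ} {φ} lt jn e)
      level-case no-h (no no-l) = number-case no-h no-l (F.any? λ s → F.any? λ a → F.any? λ g → F.any? λ g′ →
        (g F.<? g′) ×-dec F.any? λ c → (ψ (zh s a g) F.≟ c ↑ˡ q₂) ×-dec (ψ (zh s a g′) F.≟ c ↑ˡ q₂))
      hub-case : Dec HubCycle → CycleFound ⊎ CliqueFound
      hub-case (yes (a , a′ , lt , c , e)) = inj₁ (c , hub-cycle {ψ} {φ} lt e)
      hub-case (no no-h) = level-case no-h (F.any? λ s → F.any? λ s′ → (s F.<? s′) ×-dec joined? P s s′ ×-dec cycle-colour? (ψ (zz s s′)))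

-- Graphs without large sets avoiding a complete graph

-- Entries are summed with their multiplicity, which will serve as a weight on vertices.
∑ : ∀ {A : Set} → List A → (A → ℕ) → ℕ
∑ []       f = 0
∑ (x ∷ xs) f = f x + ∑ xs f

∑-++ : ∀ {A : Set} (xs ys : List A) f → ∑ (xs ++ ys) f ≡ ∑ xs f + ∑ ys f
∑-++ [] ys f = refl
∑-++ (x ∷ xs) ys f = trans (cong (f x +_) (∑-++ xs ys f)) (sym (ℕ.+-assoc (f x) _ _))

∑-map : ∀ {A B : Set} (g : A → B) xs f → ∑ (map g xs) f ≡ ∑ xs (f ∘ g)
∑-map g [] f = refl
∑-map g (x ∷ xs) f = cong (f (g x) +_) (∑-map g xs f)

∑-concatMap : ∀ {A B : Set} (g : A → List B) xs f → ∑ (concatMap g xs) f ≡ ∑ xs λ x → ∑ (g x) f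
∑-concatMap g [] f = refl
∑-concatMap g (x ∷ xs) f = trans (∑-++ (g x) (concatMap g xs) f) (cong (∑ (g x) f +_) (∑-concatMap g xs f))

∑-cong : ∀ {A : Set} (xs : List A) {f g} → (∀ x → f x ≡ g x) → ∑ xs f ≡ ∑ xs g
∑-cong [] e = refl
∑-cong (x ∷ xs) e = cong₂ _+_ (e x) (∑-cong xs e)

∑-mono : ∀ {A : Set} (xs : List A) {f g} → (∀ x → f x ≤ g x) → ∑ xs f ≤ ∑ xs g
∑-mono [] le = z≤n
∑-mono (x ∷ xs) le = ℕ.+-mono-≤ (le x) (∑-mono xs le)

∑-+ : ∀ {A : Set} (xs : List A) f g → ∑ xs (λ x → f x + g x) ≡ ∑ xs f + ∑ xs g
∑-+ [] f g = refl
∑-+ (x ∷ xs) f g rewrite ∑-+ xs f g = solve 4 (λ a b c d → (a :+ b) :+ (c :+ d) := (a :+ c) :+ (b :+ d)) refl (f x) (g x) (∑ xs f) (∑ xs g)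
  where open +-*-Solver

∑-* : ∀ {A : Set} c (xs : List A) f → ∑ xs (λ x → c * f x) ≡ c * ∑ xs f
∑-* c [] f = sym (ℕ.*-zeroʳ c)
∑-* c (x ∷ xs) f = trans (cong (c * f x +_) (∑-* c xs f)) (sym (ℕ.*-distribˡ-+ c (f x) _))

∑-const : ∀ {A : Set} (xs : List A) c → ∑ xs (λ _ → c) ≡ length xs * c
∑-const [] c = refl
∑-const (x ∷ xs) c = cong (c +_) (∑-const xs c)

∑-zero : ∀ {A : Set} (xs : List A) → ∑ xs (λ _ → 0) ≡ 0
∑-zero xs = trans (∑-const xs 0) (ℕ.*-zeroʳ (length xs))

∑-one : ∀ {A : Set} (xs : List A) → ∑ xs (λ _ → 1) ≡ length xs
∑-one xs = trans (∑-const xs 1) (ℕ.*-identityʳ _)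

∑-swap : ∀ {A B : Set} (xs : List A) (ys : List B) (f : A → B → ℕ) → ∑ xs (λ x → ∑ ys (f x)) ≡ ∑ ys λ y → ∑ xs λ x → f x y
∑-swap [] ys f = sym (∑-zero ys)
∑-swap (x ∷ xs) ys f = trans (cong (∑ ys (f x) +_) (∑-swap xs ys f)) (sym (∑-+ ys (f x) _))

copies : ∀ {A : Set} → ℕ → List A → List A
copies zero    xs = []
copies (suc n) xs = xs ++ copies n xs

∑-copies : ∀ {A : Set} n (xs : List A) f → ∑ (copies n xs) f ≡ n * ∑ xs f
∑-copies zero xs f = refl
∑-copies (suc n) xs f = trans (∑-++ xs (copies n xs) f) (cong (∑ xs f +_) (∑-copies n xs f))

∑-tabulate : ∀ {A : Set} n (g : Fin n → A) f → ∑ (tabulate g) f ≡ ∑ (allFin n) (f ∘ g)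
∑-tabulate zero g f = refl
∑-tabulate (suc n) g f = cong (f (g zero) +_) (trans (∑-tabulate n (g ∘ suc) f) (sym (∑-tabulate n suc (f ∘ g))))

∑-allFin : ∀ n f → ∑ (allFin (suc n)) f ≡ f zero + ∑ (allFin n) (f ∘ suc)
∑-allFin n f = cong (f zero +_) (∑-tabulate n suc f)

length-allFin : ∀ n → ∑ (allFin n) (λ _ → 1) ≡ n
length-allFin zero = refl
length-allFin (suc n) = trans (∑-allFin n λ _ → 1) (cong suc (length-allFin n))

∑-allFin-const : ∀ n c → ∑ (allFin n) (λ _ → c) ≡ n * c
∑-allFin-const n c = trans (∑-cong (allFin n) λ _ → sym (ℕ.*-identityʳ c)) (trans (∑-* c (allFin n) (λ _ → 1))
  (trans (cong (c *_) (length-allFin n)) (ℕ.*-comm c n)))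

[_] : Bool → ℕ
[ b ] = if b then 1 else 0

-- Counting the choices that avoid prescribed entries

vectors : ∀ L d → List (Vec (Fin L) d)
vectors L zero    = [] ∷ []
vectors L (suc d) = concatMap (λ l → map (l ∷_) (vectors L d)) (allFin L)

∑-vectors : ∀ L d f → ∑ (vectors L (suc d)) f ≡ ∑ (allFin L) λ l → ∑ (vectors L d) λ κ → f (l ∷ κ)
∑-vectors L d f = trans (∑-concatMap (λ l → map (l ∷_) (vectors L d)) (allFin L) f) (∑-cong (allFin L) λ l → ∑-map (l ∷_) (vectors L d) f)

∑-vectors-one : ∀ L d → ∑ (vectors L d) (λ _ → 1) ≡ L ^ d
∑-vectors-one L zero = refl
∑-vectors-one L (suc d) = trans (∑-vectors L d λ _ → 1) (trans (∑-allFin-const L _) (cong (L *_) (∑-vectors-one L d)))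

module _ {L : ℕ} where

  misses : Maybe (Fin L) → Fin L → ℕ
  misses nothing l = 1
  misses (just l′) l with l F.≟ l′
  ... | yes _ = 0
  ... | no _ = 1

  avoids : ∀ {d} → (Fin d → Maybe (Fin L)) → Vec (Fin L) d → ℕ
  avoids ch [] = 1
  avoids ch (l ∷ κ) = misses (ch zero) l * avoids (ch ∘ suc) κ

  avoids-cases : ∀ {d} (ch : Fin d → Maybe (Fin L)) κ → avoids ch κ ≡ 1 ⊎ ∃ λ j → ch j ≡ just (Vec.lookup κ j)
  avoids-cases ch [] = inj₁ refl
  avoids-cases ch (l ∷ κ) with ch zero in eq | avoids-cases (ch ∘ suc) κ
  ... | _ | inj₂ (j , e) = inj₂ (suc j , e)
  ... | nothing | inj₁ e = inj₁ (trans (ℕ.+-identityʳ _) e)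
  ... | just l′ | inj₁ e with l F.≟ l′
  ...   | yes refl = inj₂ (zero , eq)
  ...   | no _ = inj₁ (trans (ℕ.+-identityʳ _) e)

  defined : Maybe (Fin L) → ℕ
  defined nothing  = 0
  defined (just _) = 1

misses-suc : ∀ {L} (l′ l : Fin L) → misses (just (suc l′)) (suc l) ≡ misses (just l′) l
misses-suc l′ l with l F.≟ l′
... | yes refl = refl
... | no _ = refl

∑-misses : ∀ {L} (l′ : Fin L) → ∑ (allFin L) (misses (just l′)) ≡ pred L
∑-misses {suc L} zero = trans (∑-allFin L (misses (just zero))) (trans (∑-allFin-const L 1) (ℕ.*-identityʳ L))
∑-misses {suc (suc L)} (suc l′) = trans (∑-allFin (suc L) (misses (just (suc l′))))
  (cong suc (trans (∑-cong (allFin (suc L)) (misses-suc l′)) (∑-misses l′)))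

-- The indicator `avoids` is a product over the coordinates, and each prescribed entry leaves
-- `pred L` of `L` values. The factor `L ^ R` clears the denominator of the resulting proportion.
∑-avoids : ∀ L d (ch : Fin d → Maybe (Fin L)) → let R = ∑ (allFin d) (defined ∘ ch) in
           ∑ (vectors L d) (avoids ch) * L ^ R ≡ L ^ d * pred L ^ R
∑-avoids L zero ch = refl
∑-avoids L (suc d) ch = trans (cong₂ (λ s R → s * L ^ R) product (∑-allFin d (defined ∘ ch)))
  (trans (step (ch zero)) (cong (λ R → L ^ suc d * pred L ^ R) (sym (∑-allFin d (defined ∘ ch)))))
  where
  S = ∑ (vectors L d) (avoids (ch ∘ suc))
  R = ∑ (allFin d) (defined ∘ ch ∘ suc)
  product : ∑ (vectors L (suc d)) (avoids ch) ≡ ∑ (allFin L) (misses (ch zero)) * S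
  product = trans (∑-vectors L d (avoids ch)) (trans (∑-cong (allFin L) λ l → trans (∑-* (misses (ch zero) l) (vectors L d) (avoids (ch ∘ suc))) (ℕ.*-comm _ S))
    (trans (∑-* S (allFin L) (misses (ch zero))) (ℕ.*-comm S _)))
  open +-*-Solver
  step : ∀ m → ∑ (allFin L) (misses m) * S * L ^ (defined m + R) ≡ L ^ suc d * pred L ^ (defined m + R)
  step nothing = trans (cong (λ z → z * S * L ^ R) (length-allFin L))
    (trans (ℕ.*-assoc L S (L ^ R)) (trans (cong (L *_) (∑-avoids L d (ch ∘ suc))) (sym (ℕ.*-assoc L (L ^ d) _))))
  step (just l) = trans (cong (λ z → z * S * (L * L ^ R)) (∑-misses l))
    (trans (solve 4 (λ p s l x → (p :* s) :* (l :* x) := (p :* l) :* (s :* x)) refl (pred L) S L (L ^ R))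
    (trans (cong (pred L * L *_) (∑-avoids L d (ch ∘ suc)))
      (solve 4 (λ p l x y → (p :* l) :* (x :* y) := (l :* x) :* (p :* y)) refl (pred L) L (L ^ d) (pred L ^ R))))

-- Bernoulli's inequality (1 + 1/p)^g ≥ 1 + g/p, multiplied by p^(g+1) so that it makes sense for
-- `p = 0` too.
bernoulli : ∀ p g → (p + g) * p ^ g ≤ p * suc p ^ g
bernoulli p zero = ℕ.≤-reflexive (cong (_* 1) (ℕ.+-identityʳ p))
bernoulli p (suc g) = ℕ.≤-trans (ℕ.≤-trans (ℕ.m≤m+n _ (g * p ^ g))
    (ℕ.≤-reflexive (solve 3 (λ p g x → (p :+ (con 1 :+ g)) :* (p :* x) :+ g :* x := (con 1 :+ p) :* ((p :+ g) :* x)) refl p g (p ^ g))))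
  (ℕ.≤-trans (ℕ.*-monoʳ-≤ (suc p) (bernoulli p g))
    (ℕ.≤-reflexive (solve 2 (λ p x → (con 1 :+ p) :* (p :* x) := p :* ((con 1 :+ p) :* x)) refl p (suc p ^ g))))
  where open +-*-Solver

power-gap : ∀ E p {g} → suc (p * E) ≤ g → E * p ^ g ≤ suc p ^ g
power-gap E zero {suc g} _ = ℕ.≤-trans (ℕ.≤-reflexive (ℕ.*-zeroʳ E)) z≤n
power-gap E p@(suc _) {g} le = ℕ.*-cancelˡ-≤ p (ℕ.≤-trans (ℕ.≤-trans (ℕ.≤-reflexive (sym (ℕ.*-assoc p E (p ^ g))))
  (ℕ.*-monoˡ-≤ (p ^ g) (ℕ.≤-trans (ℕ.≤-trans (ℕ.n≤1+n _) le) (ℕ.m≤n+m g p)))) (bernoulli p g))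

-- The proportion of avoiding vectors is (1 - 1/L)^R, which Bernoulli brings below 1/E. The
-- additional one in the bound on R matters for `L = 1`, where a single prescribed entry is
-- required.
few-avoid : ∀ E L d (ch : Fin d → Maybe (Fin L)) → suc (pred L * E) ≤ ∑ (allFin d) (defined ∘ ch) →
            E * ∑ (vectors L d) (avoids ch) ≤ L ^ d
few-avoid E zero (suc d) ch le = ⊥-elim (absurd (ch zero) (ℕ.≤-trans le (ℕ.≤-trans (∑-mono (allFin (suc d)) {defined ∘ ch} {λ _ → 0} λ j → none (ch j)) (ℕ.≤-reflexive (∑-zero (allFin (suc d)))))))
  where
  none : (m : Maybe (Fin 0)) → defined m ≤ 0
  none nothing = z≤n
  absurd : Maybe (Fin 0) → ¬ 1 ≤ 0
  absurd _ ()
few-avoid E (suc p) d ch le = ℕ.*-cancelʳ-≤ _ _ (suc p ^ R) {{ℕ.m^n≢0 (suc p) R}} (ℕ.≤-trans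
  (ℕ.≤-reflexive (trans (ℕ.*-assoc E _ _) (trans (cong (E *_) (∑-avoids (suc p) d ch))
    (solve 3 (λ e l x → e :* (l :* x) := l :* (e :* x)) refl E (suc p ^ d) (p ^ R)))))
  (ℕ.*-monoʳ-≤ (suc p ^ d) (power-gap E p le)))
  where
  R = ∑ (allFin d) (defined ∘ ch)
  open +-*-Solver

finite-≟ : ∀ {A} → Finite A → (x y : A) → Dec (x ≡ y)
finite-≟ F x y = map′ (λ e → trans (sym (element-index F x)) (trans (cong (element F) e) (element-index F y))) (cong (index F)) (index F x F.≟ index F y)

finite-Vec : ∀ {A} → Finite A → ∀ d → Finite (Vec A d)
finite-Vec F zero = record { card = 1 ; index = λ _ → zero ; element = λ _ → [] ; element-index = λ { [] → refl } ; index-element = λ { zero → refl } }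
finite-Vec F (suc d) = record
  { card = card P ; index = λ { (x ∷ κ) → index P (x , κ) } ; element = λ i → cons (element P i)
  ; element-index = λ { (x ∷ κ) → cong cons (element-index P (x , κ)) } ; index-element = λ i → index-element P i }
  where
  P = finite-× F (finite-Vec F d)
  cons : _ → _
  cons (x , κ) = x ∷ κ

-- A coloured graph with a weight on its vertices, namely the multiplicity in vs.
record Structure (q t : ℕ) : Set₁ where
  field
    V         : Set
    finite    : Finite V
    vs        : List V
    nonempty  : 1 ≤ length vs
    E         : Fin q → V → V → Set
    E?        : ∀ u v → Dec (∃ λ c → E c u v)
    E-sym     : ∀ {c} u v → E c u v → E c v u
    E-irrefl  : ∀ {c} v → ¬ E c v v
    E-free    : ∀ c (f : Fin t → V) → ¬ (∀ {u v} → u ≢ v → E c (f u) (f v))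

  count : (V → Bool) → ℕ
  count U = ∑ vs λ v → [ U v ]

  weight : ℕ
  weight = length vs

open Structure

-- Copies of `K_r` coloured by `χ`. As `E` may hold in several colours, `faithful` excludes every
-- other colour on a line; through it a monochromatic clique meeting a line becomes a monochromatic
-- clique of the colouring.
record Lines {q t r : ℕ} (S : Structure q t) (χ : Fin r → Fin r → Fin q) : Set₁ where
  field
    Line     : Set
    lines    : Finite Line
    at       : Line → Fin r → V S
    joined   : ∀ l {a b} → a ≢ b → E S (χ a b) (at l a) (at l b)
    faithful : ∀ l {a b c} → E S c (at l a) (at l b) → χ a b ≡ c

  apart : ∀ l {a b} → at l a ≡ at l b → a ≡ b
  apart l {a} {b} e with a F.≟ b
  ... | yes p = p
  ... | no ne = ⊥-elim (E-irrefl S (at l a) (subst (E S (χ a b) (at l a)) (sym e) (joined l ne)))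

  Hit : (V S → Bool) → Set
  Hit U = ∃ λ l → ∀ a → U (at l a) ≡ true

  hit? : ∀ U → Dec (Hit U)
  hit? U = map′ (λ (i , p) → element lines i , p)
    (λ (l , p) → index lines l , subst (λ l → ∀ a → U (at l a) ≡ true) (sym (element-index lines l)) p)
    (F.any? λ i → F.all? λ a → U (at (element lines i) a) 𝔹.≟ true)

  Thin : ℕ → ℕ → Set
  Thin m n = ∀ U → ¬ Hit U → m * count S U ≤ n * weight S

open Lines

union : ∀ {q t r} {S : Structure q t} {χ : Fin r → Fin r → Fin q} → Lines S χ → Lines S χ → Lines S χ
union A B = record { Line = Line A ⊎ Line B ; lines = finite-⊎ (lines A) (lines B)
  ; at = λ { (inj₁ l) → at A l ; (inj₂ l) → at B l }
  ; joined = λ { (inj₁ l) → joined A l ; (inj₂ l) → joined B l }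
  ; faithful = λ { (inj₁ l) → faithful A l ; (inj₂ l) → faithful B l } }

-- One row of d copies of S for every vertex h of S, and one further copy of S for every choice κ of a line in each
-- of d copies; the vertex h of the copy κ is joined to the j-th line of κ in the j-th copy of the row h.
module Amalgam {q t r : ℕ} (X : CliqueColouring q t (suc r)) (S : Structure q t)
               (G : Lines S (λ a b → χ X (suc a) (suc b))) (d : ℕ) (1≤d : 1 ≤ d) (1≤L : 1 ≤ card (lines G)) where

  L W Λ T : ℕ
  L = card (lines G)
  W = weight S
  Λ = L ^ d
  T = Λ * (d * W) * W

  Choice : Set
  Choice = Vec (Fin L) d

  V′ : Set
  V′ = (V S × (Fin d × V S)) ⊎ (Choice × V S)

  line : Choice → Fin d → Line G
  line κ j = element (lines G) (Vec.lookup κ j)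

  OnLine : Fin q → V S → Choice → Fin d → V S → V S → Set
  OnLine c h κ j h′ x = h ≡ h′ × ∃ λ a → x ≡ at G (line κ j) a × χ X zero (suc a) ≡ c

  E′ : Fin q → V′ → V′ → Set
  E′ c (inj₁ (h , j , x)) (inj₁ (h′ , j′ , x′)) = h ≡ h′ × j ≡ j′ × E S c x x′
  E′ c (inj₂ (κ , h)) (inj₂ (κ′ , h′)) = κ ≡ κ′ × E S c h h′
  E′ c (inj₁ (h′ , j , x)) (inj₂ (κ , h)) = OnLine c h κ j h′ x
  E′ c (inj₂ (κ , h)) (inj₁ (h′ , j , x)) = OnLine c h κ j h′ x

  E′-sym : ∀ {c} u v → E′ c u v → E′ c v u
  E′-sym (inj₁ (h , j , x)) (inj₁ (h′ , j′ , x′)) (e , e′ , p) = sym e , sym e′ , E-sym S x x′ p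
  E′-sym (inj₂ (κ , h)) (inj₂ (κ′ , h′)) (e , p) = sym e , E-sym S h h′ p
  E′-sym (inj₁ _) (inj₂ _) p = p
  E′-sym (inj₂ _) (inj₁ _) p = p

  E′-irrefl : ∀ {c} v → ¬ E′ c v v
  E′-irrefl (inj₁ (h , j , x)) (_ , _ , p) = E-irrefl S x p
  E′-irrefl (inj₂ (κ , h)) (_ , p) = E-irrefl S h p

  _≟_ : (u v : V S) → Dec (u ≡ v)
  _≟_ = finite-≟ (finite S)

  onLine? : ∀ h κ j h′ x → Dec (∃ λ c → OnLine c h κ j h′ x)
  onLine? h κ j h′ x = map′ (λ (e , a , p) → _ , e , a , p , refl) (λ (_ , e , a , p , _) → e , a , p)
    ((h ≟ h′) ×-dec F.any? λ a → x ≟ at G (line κ j) a)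

  E′? : ∀ u v → Dec (∃ λ c → E′ c u v)
  E′? (inj₁ (h , j , x)) (inj₁ (h′ , j′ , x′)) = map′ (λ (e , e′ , c , p) → c , e , e′ , p) (λ (c , e , e′ , p) → e , e′ , c , p)
    ((h ≟ h′) ×-dec (j F.≟ j′) ×-dec E? S x x′)
  E′? (inj₂ (κ , h)) (inj₂ (κ′ , h′)) = map′ (λ (e , c , p) → c , e , p) (λ (c , e , p) → e , c , p)
    (finite-≟ (finite-Vec (finite-Fin L) d) κ κ′ ×-dec E? S h h′)
  E′? (inj₁ (h′ , j , x)) (inj₂ (κ , h)) = onLine? h κ j h′ x
  E′? (inj₂ (κ , h)) (inj₁ (h′ , j , x)) = onLine? h κ j h′ x

  InRow InCopy : V′ → Set
  InRow v = ∃ λ h → ∃ λ j → ∃ λ x → v ≡ inj₁ (h , j , x)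
  InCopy v = ∃ λ κ → ∃ λ h → v ≡ inj₂ (κ , h)

  inRow? : ∀ v → Dec (InRow v)
  inRow? (inj₁ (h , j , x)) = yes (h , j , x , refl)
  inRow? (inj₂ _) = no λ { (_ , _ , _ , ()) }

  inCopy : ∀ {v} → ¬ InRow v → InCopy v
  inCopy {inj₁ (h , j , x)} ¬p = ⊥-elim (¬p (h , j , x , refl))
  inCopy {inj₂ (κ , h)} _ = κ , h , refl

  -- A clique meeting both parts has a single vertex in the copies, and its other vertices lie on one line.
  E′-free : ∀ c (f : Fin t → V′) → ¬ (∀ {u v} → u ≢ v → E′ c (f u) (f v))
  E′-free c f K = split (F.any? (inRow? ∘ f)) (F.all? (inRow? ∘ f))
    where
    rows : (∀ u → InRow (f u)) → ⊥
    rows p = E-free S c (λ u → proj₁ (proj₂ (proj₂ (p u)))) λ {u} {v} ne → proj₂ (proj₂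
      (subst₂ (E′ c) (proj₂ (proj₂ (proj₂ (p u)))) (proj₂ (proj₂ (proj₂ (p v)))) (K ne)))
    copiesOnly : (∀ u → InCopy (f u)) → ⊥
    copiesOnly p = E-free S c (λ u → proj₁ (proj₂ (p u))) λ {u} {v} ne → proj₂ (subst₂ (E′ c) (proj₂ (proj₂ (p u))) (proj₂ (proj₂ (p v))) (K ne))
    mixed : ∀ {u₀ w h₀ j₀ x₀ κ h} → f u₀ ≡ inj₁ (h₀ , j₀ , x₀) → f w ≡ inj₂ (κ , h) → ⊥
    mixed {u₀} {w} {h₀} {j₀} {x₀} {κ} {h} e₀ ew = χ-free X c (proj₁ ∘ place) λ {u} {v} ne → coloured (proj₂ (place u)) (proj₂ (place v)) ne
      where
      data Place (u : Fin t) : Fin (suc r) → Set where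
        top  : u ≡ w → Place u zero
        side : ∀ a {h′ j} → f u ≡ inj₁ (h′ , j , at G (line κ j) a) → χ X zero (suc a) ≡ c → Place u (suc a)
      differ : ∀ {u v x y} → f u ≡ inj₁ x → f v ≡ inj₂ y → u ≢ v
      differ e e′ refl with trans (sym e) e′
      ... | ()
      place′ : ∀ u → (v : V′) → f u ≡ v → ∃ (Place u)
      place′ u (inj₁ (h′ , j , x)) e with subst₂ (E′ c) e ew (K (differ e ew))
      ... | refl , a , refl , eq = suc a , side a e eq
      place′ u (inj₂ (κ′ , h′)) e with u F.≟ w
      ... | yes p = zero , top p
      ... | no ne with subst₂ (E′ c) e ew (K ne) | subst₂ (E′ c) e₀ e (K (differ e₀ e)) | subst₂ (E′ c) e₀ ew (K (differ e₀ ew))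
      ...   | refl , p | refl , _ | refl , _ = ⊥-elim (E-irrefl S h′ p)
      place : ∀ u → ∃ (Place u)
      place u = place′ u (f u) refl
      coloured : ∀ {u v a b} → Place u a → Place v b → u ≢ v → a ≢ b × χ X a b ≡ c
      coloured (top refl) (top refl) ne = ⊥-elim (ne refl)
      coloured (top refl) (side a _ e) ne = (λ ()) , e
      coloured (side a _ e) (top refl) ne = (λ ()) , trans (χ-sym X (suc a) zero) e
      coloured (side a e _) (side b e′ _) ne with subst₂ (E′ c) e e′ (K ne)
      ... | refl , refl , p = (λ { refl → E-irrefl S _ p }) , faithful G _ p
    split : Dec (∃ λ u → InRow (f u)) → Dec (∀ u → InRow (f u)) → ⊥
    split _ (yes all) = rows all
    split (no none) _ = copiesOnly λ u → inCopy λ p → none (u , p)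
    split (yes (u₀ , _ , _ , _ , e₀)) (no ¬all) with F.¬∀⟶∃¬ t (InRow ∘ f) (inRow? ∘ f) ¬all
    ... | w , ¬p = mixed e₀ (proj₂ (proj₂ (inCopy ¬p)))

  -- Unrepeated, the rows have weight `W * d * W` and the copies have weight `Λ * W`; the
  -- multiplicities give each part the weight `T`, hence half of the total.
  rowPart copyPart vs′ : List V′
  rowPart = concatMap (λ h → concatMap (λ j → map (λ x → inj₁ (h , j , x)) (vs S)) (allFin d)) (vs S)
  copyPart = concatMap (λ κ → map (λ h → inj₂ (κ , h)) (vs S)) (vectors L d)
  vs′ = copies Λ rowPart ++ copies (d * W) copyPart

  ∑-vs′ : ∀ f → ∑ vs′ f ≡ Λ * ∑ (vs S) (λ h → ∑ (allFin d) λ j → ∑ (vs S) λ x → f (inj₁ (h , j , x))) +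
                          d * W * ∑ (vectors L d) (λ κ → ∑ (vs S) λ h → f (inj₂ (κ , h)))
  ∑-vs′ f = trans (∑-++ (copies Λ rowPart) _ f) (cong₂ _+_
    (trans (∑-copies Λ rowPart f) (cong (Λ *_) (trans (∑-concatMap _ (vs S) f) (∑-cong (vs S) λ h →
      trans (∑-concatMap _ (allFin d) f) (∑-cong (allFin d) λ j → ∑-map _ (vs S) f)))))
    (trans (∑-copies (d * W) copyPart f) (cong (d * W *_) (trans (∑-concatMap _ (vectors L d) f) (∑-cong (vectors L d) λ κ → ∑-map _ (vs S) f)))))

  rows-const : ∀ n → ∑ (vs S) (λ _ → ∑ (allFin d) λ _ → n) ≡ W * (d * n)
  rows-const n = trans (∑-const (vs S) _) (cong (W *_) (∑-allFin-const d n))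

  vectors-const : ∀ n → ∑ (vectors L d) (λ _ → n) ≡ Λ * n
  vectors-const n = trans (∑-cong (vectors L d) λ _ → sym (ℕ.*-identityʳ n)) (trans (∑-* n (vectors L d) (λ _ → 1))
    (trans (cong (n *_) (∑-vectors-one L d)) (ℕ.*-comm n Λ)))

  weight′ : length vs′ ≡ T + T
  weight′ = trans (sym (∑-one vs′)) (trans (∑-vs′ λ _ → 1) (cong₂ _+_
    (trans (cong (Λ *_) (trans (∑-cong (vs S) λ h → ∑-cong (allFin d) λ j → ∑-one (vs S)) (rows-const W)))
      (solve 3 (λ l d w → l :* (w :* (d :* w)) := l :* (d :* w) :* w) refl Λ d W))
    (trans (cong (d * W *_) (trans (∑-cong (vectors L d) λ κ → ∑-one (vs S)) (vectors-const W)))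
      (solve 3 (λ l d w → (d :* w) :* (l :* w) := l :* (d :* w) :* w) refl Λ d W))))
    where open +-*-Solver

  1≤T : 1 ≤ T
  1≤T = ℕ.*-mono-≤ (ℕ.*-mono-≤ (ℕ.m^n>0 L {{>-nonZero 1≤L}} d) (ℕ.*-mono-≤ 1≤d (nonempty S))) (nonempty S)

  S′ : Structure q t
  S′ = record { V = V′ ; finite = finite-⊎ (finite-× (finite S) (finite-× (finite-Fin d) (finite S))) (finite-× (finite-Vec (finite-Fin L) d) (finite S))
    ; vs = vs′ ; nonempty = ℕ.≤-trans (ℕ.≤-trans 1≤T (ℕ.m≤m+n T T)) (ℕ.≤-reflexive (sym weight′))
    ; E = E′ ; E? = E′? ; E-sym = E′-sym ; E-irrefl = E′-irrefl ; E-free = E′-free }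

  copied : ∀ {s} {ξ : Fin s → Fin s → Fin q} → Lines S ξ → Lines S′ ξ
  copied A = record { Line = (V S × (Fin d × Line A)) ⊎ (Choice × Line A)
    ; lines = finite-⊎ (finite-× (finite S) (finite-× (finite-Fin d) (lines A))) (finite-× (finite-Vec (finite-Fin L) d) (lines A))
    ; at = λ { (inj₁ (h , j , l)) a → inj₁ (h , j , at A l a) ; (inj₂ (κ , l)) a → inj₂ (κ , at A l a) }
    ; joined = λ { (inj₁ (h , j , l)) ne → refl , refl , joined A l ne ; (inj₂ (κ , l)) ne → refl , joined A l ne }
    ; faithful = λ { (inj₁ (h , j , l)) (_ , _ , p) → faithful A l p ; (inj₂ (κ , l)) (_ , p) → faithful A l p } }

  new : Lines S′ (χ X)
  new = record { Line = Choice × (V S × Fin d)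
    ; lines = finite-× (finite-Vec (finite-Fin L) d) (finite-× (finite S) (finite-Fin d))
    ; at = point
    ; joined = λ { (κ , h , j) {a} {b} → jn κ h j a b }
    ; faithful = λ { (κ , h , j) {a} {b} → ff κ h j a b } }
    where
    point : Choice × (V S × Fin d) → Fin (suc r) → V′
    point (κ , h , j) zero = inj₂ (κ , h)
    point (κ , h , j) (suc a) = inj₁ (h , j , at G (line κ j) a)
    jn : ∀ κ h j a b → a ≢ b → E′ (χ X a b) (point (κ , h , j) a) (point (κ , h , j) b)
    jn κ h j zero zero ne = ⊥-elim (ne refl)
    jn κ h j zero (suc b) ne = refl , b , refl , refl
    jn κ h j (suc a) zero ne = refl , a , refl , χ-sym X zero (suc a)
    jn κ h j (suc a) (suc b) ne = refl , refl , joined G (line κ j) (ne ∘ cong suc)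
    ff : ∀ κ h j a b {c} → E′ c (point (κ , h , j) a) (point (κ , h , j) b) → χ X a b ≡ c
    ff κ h j zero zero (_ , p) = ⊥-elim (E-irrefl S h p)
    ff κ h j zero (suc b) (_ , a , e , eq) with apart G (line κ j) e
    ... | refl = eq
    ff κ h j (suc a) zero (_ , b , e , eq) with apart G (line κ j) e
    ... | refl = trans (χ-sym X (suc a) zero) eq
    ff κ h j (suc a) (suc b) (_ , _ , p) = faithful G (line κ j) p

  row : (V′ → Bool) → V S → Fin d → V S → Bool
  row U h j x = U (inj₁ (h , j , x))

  copy-of : (V′ → Bool) → Choice → V S → Bool
  copy-of U κ h = U (inj₂ (κ , h))

  count′ : ∀ U → count S′ U ≡ Λ * ∑ (vs S) (λ h → ∑ (allFin d) λ j → count S (row U h j)) + d * W * ∑ (vectors L d) λ κ → count S (copy-of U κ)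
  count′ U = ∑-vs′ λ v → [ U v ]

  -- Each part is a disjoint union of copies of `S`, and the trace of `U` on every copy contains no
  -- line of `A`.
  copied-thin : ∀ {s} {ξ : Fin s → Fin s → Fin q} (A : Lines S ξ) {m n} → Thin A m n → Thin (copied A) m n
  copied-thin A {m} {n} thin U ¬hit = begin
    m * count S′ U                                    ≡⟨ cong (m *_) (count′ U) ⟩
    m * (Λ * Xs + d * W * Ys)                         ≡⟨ solve 5 (λ m l x e y → m :* (l :* x :+ e :* y) := l :* (m :* x) :+ e :* (m :* y)) refl m Λ Xs (d * W) Ys ⟩
    Λ * (m * Xs) + d * W * (m * Ys)                   ≤⟨ ℕ.+-mono-≤ (ℕ.*-monoʳ-≤ Λ rowsBound) (ℕ.*-monoʳ-≤ (d * W) copiesBound) ⟩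
    Λ * (W * (d * (n * W))) + d * W * (Λ * (n * W))   ≡⟨ solve 4 (λ l w d n → l :* (w :* (d :* (n :* w))) :+ d :* w :* (l :* (n :* w)) := n :* (l :* (d :* w) :* w :+ l :* (d :* w) :* w)) refl Λ W d n ⟩
    n * (T + T)                                       ≡⟨ cong (n *_) (sym weight′) ⟩
    n * length vs′ ∎
    where
    open ℕ.≤-Reasoning
    open +-*-Solver
    Xs = ∑ (vs S) (λ h → ∑ (allFin d) λ j → count S (row U h j))
    Ys = ∑ (vectors L d) λ κ → count S (copy-of U κ)
    rowsBound : m * Xs ≤ W * (d * (n * W))
    rowsBound = begin
      m * Xs                                                             ≡⟨ sym (∑-* m (vs S) _) ⟩
      ∑ (vs S) (λ h → m * ∑ (allFin d) λ j → count S (row U h j))        ≡⟨ ∑-cong (vs S) (λ h → sym (∑-* m (allFin d) _)) ⟩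
      ∑ (vs S) (λ h → ∑ (allFin d) λ j → m * count S (row U h j))        ≤⟨ ∑-mono (vs S) (λ h → ∑-mono (allFin d) λ j →
                                                                              thin (row U h j) λ (l , p) → ¬hit (inj₁ (h , j , l) , p)) ⟩
      ∑ (vs S) (λ h → ∑ (allFin d) λ j → n * W)                          ≡⟨ rows-const (n * W) ⟩
      W * (d * (n * W)) ∎
    copiesBound : m * Ys ≤ Λ * (n * W)
    copiesBound = begin
      m * Ys                                              ≡⟨ sym (∑-* m (vectors L d) _) ⟩
      ∑ (vectors L d) (λ κ → m * count S (copy-of U κ))   ≤⟨ ∑-mono (vectors L d) (λ κ → thin (copy-of U κ) λ (l , p) → ¬hit (inj₂ (κ , l) , p)) ⟩
      ∑ (vectors L d) (λ _ → n * W)                       ≡⟨ vectors-const (n * W) ⟩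
      Λ * (n * W) ∎

-- One step of the density decrease

open Structure
open Lines

[_]≤1 : ∀ b → [ b ] ≤ 1
[ true ]≤1 = ℕ.≤-refl
[ false ]≤1 = z≤n

count≤weight : ∀ {q t} (S : Structure q t) U → count S U ≤ weight S
count≤weight S U = ℕ.≤-trans (∑-mono (vs S) {g = λ _ → 1} λ v → [ U v ]≤1) (ℕ.≤-reflexive (∑-one (vs S)))

-- The number 2/(J+1) exceeds 2/J - 2/J² by exactly 2/(J²(J+1)). This is the origin of `E₀`: the gap
-- is 2/E₀ and absorbs the error (1 + 1/J)/E₀. The second summand on the left is what remains of it.
budget : ∀ i {J E₀} → J ≡ 2 + i → E₀ ≡ J * J * suc J → ∀ T →
         suc J * (T * (2 * J * E₀ + 2 * E₀ * i + 2 * J * suc J)) + T * (2 * J * suc J * suc i) ≡ E₀ * (J * J) * (2 * (T + T))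
budget i refl refl T = solve 2 (λ t i → let j = con 2 :+ i ; s = con 3 :+ i ; e = j :* j :* s in
  s :* (t :* (con 2 :* j :* e :+ con 2 :* e :* i :+ con 2 :* j :* s)) :+ t :* (con 2 :* j :* s :* (con 1 :+ i)) :=
  e :* (j :* j) :* (con 2 :* (t :+ t))) refl T i
  where open +-*-Solver

-- The weights i/J and 2/J are 1 - μ and μ for μ = 2/J.
average : ∀ i {J} → J ≡ 2 + i → ∀ y → J * J * y ≡ i * (J * y) + 2 * J * y
average i refl y = solve 2 (λ i y → (con 2 :+ i) :* (con 2 :+ i) :* y := i :* ((con 2 :+ i) :* y) :+ con 2 :* (con 2 :+ i) :* y) refl i y
  where open +-*-Solver

-- Writing μ = 2 / J, a set without lines of H′ has density at most μ − μ² / 2 + O(1 / E₀) in S′, and E₀ is chosen to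
-- bring this below 2 / (J + 1).  There are so many copies in a row that g of them with a line in U exclude the vertex of
-- this row from all but a fraction 1 / E₀ of the copies κ.
module Thinning {q t r : ℕ} (X : CliqueColouring q t (suc r)) (S : Structure q t)
                (G : Lines S (λ a b → χ X (suc a) (suc b))) (H : Lines S (χ X)) (i J E₀ g d k : ℕ)
                (J≡ : J ≡ 2 + i) (E≡ : E₀ ≡ J * J * suc J) (g≡ : g ≡ suc (pred (card (lines G)) * E₀)) (d≡ : d ≡ g * E₀)
                (1≤d : 1 ≤ d) (1≤L : 1 ≤ card (lines G)) (k-large : E₀ ≤ k) (G-thin : Thin G k 1) (H-thin : Thin H J 2) where

  open Amalgam X S G d 1≤d 1≤L public

  H′ : Lines S′ (χ X)
  H′ = union (copied H) new

  module _ (U : V′ → Bool) (¬hit : ¬ Hit H′ U) where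

    xs : V S → Fin d → ℕ
    xs h j = count S (row U h j)

    ys : Choice → ℕ
    ys κ = count S (copy-of U κ)

    x-thin : ∀ h j → J * xs h j ≤ 2 * W
    x-thin h j = H-thin (row U h j) λ (l , p) → ¬hit (inj₁ (inj₁ (h , j , l)) , p)

    y-thin : ∀ κ → J * ys κ ≤ 2 * W
    y-thin κ = H-thin (copy-of U κ) λ (l , p) → ¬hit (inj₁ (inj₂ (κ , l)) , p)

    chosen : ∀ {h j} → Dec (Hit G (row U h j)) → Maybe (Fin L)
    chosen (yes (l , _)) = just (index (lines G) l)
    chosen (no _) = nothing

    choice : V S → Fin d → Maybe (Fin L)
    choice h j = chosen (hit? G (row U h j))

    x-slot : ∀ h j → E₀ * xs h j ≤ W + defined (choice h j) * (E₀ * W)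
    x-slot h j with hit? G (row U h j)
    ... | yes _ = ℕ.≤-trans (ℕ.*-monoʳ-≤ E₀ (count≤weight S (row U h j))) (ℕ.≤-trans (ℕ.m≤n+m (E₀ * W) W) (ℕ.≤-reflexive (cong (W +_) (sym (ℕ.+-identityʳ _)))))
    ... | no ¬p = ℕ.≤-trans (ℕ.*-monoˡ-≤ (xs h j) k-large) (G-thin (row U h j) ¬p)

    rich : V S → ℕ
    rich h = ∑ (allFin d) (defined ∘ choice h)

    γ β : V S → ℕ
    γ h with g ≤? rich h
    ... | yes _ = 1
    ... | no _ = 0
    β h with g ≤? rich h
    ... | yes _ = 0
    ... | no _ = 1

    γ+β : ∀ h → γ h + β h ≡ 1
    γ+β h with g ≤? rich h
    ... | yes _ = refl
    ... | no _ = refl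

    chosen-line : ∀ {h j} (D : Dec (Hit G (row U h j))) κ → chosen D ≡ just (Vec.lookup κ j) → ∀ a → U (inj₁ (h , j , at G (line κ j) a)) ≡ true
    chosen-line {h} {j} (yes (l , p)) κ e a = subst (λ l → U (inj₁ (h , j , at G l a)) ≡ true)
      (trans (sym (element-index (lines G) l)) (cong (element (lines G)) (just-injective e))) (p a)

    -- U misses the vertex h of the copy κ when κ contains the chosen line of a copy in the row h.
    avoiding : ∀ h κ → [ copy-of U κ h ] ≤ avoids (choice h) κ
    avoiding h κ with avoids-cases (choice h) κ
    ... | inj₁ e = ℕ.≤-trans [ copy-of U κ h ]≤1 (ℕ.≤-reflexive (sym e))
    ... | inj₂ (j , e) with U (inj₂ (κ , h)) in eq
    ...   | false = z≤n
    ...   | true = ⊥-elim (¬hit (inj₂ (κ , h , j) , λ { zero → eq ; (suc a) → chosen-line (hit? G (row U h j)) κ e a }))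

    few : ∀ h → E₀ * (γ h * ∑ (vectors L d) (λ κ → [ copy-of U κ h ])) ≤ Λ
    few h with g ≤? rich h
    ... | no _ = ℕ.≤-trans (ℕ.≤-reflexive (ℕ.*-zeroʳ E₀)) z≤n
    ... | yes le = ℕ.≤-trans (ℕ.*-monoʳ-≤ E₀ (ℕ.≤-trans (ℕ.≤-reflexive (ℕ.+-identityʳ _)) (∑-mono (vectors L d) (avoiding h)))) (few-avoid E₀ L d (choice h) (ℕ.≤-trans (ℕ.≤-reflexive (sym g≡)) le))

    Xs : V S → ℕ
    Xs h = ∑ (allFin d) (xs h)

    -- A rich row has density at most 2/J copy by copy. In any other row fewer than `g` of the `d`
    -- copies contain a line of `G` in `U`, a fraction of at most 1/E₀, and the remaining ones have
    -- density at most 1/k ≤ 1/E₀; hence the 2.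
    row-bound : ∀ h → E₀ * (J * J * Xs h) ≤ γ h * (E₀ * J * (d * (2 * W))) + J * J * (2 * (d * W))
    row-bound h with g ≤? rich h
    ... | yes _ = begin
      E₀ * (J * J * Xs h)                         ≡⟨ solve 3 (λ e j x → e :* (j :* j :* x) := e :* j :* (j :* x)) refl E₀ J (Xs h) ⟩
      E₀ * J * (J * Xs h)                         ≡⟨ cong (E₀ * J *_) (sym (∑-* J (allFin d) (xs h))) ⟩
      E₀ * J * ∑ (allFin d) (λ j → J * xs h j)    ≤⟨ ℕ.*-monoʳ-≤ (E₀ * J) (∑-mono (allFin d) (x-thin h)) ⟩
      E₀ * J * ∑ (allFin d) (λ j → 2 * W)         ≡⟨ cong (E₀ * J *_) (∑-allFin-const d (2 * W)) ⟩
      E₀ * J * (d * (2 * W))                      ≡⟨ sym (ℕ.+-identityʳ _) ⟩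
      1 * (E₀ * J * (d * (2 * W)))                ≤⟨ ℕ.m≤m+n _ _ ⟩
      1 * (E₀ * J * (d * (2 * W))) + J * J * (2 * (d * W)) ∎
      where
      open ℕ.≤-Reasoning
      open +-*-Solver
    ... | no ¬le = begin
      E₀ * (J * J * Xs h)                                                           ≡⟨ solve 3 (λ e j x → e :* (j :* j :* x) := j :* j :* (e :* x)) refl E₀ J (Xs h) ⟩
      J * J * (E₀ * Xs h)                                                           ≡⟨ cong (J * J *_) (sym (∑-* E₀ (allFin d) (xs h))) ⟩
      J * J * ∑ (allFin d) (λ j → E₀ * xs h j)                                      ≤⟨ ℕ.*-monoʳ-≤ (J * J) (∑-mono (allFin d) (x-slot h)) ⟩
      J * J * ∑ (allFin d) (λ j → W + defined (choice h j) * (E₀ * W))              ≡⟨ cong (J * J *_) slots-sum ⟩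
      J * J * (d * W + E₀ * W * rich h)                                             ≤⟨ ℕ.*-monoʳ-≤ (J * J) (ℕ.+-monoʳ-≤ (d * W) (ℕ.*-monoʳ-≤ (E₀ * W) (ℕ.<⇒≤ (ℕ.≰⇒> ¬le)))) ⟩
      J * J * (d * W + E₀ * W * g)                                                  ≡⟨ cong (λ d → J * J * (d * W + E₀ * W * g)) d≡ ⟩
      J * J * (g * E₀ * W + E₀ * W * g)                                             ≡⟨ solve 4 (λ j g e w → j :* j :* (g :* e :* w :+ e :* w :* g) := j :* j :* (con 2 :* (g :* e :* w))) refl J g E₀ W ⟩
      J * J * (2 * (g * E₀ * W))                                                    ≡⟨ cong (λ d → J * J * (2 * (d * W))) (sym d≡) ⟩
      J * J * (2 * (d * W)) ∎
      where
      open ℕ.≤-Reasoning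
      open +-*-Solver
      slots-sum : ∑ (allFin d) (λ j → W + defined (choice h j) * (E₀ * W)) ≡ d * W + E₀ * W * rich h
      slots-sum = trans (∑-+ (allFin d) (λ _ → W) _) (cong₂ _+_ (∑-allFin-const d W)
        (trans (∑-cong (allFin d) λ j → ℕ.*-comm (defined (choice h j)) (E₀ * W)) (∑-* (E₀ * W) (allFin d) (defined ∘ choice h))))

    A B Gs Xtotal Ytotal : ℕ
    A = ∑ (vs S) γ
    B = ∑ (vs S) β
    Gs = ∑ (vectors L d) λ κ → ∑ (vs S) λ h → γ h * [ copy-of U κ h ]
    Xtotal = ∑ (vs S) Xs
    Ytotal = ∑ (vectors L d) ys

    A+B : A + B ≡ W
    A+B = trans (sym (∑-+ (vs S) γ β)) (trans (∑-cong (vs S) γ+β) (∑-one (vs S)))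

    Xtotal-bound : E₀ * (J * J * Xtotal) ≤ A * (E₀ * J * (d * (2 * W))) + W * (J * J * (2 * (d * W)))
    Xtotal-bound = begin
      E₀ * (J * J * Xtotal)                                        ≡⟨ trans (cong (E₀ *_) (sym (∑-* (J * J) (vs S) Xs))) (sym (∑-* E₀ (vs S) _)) ⟩
      ∑ (vs S) (λ h → E₀ * (J * J * Xs h))                         ≤⟨ ∑-mono (vs S) row-bound ⟩
      ∑ (vs S) (λ h → γ h * c₁ + c₂)                               ≡⟨ ∑-+ (vs S) (λ h → γ h * c₁) (λ _ → c₂) ⟩
      ∑ (vs S) (λ h → γ h * c₁) + ∑ (vs S) (λ _ → c₂)              ≡⟨ cong₂ _+_ (trans (∑-cong (vs S) λ h → ℕ.*-comm (γ h) c₁) (trans (∑-* c₁ (vs S) γ) (ℕ.*-comm c₁ A))) (∑-const (vs S) c₂) ⟩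
      A * c₁ + W * c₂ ∎
      where
      open ℕ.≤-Reasoning
      c₁ = E₀ * J * (d * (2 * W))
      c₂ = J * J * (2 * (d * W))

    Gs-bound : E₀ * Gs ≤ W * Λ
    Gs-bound = begin
      E₀ * Gs                                                                       ≡⟨ cong (E₀ *_) (∑-swap (vectors L d) (vs S) _) ⟩
      E₀ * ∑ (vs S) (λ h → ∑ (vectors L d) λ κ → γ h * [ copy-of U κ h ])            ≡⟨ sym (∑-* E₀ (vs S) _) ⟩
      ∑ (vs S) (λ h → E₀ * ∑ (vectors L d) λ κ → γ h * [ copy-of U κ h ])            ≡⟨ ∑-cong (vs S) (λ h → cong (E₀ *_) (∑-* (γ h) (vectors L d) _)) ⟩
      ∑ (vs S) (λ h → E₀ * (γ h * ∑ (vectors L d) λ κ → [ copy-of U κ h ]))          ≤⟨ ∑-mono (vs S) few ⟩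
      ∑ (vs S) (λ _ → Λ)                                                            ≡⟨ ∑-const (vs S) Λ ⟩
      W * Λ ∎
      where open ℕ.≤-Reasoning

    y-split : ∀ κ → ys κ ≤ ∑ (vs S) (λ h → γ h * [ copy-of U κ h ]) + B
    y-split κ = ℕ.≤-trans (∑-mono (vs S) pointwise) (ℕ.≤-reflexive (∑-+ (vs S) _ β))
      where
      pointwise : ∀ h → [ copy-of U κ h ] ≤ γ h * [ copy-of U κ h ] + β h
      pointwise h with g ≤? rich h
      ... | yes _ = ℕ.≤-reflexive (sym (trans (ℕ.+-identityʳ _) (ℕ.+-identityʳ _)))
      ... | no _ = [ copy-of U κ h ]≤1

    -- The two bounds on ys κ are averaged with weights i and 2, which makes the sum of all bounds independent of A.
    Ytotal-bound : J * J * Ytotal ≤ Λ * (i * (2 * W)) + 2 * J * (Gs + Λ * B)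
    Ytotal-bound = begin
      J * J * Ytotal                                      ≡⟨ sym (∑-* (J * J) (vectors L d) ys) ⟩
      ∑ (vectors L d) (λ κ → J * J * ys κ)                ≤⟨ ∑-mono (vectors L d) pointwise ⟩
      ∑ (vectors L d) (λ κ → i * (2 * W) + 2 * J * (Gκ κ + B))   ≡⟨ ∑-+ (vectors L d) _ _ ⟩
      ∑ (vectors L d) (λ κ → i * (2 * W)) + ∑ (vectors L d) (λ κ → 2 * J * (Gκ κ + B))
        ≡⟨ cong₂ _+_ (vectors-const (i * (2 * W))) (trans (∑-* (2 * J) (vectors L d) _) (cong (2 * J *_) (trans (∑-+ (vectors L d) Gκ _) (cong (Gs +_) (vectors-const B))))) ⟩
      Λ * (i * (2 * W)) + 2 * J * (Gs + Λ * B) ∎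
      where
      open ℕ.≤-Reasoning
      open +-*-Solver
      Gκ : Choice → ℕ
      Gκ κ = ∑ (vs S) λ h → γ h * [ copy-of U κ h ]
      pointwise : ∀ κ → J * J * ys κ ≤ i * (2 * W) + 2 * J * (Gκ κ + B)
      pointwise κ = begin
        J * J * ys κ                            ≡⟨ average i J≡ (ys κ) ⟩
        i * (J * ys κ) + 2 * J * ys κ           ≤⟨ ℕ.+-mono-≤ (ℕ.*-monoʳ-≤ i (y-thin κ)) (ℕ.*-monoʳ-≤ (2 * J) (y-split κ)) ⟩
        i * (2 * W) + 2 * J * (Gκ κ + B) ∎

    c : ℕ
    c = count S′ U

    scaled : E₀ * (J * J * c) ≤ T * (2 * J * E₀ + 2 * E₀ * i + 2 * J * suc J)
    scaled = begin
      E₀ * (J * J * c)                                                     ≡⟨ cong (λ c → E₀ * (J * J * c)) (count′ U) ⟩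
      E₀ * (J * J * (Λ * Xtotal + d * W * Ytotal))                         ≡⟨ solve 6 (λ e j l x dw y → e :* (j :* (l :* x :+ dw :* y)) := l :* (e :* (j :* x)) :+ dw :* (e :* (j :* y))) refl E₀ (J * J) Λ Xtotal (d * W) Ytotal ⟩
      Λ * (E₀ * (J * J * Xtotal)) + d * W * (E₀ * (J * J * Ytotal))        ≤⟨ ℕ.+-mono-≤ (ℕ.*-monoʳ-≤ Λ Xtotal-bound) (ℕ.*-monoʳ-≤ (d * W) (ℕ.*-monoʳ-≤ E₀ Ytotal-bound)) ⟩
      Λ * xb + d * W * (E₀ * (Λ * (i * (2 * W)) + 2 * J * (Gs + Λ * B)))   ≡⟨ cong (λ z → Λ * xb + d * W * z) (solve 5 (λ e p j s lb → e :* (p :+ con 2 :* j :* (s :+ lb)) := e :* p :+ con 2 :* j :* (e :* s :+ e :* lb)) refl E₀ (Λ * (i * (2 * W))) J Gs (Λ * B)) ⟩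
      Λ * xb + d * W * (E₀ * (Λ * (i * (2 * W))) + 2 * J * (E₀ * Gs + E₀ * (Λ * B)))
        ≤⟨ ℕ.+-monoʳ-≤ (Λ * xb) (ℕ.*-monoʳ-≤ (d * W) (ℕ.+-monoʳ-≤ (E₀ * (Λ * (i * (2 * W)))) (ℕ.*-monoʳ-≤ (2 * J) (ℕ.+-monoˡ-≤ (E₀ * (Λ * B)) Gs-bound)))) ⟩
      Λ * xb + d * W * (E₀ * (Λ * (i * (2 * W))) + 2 * J * (W * Λ + E₀ * (Λ * B)))
        -- The rows contribute a term in `A` and the copies one in `B`, with the same coefficient;
        -- `A + B ≡ W` then removes both.
        ≡⟨ solve 8 (λ l a e j d w i b →
             l :* (a :* (e :* j :* (d :* (con 2 :* w))) :+ w :* (j :* j :* (con 2 :* (d :* w)))) :+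
               d :* w :* (e :* (l :* (i :* (con 2 :* w))) :+ con 2 :* j :* (w :* l :+ e :* (l :* b))) :=
             l :* (d :* w) :* (con 2 :* j :* e :* (a :+ b) :+ (con 2 :* e :* i :+ con 2 :* j :* (con 1 :+ j)) :* w)) refl Λ A E₀ J d W i B ⟩
      Λ * (d * W) * (2 * J * E₀ * (A + B) + (2 * E₀ * i + 2 * J * suc J) * W)     ≡⟨ cong (λ z → Λ * (d * W) * (2 * J * E₀ * z + (2 * E₀ * i + 2 * J * suc J) * W)) A+B ⟩
      Λ * (d * W) * (2 * J * E₀ * W + (2 * E₀ * i + 2 * J * suc J) * W)           ≡⟨ solve 4 (λ p q r w → p :* (q :* w :+ r :* w) := p :* w :* (q :+ r)) refl (Λ * (d * W)) (2 * J * E₀) (2 * E₀ * i + 2 * J * suc J) W ⟩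
      T * (2 * J * E₀ + (2 * E₀ * i + 2 * J * suc J))                             ≡⟨ cong (T *_) (sym (ℕ.+-assoc (2 * J * E₀) _ _)) ⟩
      T * (2 * J * E₀ + 2 * E₀ * i + 2 * J * suc J) ∎
      where
      open ℕ.≤-Reasoning
      open +-*-Solver
      xb = A * (E₀ * J * (d * (2 * W))) + W * (J * J * (2 * (d * W)))

    positive : ∀ {J E₀} → J ≡ 2 + i → E₀ ≡ J * J * suc J → NonZero (E₀ * (J * J))
    positive refl refl = _

    thinner : suc J * c ≤ 2 * length vs′
    thinner = ℕ.*-cancelˡ-≤ (E₀ * (J * J)) {{positive J≡ E≡}} (begin
      E₀ * (J * J) * (suc J * c)                                             ≡⟨ solve 4 (λ e j s c → e :* j :* (s :* c) := s :* (e :* (j :* c))) refl E₀ (J * J) (suc J) c ⟩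
      suc J * (E₀ * (J * J * c))                                             ≤⟨ ℕ.*-monoʳ-≤ (suc J) scaled ⟩
      suc J * (T * (2 * J * E₀ + 2 * E₀ * i + 2 * J * suc J))                ≤⟨ ℕ.m≤m+n _ (T * (2 * J * suc J * suc i)) ⟩
      suc J * (T * (2 * J * E₀ + 2 * E₀ * i + 2 * J * suc J)) + T * (2 * J * suc J * suc i)
        ≡⟨ budget i J≡ E≡ T ⟩
      E₀ * (J * J) * (2 * (T + T))                                           ≡⟨ cong (λ z → E₀ * (J * J) * (2 * z)) (sym weight′) ⟩
      E₀ * (J * J) * (2 * length vs′) ∎)
      where
      open ℕ.≤-Reasoning
      open +-*-Solver

  H′-thin : Thin H′ (suc J) 2
  H′-thin U ¬hit = thinner U ¬hit

  G′-thin : Thin (copied G) k 1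
  G′-thin = copied-thin G {k} {1} G-thin

-- Iterating the decrease

open Structure
open Lines

-- The vertex `zero` is dropped because in the amalgam its role falls to the vertices of the copies
-- κ, placed above lines for the others.
restrict : ∀ {q t r} → CliqueColouring q t (suc r) → CliqueColouring q t r
restrict X = record { χ = λ a b → χ X (suc a) (suc b) ; χ-sym = λ a b → χ-sym X (suc a) (suc b)
  ; χ-free = λ j f p → χ-free X j (suc ∘ f) λ ne → (λ e → proj₁ (p ne) (F.suc-injective e)) , proj₂ (p ne) }

singleton : ∀ {q t} → 2 ≤ t → Structure q t
singleton 2≤t = record { V = Fin 1 ; finite = finite-Fin 1 ; vs = zero ∷ [] ; nonempty = ℕ.≤-refl
  ; E = λ _ _ _ → ⊥ ; E? = λ _ _ → no λ () ; E-sym = λ _ _ () ; E-irrefl = λ _ () ; E-free = free 2≤t }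
  where
  free : ∀ {q t} → 2 ≤ t → (c : Fin q) (f : Fin t → Fin 1) → ¬ (∀ {u v : Fin t} → u ≢ v → ⊥)
  free (s≤s (s≤s _)) c f p = p {zero} {suc zero} λ ()

-- Without a line, the whole vertex set would have density at most 1/k < 1.
lines-exist : ∀ {q t r} {S : Structure q t} {χ : Fin r → Fin r → Fin q} (G : Lines S χ) {k} → 2 ≤ k → Thin G k 1 → 1 ≤ card (lines G)
lines-exist {S = S} G {k} 2≤k thin with hit? G (λ _ → true)
... | yes (l , _) = ℕ.≤-trans (s≤s z≤n) (F.toℕ<n (index (lines G) l))
... | no ¬hit = ⊥-elim (ℕ.<⇒≱ (ℕ.m<m+n (weight S) (nonempty S)) (begin
  weight S + weight S            ≡⟨ cong (weight S +_) (sym (ℕ.+-identityʳ _)) ⟩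
  2 * weight S                   ≤⟨ ℕ.*-monoˡ-≤ (weight S) 2≤k ⟩
  k * weight S                   ≡⟨ cong (k *_) (sym (∑-one (vs S))) ⟩
  k * count S (λ _ → true)       ≤⟨ thin (λ _ → true) ¬hit ⟩
  1 * weight S                   ≡⟨ ℕ.+-identityʳ _ ⟩
  weight S ∎))
  where open ℕ.≤-Reasoning

-- The value of `E₀` in `Thinning` for `J = 2 + i`.
cost : ℕ → ℕ
cost i = (2 + i) * (2 + i) * (3 + i)

cost-mono : ∀ {i j} → i ≤ j → cost i ≤ cost j
cost-mono le = ℕ.*-mono-≤ (ℕ.*-mono-≤ (s≤s (s≤s le)) (s≤s (s≤s le))) (s≤s (s≤s (s≤s le)))

record Stage {q t r : ℕ} (X : CliqueColouring q t (suc r)) (k m : ℕ) : Set₁ where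
  field
    S : Structure q t
    G : Lines S (χ (restrict X))
    H : Lines S (χ X)
    G-thin : Thin G k 1
    H-thin : Thin H m 2

advance : ∀ {q t r} {X : CliqueColouring q t (suc r)} {k} i → cost i ≤ k → Stage X k (2 + i) → Stage X k (3 + i)
advance {X = X} {k} i le st = record { S = S′ ; G = copied G ; H = H′ ; G-thin = G′-thin ; H-thin = H′-thin }
  where
  open Stage st
  open Thinning X S G H i (2 + i) (cost i) _ _ k refl refl refl refl (s≤s z≤n)
    (lines-exist G (ℕ.≤-trans (ℕ.≤-trans (s≤s (s≤s z≤n)) (cost-mono {0} z≤n)) le) G-thin) le G-thin H-thin

-- At `J = 2` the density bound is 1, so the iteration may start with an empty family of lines for
-- `X`. The lines `G` keep their density throughout, hence they have to be thin enough for the most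
-- expensive step from the outset.
stage : ∀ {q t r} (X : CliqueColouring q t (suc r)) (S : Structure q t) {i} (G : Lines S (χ (restrict X))) → Thin G (cost i) 1 →
        ∀ j → j ≤ i → Stage X (cost i) (2 + j)
stage X S G thin zero _ = record { S = S ; G = G
  ; H = record { Line = Fin 0 ; lines = finite-Fin 0 ; at = λ () ; joined = λ () ; faithful = λ () }
  ; G-thin = thin ; H-thin = λ U _ → ℕ.*-monoʳ-≤ 2 (count≤weight S U) }
stage X S {i} G thin (suc j) lt = advance j (cost-mono (ℕ.<⇒≤ lt)) (stage X S {i} G thin j (ℕ.<⇒≤ lt))

record Dense {q t r : ℕ} (X : CliqueColouring q t r) (k : ℕ) : Set₁ where
  field
    S : Structure q t
    G : Lines S (χ X)
    thin : Thin G k 1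

-- Reaching `J = 2 + 2 * k` gives the density 2/(2 + 2k) ≤ 1/k. The structure for one vertex less
-- supplies the lines `G`, thin enough for all these steps.
dense : ∀ {q t} → 2 ≤ t → ∀ r (X : CliqueColouring q t r) k → Dense X k
dense 2≤t zero X k = record { S = singleton 2≤t ; thin = λ U ¬hit → ⊥-elim (¬hit (zero , λ ()))
  ; G = record { Line = Fin 1 ; lines = finite-Fin 1 ; at = λ _ () ; joined = λ _ {} ; faithful = λ _ {} } }
dense 2≤t (suc r) X k = record { S = Stage.S st ; G = Stage.H st ; thin = λ U ¬hit → ℕ.*-cancelˡ-≤ 2 (begin
    2 * (k * count (Stage.S st) U)               ≡⟨ sym (ℕ.*-assoc 2 k _) ⟩
    2 * k * count (Stage.S st) U                 ≤⟨ ℕ.*-monoˡ-≤ _ (ℕ.m≤n+m (2 * k) 2) ⟩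
    (2 + 2 * k) * count (Stage.S st) U           ≤⟨ Stage.H-thin st U ¬hit ⟩
    2 * weight (Stage.S st)                      ≡⟨ cong (2 *_) (sym (ℕ.+-identityʳ (weight (Stage.S st)))) ⟩
    2 * (1 * weight (Stage.S st)) ∎) }
  where
  open ℕ.≤-Reasoning
  base : Dense (restrict X) (cost (2 * k))
  base = dense 2≤t r (restrict X) (cost (2 * k))
  st : Stage X (cost (2 * k)) (2 + 2 * k)
  st = stage X (Dense.S base) (Dense.G base) (Dense.thin base) (2 * k) ℕ.≤-refl

-- Blowing up a structure to the required number of positions

Σ-lookup : ∀ {A : Set} (xs : List A) (f : A → ℕ) → Σ[ f ∘ lookup xs ] ≡ ∑ xs f
Σ-lookup [] f = refl
Σ-lookup (x ∷ xs) f = trans (Σ-suc {length xs} (f ∘ lookup (x ∷ xs))) (cong (f x +_) (Σ-lookup xs f))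

record Blowup (q₁ q₂ t ρ a b : ℕ) : Set₁ where
  field
    n : ℕ
    pattern′ : Pattern q₁ q₂ t ρ n
    small : b * n ≤ (b + a) * q₁
    large : q₁ ≤ n

module _ {q₂ t ρ : ℕ} (X : CliqueColouring q₂ t ρ) (2≤t : 2 ≤ t) (b : ℕ) (1≤b : 1 ≤ b) where

  -- With n about (1 + 1/b) q₁, a set of n - q₁ positions has density about 1/(b + 1); aiming at
  -- 1/(2b + 1) leaves room for rounding.
  open Dense (dense 2≤t ρ X (suc (2 * b)))

  private
    instance
      bW≢0 : NonZero (b * weight S)
      bW≢0 = >-nonZero (ℕ.*-mono-≤ 1≤b (nonempty S))

  -- From here on, rounding `n` down to a multiple of the weight costs less than `b * weight S`,
  -- which is at most q₁/2, in `b * n`.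
  threshold : ℕ
  threshold = 2 * (b * weight S)

  module _ (q₁ : ℕ) (q₁-large : threshold ≤ q₁) where

    private
      -- The largest number of copies with `b * N ≤ suc b * q₁`. Only the excess 1/b is aimed at,
      -- which is at most a/b.
      W m : ℕ
      W = weight S
      m = (suc b * q₁) / (b * W)

      positions : List (V S)
      positions = copies m (vs S)

      N : ℕ
      N = length positions

      N≡ : N ≡ m * W
      N≡ = trans (sym (∑-one positions)) (trans (∑-copies m (vs S) _) (cong (m *_) (∑-one (vs S))))

      bN≡ : b * N ≡ m * (b * W)
      bN≡ = trans (cong (b *_) N≡) (solve 3 (λ b m w → b :* (m :* w) := m :* (b :* w)) refl b m W)
        where open +-*-Solver

      bN-upper : b * N ≤ suc b * q₁
      bN-upper = ℕ.≤-trans (ℕ.≤-reflexive bN≡) (m/n*n≤m (suc b * q₁) (b * W))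

      bN-lower : suc b * q₁ < b * N + b * W
      bN-lower = ℕ.≤-<-trans (ℕ.≤-reflexive (trans (m≡m%n+[m/n]*n (suc b * q₁) (b * W)) (trans (ℕ.+-comm ((suc b * q₁) % (b * W)) _) (cong (_+ (suc b * q₁) % (b * W)) (sym bN≡)))))
        (ℕ.+-monoʳ-< (b * N) (m%n<n (suc b * q₁) (b * W)))

      q₁≤N : q₁ ≤ N
      q₁≤N = ℕ.*-cancelˡ-≤ b {{>-nonZero 1≤b}} (ℕ.+-cancelˡ-≤ q₁ _ _ (begin
        q₁ + b * q₁         ≤⟨ ℕ.<⇒≤ bN-lower ⟩
        b * N + b * W       ≤⟨ ℕ.+-monoʳ-≤ (b * N) (ℕ.≤-trans (ℕ.m≤m+n (b * W) _) q₁-large) ⟩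
        b * N + q₁          ≡⟨ ℕ.+-comm (b * N) q₁ ⟩
        q₁ + b * N ∎))
        where open ℕ.≤-Reasoning

      v : Fin N → V S
      v = lookup positions

      module _ (U : Fin N → Bool) (U-large : N ≤ q₁ + Σ[ (λ s → if U s then 1 else 0) ]) where

        marked? : ∀ x → Dec (∃ λ s → v s ≡ x × U s ≡ true)
        marked? x = F.any? λ s → finite-≟ (finite S) (v s) x ×-dec (U s 𝔹.≟ true)

        marked : V S → Bool
        marked x = ⌊ marked? x ⌋

        u : ℕ
        u = Σ[ (λ s → if U s then 1 else 0) ]

        u≤ : u ≤ m * count S marked
        u≤ = ℕ.≤-trans (Σ-mono le) (ℕ.≤-reflexive (trans (Σ-lookup positions λ x → [ marked x ]) (∑-copies m (vs S) _)))
          where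
          le : ∀ s → (if U s then 1 else 0) ≤ [ marked (v s) ]
          le s with U s in eq
          ... | false = z≤n
          ... | true = ℕ.≤-reflexive (cong [_] (sym (⌊⌋-complete (marked? (v s)) (s , refl , eq))))

        -- If the marked vertices contained no line, then (2b + 1) u ≤ N ≤ q₁ + u and so 2 b u ≤ q₁.
        -- This is too few for N ≤ q₁ + u, as `b * N` is larger than (b + 1) q₁ - b W.
        crowded : ¬ suc (2 * b) * count S marked ≤ 1 * W
        crowded le = ℕ.<-irrefl refl (ℕ.+-cancelˡ-< (2 * (b * q₁)) _ _ (begin-strict
          2 * (b * q₁) + 2 * q₁                         ≡⟨ solve 2 (λ b q → con 2 :* (b :* q) :+ con 2 :* q := con 2 :* ((con 1 :+ b) :* q)) refl b q₁ ⟩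
          2 * (suc b * q₁)                              <⟨ ℕ.*-monoʳ-< 2 bN-lower ⟩
          2 * (b * N + b * W)                           ≤⟨ ℕ.*-monoʳ-≤ 2 (ℕ.+-monoˡ-≤ (b * W) (ℕ.*-monoʳ-≤ b U-large)) ⟩
          2 * (b * (q₁ + u) + b * W)                    ≡⟨ solve 4 (λ b q u w → con 2 :* (b :* (q :+ u) :+ b :* w) := con 2 :* (b :* q) :+ (con 2 :* b :* u :+ con 2 :* (b :* w))) refl b q₁ u W ⟩
          2 * (b * q₁) + (2 * b * u + 2 * (b * W))      ≤⟨ ℕ.+-monoʳ-≤ (2 * (b * q₁)) (ℕ.+-mono-≤ few q₁-large) ⟩
          2 * (b * q₁) + (q₁ + q₁)                      ≡⟨ cong (λ z → 2 * (b * q₁) + (q₁ + z)) (sym (ℕ.+-identityʳ q₁)) ⟩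
          2 * (b * q₁) + 2 * q₁ ∎))
          where
          open ℕ.≤-Reasoning
          open +-*-Solver
          few : 2 * b * u ≤ q₁
          few = ℕ.+-cancelˡ-≤ u _ _ (begin
            suc (2 * b) * u                             ≤⟨ ℕ.*-monoʳ-≤ (suc (2 * b)) u≤ ⟩
            suc (2 * b) * (m * count S marked)          ≡⟨ solve 3 (λ k m c → k :* (m :* c) := m :* (k :* c)) refl (suc (2 * b)) m (count S marked) ⟩
            m * (suc (2 * b) * count S marked)          ≤⟨ ℕ.*-monoʳ-≤ m le ⟩
            m * (1 * W)                                 ≡⟨ cong (m *_) (ℕ.+-identityʳ W) ⟩
            m * W                                       ≡⟨ sym N≡ ⟩
            N                                           ≤⟨ U-large ⟩
            q₁ + u                                      ≡⟨ ℕ.+-comm q₁ u ⟩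
            u + q₁ ∎)

        found : Dec (Hit G marked) → Σ (Fin ρ → Fin N) λ κ → (∀ a → U (κ a) ≡ true) × (∀ {a b} → a ≢ b → ∃ λ j → E S j (v (κ a)) (v (κ b)))
        found (no ¬hit) = ⊥-elim (crowded (thin marked ¬hit))
        found (yes (l , p)) = (λ a → proj₁ (mark a)) , (λ a → proj₂ (proj₂ (mark a))) , edge
          where
          mark : ∀ a → ∃ λ s → v s ≡ at G l a × U s ≡ true
          mark a = ⌊⌋-sound (marked? (at G l a)) (p a)
          edge : ∀ {a b} → a ≢ b → ∃ λ j → E S j (v (proj₁ (mark a))) (v (proj₁ (mark b)))
          edge {a} {b} ne rewrite proj₁ (proj₂ (mark a)) | proj₁ (proj₂ (mark b)) = χ X a b , joined G l ne

    blowup : ∀ {a} → 1 ≤ a → Blowup q₁ q₂ t ρ a b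
    blowup {a} 1≤a = record { n = N
      ; pattern′ = record { Joined = λ j s s′ → E S j (v s) (v s′) ; joined? = λ s s′ → E? S (v s) (v s′)
        ; symmetric = λ {j} {s} {s′} → E-sym S (v s) (v s′) ; irreflexive = λ {j} {s} → E-irrefl S (v s)
        ; clique-free = λ j f → E-free S j (v ∘ f) ; hits = λ U le → found U le (hit? G (marked U le)) }
      ; small = ℕ.≤-trans bN-upper (ℕ.*-monoˡ-≤ q₁ (ℕ.≤-trans (ℕ.≤-reflexive (ℕ.+-comm 1 b)) (ℕ.+-monoʳ-≤ b 1≤a)))
      ; large = q₁≤N }

-- The Ramsey threshold of complete graphs

lookup-⊆ : ∀ {A : Set} (ys : List A) i → lookup ys i ∷ [] ⊆ ys
lookup-⊆ (y ∷ ys) zero = refl ∷ minimum ys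
lookup-⊆ (y ∷ ys) (suc i) = y ∷ʳ lookup-⊆ ys i

lookup-pair-⊆ : ∀ {A : Set} (ys : List A) {i j} → i Fin.< j → lookup ys i ∷ lookup ys j ∷ [] ⊆ ys
lookup-pair-⊆ (y ∷ ys) {zero} {suc j} lt = refl ∷ lookup-⊆ ys j
lookup-pair-⊆ (y ∷ ys) {suc i} {suc j} (s≤s lt) = y ∷ʳ lookup-pair-⊆ ys lt

pair-unique : ∀ {A : Set} {x y : A} → Unique (x ∷ y ∷ []) → x ≢ y
pair-unique ((ne All.∷ _) ∷ _) = ne

monochromatic-pairs : ∀ {q t N} → RamseyNumber q 2 t N → Fin q → ∀ m → N ≤ m → CliqueRamsey q t m
monochromatic-pairs {q} {t} R j₀ m le c c-sym with R (allFin m) (ℕ.≤-trans le (ℕ.≤-reflexive (sym (length-tabulate id)))) colour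
  where
  colour : List (Fin m) → Fin q
  colour (x ∷ y ∷ _) = c x y
  -- A filler, since homogeneity is about lists of length two.
  colour _ = j₀
... | ys , ys⊆ , t≤ , k , hom = k , κ , κ-injective , λ {u} {v} ne → mono (F.<-cmp (ix u) (ix v)) (ne ∘ F.inject≤-injective t≤ t≤ u v)
  where
  ix : Fin t → Fin (length ys)
  ix u = inject≤ u t≤
  κ : Fin t → Fin m
  κ = lookup ys ∘ ix
  unique : Unique ys
  unique = AllPairs-⊆ ys⊆ (allFin⁺ m)
  lookup-apart : ∀ {i j} → i Fin.< j → lookup ys i ≢ lookup ys j
  lookup-apart lt = pair-unique (AllPairs-⊆ (lookup-pair-⊆ ys lt) unique)
  κ-injective : ∀ {u v} → κ u ≡ κ v → u ≡ v
  κ-injective {u} {v} e = F.inject≤-injective t≤ t≤ u v (go (F.<-cmp (ix u) (ix v)))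
    where
    go : Tri (ix u Fin.< ix v) (ix u ≡ ix v) (ix v Fin.< ix u) → ix u ≡ ix v
    go (tri< lt _ _) = ⊥-elim (lookup-apart lt e)
    go (tri≈ _ p _) = p
    go (tri> _ _ gt) = ⊥-elim (lookup-apart gt (sym e))
  mono : ∀ {i j} → Tri (i Fin.< j) (i ≡ j) (j Fin.< i) → i ≢ j → c (lookup ys i) (lookup ys j) ≡ k
  mono (tri< lt _ _) _ = hom (lookup-pair-⊆ ys lt) refl
  mono (tri≈ _ p _) ne = ⊥-elim (ne p)
  mono {i} {j} (tri> _ _ gt) _ = trans (c-sym (lookup ys i) (lookup ys j)) (hom (lookup-pair-⊆ ys gt) refl)

distinct-injective : ∀ {A : Set} {n} (f : Fin n → A) → (∀ {u v} → u ≢ v → f u ≢ f v) → ∀ {u v} → f u ≡ f v → u ≡ v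
distinct-injective f ne {u} {v} e with u F.≟ v
... | yes p = p
... | no u≢v = ⊥-elim (ne u≢v e)

module _ {q t : ℕ} where

  ramsey-or-colouring : ∀ m → CliqueRamsey q t m ⊎ CliqueColouring q t m
  ramsey-or-colouring m with ramsey? q (λ _ → complete t) (complete m)
  ... | inj₁ R = inj₁ λ c c-sym → let (j , κ , inj , mono) = R (c , c-sym) in
                 j , κ , inj , λ {u} {v} ne → proj₂ (mono u v (complete-adj {u = u} {v} ne))
  ... | inj₂ ((c , c-sym) , free) = inj₂ record { χ = c ; χ-sym = c-sym ; χ-free = λ j f p →
                 free j (f , distinct-injective f (λ ne → proj₁ (p ne)) ,
                   λ u v a → complete-adj {u = f u} {f v} (proj₁ (p (adj-complete {u = u} {v} a))) , proj₂ (p (adj-complete {u = u} {v} a))) }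

  exclusive : ∀ {m} → CliqueRamsey q t m → ¬ CliqueColouring q t m
  exclusive R X = let (j , κ , inj , mono) = R (χ X) (χ-sym X) in χ-free X j κ λ ne → ne ∘ inj , mono ne

  -- The largest complete graph that is not Ramsey, which has at least two vertices as t ≥ 3.
  critical : 3 ≤ t → Fin q → ∀ {N} → (∀ m → N ≤ m → CliqueRamsey q t m) →
             ∃ λ ρ → 1 ≤ ρ × CliqueColouring q t (suc ρ) × CliqueRamsey q t (suc (suc ρ))
  critical 3≤t j₀ {N} large = search N 1 ℕ.≤-refl (ℕ.m≤m+n N 2) record { χ = λ _ _ → j₀ ; χ-sym = λ _ _ → refl ; χ-free = λ j f p →
    ℕ.<⇒≱ 3≤t (F.injective⇒≤ {f = f} (distinct-injective f λ ne → proj₁ (p ne))) }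
    where
    -- The number `k` bounds the remaining steps: when it reaches zero, the graph has at least `N`
    -- vertices and is Ramsey, so it has no colouring `X`.
    search : ∀ k ρ → 1 ≤ ρ → N ≤ k + suc ρ → CliqueColouring q t (suc ρ) →
             ∃ λ ρ → 1 ≤ ρ × CliqueColouring q t (suc ρ) × CliqueRamsey q t (suc (suc ρ))
    search zero ρ _ le X = ⊥-elim (exclusive (large (suc ρ) le) X)
    search (suc k) ρ 1≤ρ le X = next (ramsey-or-colouring (suc (suc ρ)))
      where
      next : CliqueRamsey q t (suc (suc ρ)) ⊎ CliqueColouring q t (suc (suc ρ)) →
             ∃ λ ρ → 1 ≤ ρ × CliqueColouring q t (suc ρ) × CliqueRamsey q t (suc (suc ρ))
      next (inj₁ R) = ρ , 1≤ρ , X , R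
      next (inj₂ X′) = search k (suc ρ) (s≤s z≤n) (ℕ.≤-trans le (ℕ.≤-reflexive (sym (ℕ.+-suc k (suc ρ))))) X′

-- Parity of the cycle length and conclusion

f+f≡double : ∀ f → f + f ≡ double f
f+f≡double zero = refl
f+f≡double (suc f) = cong suc (trans (ℕ.+-suc f f) (cong suc (f+f≡double f)))

even-double : ∀ i → even (double i) ≡ true
even-double zero = refl
even-double (suc i) = cong (not ∘ not) (even-double i)

odd-double : ∀ i f → suc (double i) ≢ f + f
odd-double i f e with trans (sym (cong even (trans e (f+f≡double f)))) (cong not (even-double i))
... | e′ with trans (sym (even-double f)) e′
...   | ()

module _ {q₁ q₂ t ρ n m d : ℕ} (K : CliqueRamsey q₂ t (suc (suc ρ))) (j₀ : Fin q₂) (P : Pattern q₁ q₂ t (suc ρ) n)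
         (small : d * n ≤ m) where

  -- The cycle has length 4 + m₀ for the odd number m₀ = `suc (double i)`, the number of shifts
  -- between two new vertices.
  odd-bound : 3 ≤ t → ∀ i → sLeFrac (q₁ + q₂) (𝒯 q₁ q₂ (5 + double i) t) m d
  odd-bound 3≤t i = Finish.finish {q₁ = q₁} {L = 4 + double i} (OddSystem.system P j₀ (4 + double i)) j₀
    (OddSystem.ψ₀ P j₀ (4 + double i)) (OddSystem.no-cycle P j₀ (4 + double i) (odd-double (2 + i)) (s≤s z≤n))
    (OddSystem.no-clique P j₀ (4 + double i) 3≤t)
    (OddColours.forced P j₀ (suc (double i)) (cong not (even-double i)) K) {m} {d} small

module _ {Q q₂ t ρ n m d : ℕ} (X : CliqueColouring q₂ t (suc ρ)) (K : CliqueRamsey q₂ t (suc (suc ρ))) (j₀ : Fin q₂)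
         (P : Pattern (suc Q) q₂ t (suc ρ) n) (small : d * n ≤ m) where

  -- The cycle has `suc h` vertices in each class of its bipartition, with `h = suc i`.
  even-bound : 1 ≤ ρ → 3 ≤ n → ∀ i → sLeFrac (suc Q + q₂) (𝒯 (suc Q) q₂ (double (2 + i)) t) m d
  even-bound 1≤ρ 3≤n i = Finish.finish {q₁ = suc Q} {L = 3 + double i} (EvenSystem.system Q P X j₀) j₀
    (EvenSystem.ψ₀ Q P X j₀) (EvenSystem.no-cycle Q P X j₀ (s≤s (s≤s z≤n))) (EvenSystem.no-clique Q P X j₀)
    (EvenForced.forced Q P X j₀ K 1≤ρ 3≤n (suc i) (s≤s z≤n)) {m} {d} small

-- A real ε > 0 may be lowered to a positive rational a/b; the bound on δ then reads b δ ≤ (b + a)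
-- q₁.
theorem1p5 : ∀ (ℓ t q₂ : ℕ) → 4 ≤ ℓ → 3 ≤ t → 1 ≤ q₂ →
  ∀ (a b : ℕ) → 0 < a → 0 < b →
  ∃[ q₀ ] ∀ (q₁ : ℕ) → q₀ ≤ q₁ →
    sLeFrac (q₁ + q₂) (𝒯 q₁ q₂ ℓ t) ((b + a) * q₁) b
-- The additional 3 gives n ≥ q₁ ≥ 3, hence the third position that the even construction uses to
-- tell new vertices apart.
theorem1p5 ℓ t q₂ 4≤ℓ 3≤t 1≤q₂ a b 0<a 0<b = 3 + threshold X 2≤t b 0<b , bound
  where
  2≤t : 2 ≤ t
  2≤t = ℕ.<⇒≤ 3≤t
  j₀ : Fin q₂
  j₀ = fromℕ< 1≤q₂
  crit : ∃ λ ρ → 1 ≤ ρ × CliqueColouring q₂ t (suc ρ) × CliqueRamsey q₂ t (suc (suc ρ))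
  crit = critical 3≤t j₀ (monochromatic-pairs (proj₂ (ramsey q₂ 2 t)) j₀)
  X : CliqueColouring q₂ t (suc (proj₁ crit))
  X = proj₁ (proj₂ (proj₂ crit))
  K : CliqueRamsey q₂ t (suc (suc (proj₁ crit)))
  K = proj₂ (proj₂ (proj₂ crit))
  bound : ∀ q₁ → 3 + threshold X 2≤t b 0<b ≤ q₁ → sLeFrac (q₁ + q₂) (𝒯 q₁ q₂ ℓ t) ((b + a) * q₁) b
  bound (suc Q) le = by-parity (parity ℓ) 4≤ℓ
    where
    open Blowup (blowup X 2≤t b 0<b (suc Q) (ℕ.≤-trans (ℕ.m≤n+m _ 3) le) {a} 0<a)
    by-parity : ∀ {ℓ} → Parity ℓ → 4 ≤ ℓ → sLeFrac (suc Q + q₂) (𝒯 (suc Q) q₂ ℓ t) ((b + a) * suc Q) b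
    by-parity (isDouble (suc (suc i))) _ = even-bound {m = (b + a) * suc Q} {b} X K j₀ pattern′ small (proj₁ (proj₂ crit))
      (ℕ.≤-trans (ℕ.≤-trans (ℕ.m≤m+n 3 _) le) large) i
    by-parity (isSucDouble (suc (suc i))) _ = odd-bound {m = (b + a) * suc Q} {b} K j₀ pattern′ small 3≤t i
    by-parity (isDouble zero) ()
    by-parity (isDouble (suc zero)) (s≤s (s≤s ()))
    by-parity (isSucDouble zero) (s≤s ())
    by-parity (isSucDouble (suc zero)) (s≤s (s≤s (s≤s ())))
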